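{- Let $P$ be an $r$-differential poset and $Q$ an $s$-differential poset, with rank sizes $p_n$ and $q_n$ respectively. Suppose that $\Delta q_n\ge\Delta q_{n-1}$ for all $n\ge2$, and that all the down maps of at least one of $P$, $Q$ are surjective (over $\mathbb{Z}$). Then for the Cartesian product poset $P\times Q$ and every $n\ge0$, the matrix $[DU_n]+xI$ (where $DU_n$ is computed in $P\times Q$ and $I$ is the identity of size equal to the $n$-th rank size of $P\times Q$) has Smith normal form over $\mathbb{Z}[x]$.
   Context: For a positive integer $r$, a poset $P$ is $r$-differential if: (D1) $P$ is graded, locally finite, has all rank sizes finite and a unique minimum element; (D2) if two distinct elements of $P$ both cover exactly $k$ common elements, then exactly $k$ elements cover them both; (D3) if an element covers $k$ elements then it is covered by exactly $k+r$ elements. $P_n$ is the $n$-th rank (empty for $n<0$), $p_n=|P_n|$, $\Delta p_n=p_n-p_{n-1}$. $\mathbb{Z}P_n$ is the free $\mathbb{Z}$-module with basis $P_n$; $U_n:\mathbb{Z}P_n\to\mathbb{Z}P_{n+1}$ sends an element to the sum of all elements covering it, $D_n:\mathbb{Z}P_n\to\mathbb{Z}P_{n-1}$ sends an element to the sum of all elements it covers, $DU_n=D_{n+1}U_n$, and $[DU_n]$ is its matrix in the standard basis. $P\times Q$ is the product poset with componentwise order (it is $(r+s)$-differential). A matrix over a commutative ring $R$ has Smith normal form over $R$ if it can be multiplied on both sides by invertible matrices over $R$ to obtain a diagonal matrix whose diagonal entries satisfy $s_1\mid s_2\mid\cdots$. -}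

module Defs where

open import Algebra.Bundles using (CommutativeRing)
import Algebra.Properties.Semiring.Divisibility as Divisibility
import Algebra.Properties.Semiring.Sum as Sum
open import Data.Bool.Base using (if_then_else_)
open import Data.Fin.Base as Fin using (Fin; toℕ)
import Data.Fin.Properties as Fin
open import Data.Integer.Base as ℤ using (ℤ; +_; _⊖_; 0ℤ; 1ℤ)
import Data.Integer.Properties as ℤ
open import Data.List.Base using (List; []; _∷_; length; lookup; map; concat; applyUpTo; cartesianProduct)
import Data.List.Membership.Setoid as Membership
import Data.List.Membership.Setoid.Properties as Membershipₚ
import Data.List.Relation.Unary.All.Properties as All
import Data.List.Relation.Unary.AllPairs.Properties as AllPairs
open import Data.List.Relation.Unary.Any as Any using (here)
import Data.List.Relation.Unary.Any.Properties as Any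
import Data.List.Relation.Unary.Unique.Setoid as Unique
import Data.List.Relation.Unary.Unique.Setoid.Properties as Uniqueₚ
open import Data.Nat.Base as ℕ using (ℕ; zero; suc; s≤s)
import Data.Nat.Properties as ℕ
open import Data.Product.Base using (Σ; ∃; ∃₂; _×_; _,_; proj₁; proj₂)
open import Data.Product.Relation.Binary.Pointwise.NonDependent using (×-poset)
open import Data.Vec.Functional using (Vector)
open import Function.Base using (_∘_)
open import Function.Bundles using (_⇔_; mk⇔; Equivalence)
open import Function.Definitions using (Surjective)
open import Level using (_⊔_)
open import Relation.Binary.Bundles using (Setoid; Poset)
open import Relation.Binary.Core using (Rel; _Preserves_⟶_)
open import Relation.Binary.Definitions using (Decidable; Minimum)
import Relation.Binary.Construct.NonStrictToStrict as ToStrict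
import Relation.Binary.Properties.Poset as PosetProperties
import Relation.Binary.Reasoning.Setoid as SetoidReasoning
open import Relation.Binary.PropositionalEquality as ≡ using (_≡_; _≢_; _≗_)
open import Relation.Nullary using (¬_; Dec; yes; no; does; contradiction)
open import Relation.Nullary.Decidable using (_×-dec_)
open import Relation.Unary using (Pred)

record Finite {a ℓ p} (S : Setoid a ℓ) (φ : Pred (Setoid.Carrier S) p) : Set (a ⊔ ℓ ⊔ p) where
  open Membership S using (_∈_)
  open Unique S using (Unique)
  field
    elements : List (Setoid.Carrier S)
    unique   : Unique elements
    ∈⇔       : ∀ x → x ∈ elements ⇔ φ x

  size : ℕ
  size = length elements

HasSize : ∀ {a ℓ p} (S : Setoid a ℓ) → Pred (Setoid.Carrier S) p → ℕ → Set (a ⊔ ℓ ⊔ p)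
HasSize S φ k = Σ (Finite S φ) λ fin → Finite.size fin ≡ k

module _ {a ℓ₁ ℓ₂} (P : Poset a ℓ₁ ℓ₂) where
  open Poset P using (Carrier; _≈_; _≤_; module Eq)
  open PosetProperties P using (_<_)

  infix 4 _⋖_
  _⋖_ : Rel Carrier (a ⊔ ℓ₁ ⊔ ℓ₂)
  x ⋖ y = x < y × (∀ z → ¬ (x < z × z < y))

  -- Intervals are taken for all pairs x , y (they are empty unless x ≤ y).
  -- Uniqueness of the minimum is automatic by antisymmetry.
  record D1 : Set (a ⊔ ℓ₁ ⊔ ℓ₂) where
    field
      rank            : Carrier → ℕ
      rank-cong       : rank Preserves _≈_ ⟶ _≡_
      rank-mono       : rank Preserves _<_ ⟶ ℕ._<_
      rank-cover      : ∀ {x y} → x ⋖ y → rank y ≡ suc (rank x)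
      locally-finite  : ∀ x y → Finite Eq.setoid (λ z → x ≤ z × z ≤ y)
      ranks-finite    : ∀ n → Finite Eq.setoid (λ z → rank z ≡ n)
      0̂               : Carrier
      0̂-minimum       : Minimum _≤_ 0̂
      rank-0̂          : rank 0̂ ≡ 0

    rankSize : ℕ → ℕ
    rankSize n = Finite.size (ranks-finite n)

    basis : ∀ n → Fin (rankSize n) → Carrier
    basis n = lookup (Finite.elements (ranks-finite n))

  record IsDifferential (r : ℕ) : Set (a ⊔ ℓ₁ ⊔ ℓ₂) where
    field
      r-positive : 0 ℕ.< r
      d1 : D1
      d2 : ∀ x y k → ¬ (x ≈ y) →
           HasSize Eq.setoid (λ z → z ⋖ x × z ⋖ y) k →
           HasSize Eq.setoid (λ z → x ⋖ z × y ⋖ z) k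
      d3 : ∀ x k →
           HasSize Eq.setoid (λ z → z ⋖ x) k →
           HasSize Eq.setoid (λ z → x ⋖ z) (k ℕ.+ r)

    open D1 d1 public

Δ : (ℕ → ℕ) → ℕ → ℤ
Δ p zero    = + p zero
Δ p (suc n) = p (suc n) ⊖ p n

-- Decidability of the order and of the covering relation, which follows
-- from local finiteness.
module _ {a ℓ₁ ℓ₂} {P : Poset a ℓ₁ ℓ₂} (G : D1 P) where
  open Poset P
  open PosetProperties P using (_<_; <-resp-≈; ≤-dec⇒≈-dec)
  open Membership Eq.setoid using (lose)
  open D1 G

  private
    interval : Carrier → Carrier → List Carrier
    interval x y = Finite.elements (locally-finite x y)

  ≤-dec : Decidable _≤_
  ≤-dec x y with interval x y | Finite.∈⇔ (locally-finite x y)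
  ... | []    | ∈⇔ = no λ x≤y → contradiction (Equivalence.from (∈⇔ x) (refl , x≤y)) λ ()
  ... | z ∷ _ | ∈⇔ = let x≤z , z≤y = Equivalence.to (∈⇔ z) (here Eq.refl) in yes (trans x≤z z≤y)

  ≈-dec : Decidable _≈_
  ≈-dec = ≤-dec⇒≈-dec ≤-dec

  <-dec : Decidable _<_
  <-dec = ToStrict.<-decidable _≈_ _≤_ ≈-dec ≤-dec

  ⋖-dec : Decidable (_⋖_ P)
  ⋖-dec x y with <-dec x y
  ... | no  x≮y = no (x≮y ∘ proj₁)
  ... | yes x<y with Any.any? (λ z → <-dec x z ×-dec <-dec z y) (interval x y)
  ...   | yes between = let z , x<z<y = Any.satisfied between in no λ x⋖y → proj₂ x⋖y z x<z<y
  ...   | no ¬between = yes (x<y , λ z x<z<y → ¬between (lose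
            (λ u≈v (x<u , u<y) → proj₁ <-resp-≈ u≈v x<u , proj₂ <-resp-≈ u≈v u<y)
            (Equivalence.from (Finite.∈⇔ (locally-finite x y) z)
              (proj₁ (proj₁ x<z<y) , proj₁ (proj₂ x<z<y)))
            x<z<y))

indicator : ∀ {a} {A : Set a} → Dec A → ℤ
indicator d = if does d then 1ℤ else 0ℤ

unit : ∀ {m} → Fin m → Vector ℤ m
unit j i = indicator (i Fin.≟ j)

-- The ℤ-linear map sending the j-th basis vector to f j.
linear : ∀ {m k} → (Fin m → Vector ℤ k) → Vector ℤ m → Vector ℤ k
linear f v i = sum λ j → v j ℤ.* f j i
  where open Sum (CommutativeRing.semiring ℤ.+-*-commutativeRing) using (sum)

matrixOf : ∀ {m k} → (Vector ℤ m → Vector ℤ k) → Fin k → Fin m → ℤ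
matrixOf φ i j = φ (unit j) i

module _ {a ℓ₁ ℓ₂} {P : Poset a ℓ₁ ℓ₂} (G : D1 P) where
  open D1 G

  ℤ[Rank_] : ℕ → Set
  ℤ[Rank n ] = Vector ℤ (rankSize n)

  U : ∀ n → ℤ[Rank n ] → ℤ[Rank suc n ]
  U n = linear λ x y → indicator (⋖-dec G (basis n x) (basis (suc n) y))

  -- D n is the down map from rank suc n to rank n; the down map out of rank 0
  -- has codomain 0 and is omitted.
  D : ∀ n → ℤ[Rank suc n ] → ℤ[Rank n ]
  D n = linear λ y x → indicator (⋖-dec G (basis n x) (basis (suc n) y))

  DU : ∀ n → ℤ[Rank n ] → ℤ[Rank n ]
  DU n = D n ∘ U n

  DownMapsSurjective : Set
  DownMapsSurjective = ∀ n → Surjective _≗_ _≗_ (D n)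

module _ {a ℓ₁ ℓ₂ b ℓ₃ ℓ₄} {P : Poset a ℓ₁ ℓ₂} {Q : Poset b ℓ₃ ℓ₄} (G : D1 P) (H : D1 Q) where
  private
    module P = Poset P
    module Q = Poset Q
    module P< = PosetProperties P
    module Q< = PosetProperties Q
    module G = D1 G
    module H = D1 H
    P×Q : Poset (a ⊔ b) (ℓ₁ ⊔ ℓ₃) (ℓ₂ ⊔ ℓ₄)
    P×Q = ×-poset P Q
    module P×Q = Poset P×Q
    open PosetProperties P×Q using (_<_)
    open Membership P×Q.Eq.setoid using (_∈_)

    rank : P×Q.Carrier → ℕ
    rank (x , y) = G.rank x ℕ.+ H.rank y

    rank-mono : rank Preserves _<_ ⟶ ℕ._<_
    rank-mono {x , y} {x′ , y′} ((x≤x′ , y≤y′) , ≉) with ≈-dec G x x′ | ≈-dec H y y′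
    ... | yes x≈ | yes y≈ = contradiction (x≈ , y≈) ≉
    ... | yes x≈ | no  y≉ = ℕ.+-mono-≤-< (ℕ.≤-reflexive (G.rank-cong x≈)) (H.rank-mono (y≤y′ , y≉))
    ... | no  x≉ | yes y≈ = ℕ.+-mono-<-≤ (G.rank-mono (x≤x′ , x≉)) (ℕ.≤-reflexive (H.rank-cong y≈))
    ... | no  x≉ | no  y≉ = ℕ.+-mono-< (G.rank-mono (x≤x′ , x≉)) (H.rank-mono (y≤y′ , y≉))

    rank-cover : ∀ {u v} → _⋖_ P×Q u v → rank v ≡ suc (rank u)
    rank-cover {x , y} {x′ , y′} (((x≤x′ , y≤y′) , ≉) , none) with ≈-dec G x x′ | ≈-dec H y y′
    ... | yes x≈ | yes y≈ = contradiction (x≈ , y≈) ≉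
    ... | yes x≈ | no  y≉ = ≡.trans
      (≡.cong₂ ℕ._+_ (≡.sym (G.rank-cong x≈)) (H.rank-cover
        ((y≤y′ , y≉) , λ z ((y≤z , y≉z) , (z≤y′ , z≉y′)) →
          none (x , z) (((P.refl , y≤z) , y≉z ∘ proj₂) , ((x≤x′ , z≤y′) , z≉y′ ∘ proj₂)))))
      (ℕ.+-suc _ _)
    ... | no  x≉ | yes y≈ = ≡.cong₂ ℕ._+_
      (G.rank-cover ((x≤x′ , x≉) , λ z ((x≤z , x≉z) , (z≤x′ , z≉x′)) →
          none (z , y) (((x≤z , Q.refl) , x≉z ∘ proj₁) , ((z≤x′ , y≤y′) , z≉x′ ∘ proj₁))))
      (≡.sym (H.rank-cong y≈))
    ... | no  x≉ | no  y≉ = contradiction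
      (((x≤x′ , Q.refl) , x≉ ∘ proj₁) , ((P.refl , y≤y′) , y≉ ∘ proj₂))
      (none (x′ , y))

    ×-finite : ∀ {p q} {φ : Pred P.Carrier p} {ψ : Pred Q.Carrier q} →
               Finite P.Eq.setoid φ → Finite Q.Eq.setoid ψ →
               Finite P×Q.Eq.setoid (λ (x , y) → φ x × ψ y)
    ×-finite F F′ = record
      { elements = cartesianProduct F.elements F′.elements
      ; unique   = Uniqueₚ.cartesianProduct⁺ P.Eq.setoid Q.Eq.setoid F.unique F′.unique
      ; ∈⇔       = λ (x , y) → mk⇔
          (λ ∈xs → let x∈ , y∈ = Membershipₚ.∈-cartesianProduct⁻ P.Eq.setoid Q.Eq.setoid F.elements F′.elements ∈xs
                   in Equivalence.to (F.∈⇔ x) x∈ , Equivalence.to (F′.∈⇔ y) y∈)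
          (λ (φx , ψy) → Membershipₚ.∈-cartesianProduct⁺ P.Eq.setoid Q.Eq.setoid
                   (Equivalence.from (F.∈⇔ x) φx) (Equivalence.from (F′.∈⇔ y) ψy))
      }
      where
      module F  = Finite F
      module F′ = Finite F′

    locally-finite : ∀ u v → Finite P×Q.Eq.setoid (λ z → u P×Q.≤ z × z P×Q.≤ v)
    locally-finite (x , y) (x′ , y′) = record
      { elements = F.elements
      ; unique   = F.unique
      ; ∈⇔       = λ z → mk⇔
          (λ z∈ → let (x≤ , ≤x′) , (y≤ , ≤y′) = Equivalence.to (F.∈⇔ z) z∈ in (x≤ , y≤) , (≤x′ , ≤y′))
          (λ ((x≤ , y≤) , (≤x′ , ≤y′)) → Equivalence.from (F.∈⇔ z) ((x≤ , ≤x′) , (y≤ , ≤y′)))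
      }
      where module F = Finite (×-finite (G.locally-finite x x′) (H.locally-finite y y′))

    ranks-finite : ∀ n → Finite P×Q.Eq.setoid (λ z → rank z ≡ n)
    ranks-finite n = record
      { elements = concat (applyUpTo block (suc n))
      ; unique   = Uniqueₚ.concat⁺ P×Q.Eq.setoid
          (All.applyUpTo⁺₂ block (suc n) (λ i → Finite.unique (blockF i)))
          (AllPairs.applyUpTo⁺₁ block (suc n) λ i<j _ (v∈i , v∈j) →
            ℕ.<⇒≢ i<j (≡.trans (≡.sym (proj₁ (fromBlock v∈i))) (proj₁ (fromBlock v∈j))))
      ; ∈⇔       = λ z → mk⇔ to from
      }
      where
      blockF : ∀ i → Finite P×Q.Eq.setoid (λ (x , y) → G.rank x ≡ i × H.rank y ≡ n ℕ.∸ i)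
      blockF i = ×-finite (G.ranks-finite i) (H.ranks-finite (n ℕ.∸ i))

      block : ℕ → List P×Q.Carrier
      block i = Finite.elements (blockF i)

      fromBlock : ∀ {i z} → z ∈ block i → G.rank (proj₁ z) ≡ i × H.rank (proj₂ z) ≡ n ℕ.∸ i
      fromBlock {i} {z} = Equivalence.to (Finite.∈⇔ (blockF i) z)

      to : ∀ {z} → z ∈ concat (applyUpTo block (suc n)) → rank z ≡ n
      to z∈ with Any.applyUpTo⁻ block (Membershipₚ.∈-concat⁻ P×Q.Eq.setoid _ z∈)
      ... | i , s≤s i≤n , z∈i = let p , q = fromBlock z∈i in
        ≡.trans (≡.cong₂ ℕ._+_ p q) (ℕ.m+[n∸m]≡n i≤n)

      from : ∀ {z} → rank z ≡ n → z ∈ concat (applyUpTo block (suc n))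
      from {x , y} eq = Membershipₚ.∈-concat⁺ P×Q.Eq.setoid
        (Any.applyUpTo⁺ block
          (Equivalence.from (Finite.∈⇔ (blockF (G.rank x)) (x , y))
            (≡.refl , ≡.sym (≡.trans (≡.cong (ℕ._∸ G.rank x) (≡.sym eq)) (ℕ.m+n∸m≡n (G.rank x) (H.rank y)))))
          (s≤s (ℕ.m+n≤o⇒m≤o (G.rank x) (ℕ.≤-reflexive eq))))

  ×-D1 : D1 (×-poset P Q)
  ×-D1 = record
    { rank           = rank
    ; rank-cong      = λ (x≈ , y≈) → ≡.cong₂ ℕ._+_ (G.rank-cong x≈) (H.rank-cong y≈)
    ; rank-mono      = rank-mono
    ; rank-cover     = rank-cover
    ; locally-finite = locally-finite
    ; ranks-finite   = ranks-finite
    ; 0̂              = G.0̂ , H.0̂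
    ; 0̂-minimum      = λ (x , y) → G.0̂-minimum x , H.0̂-minimum y
    ; rank-0̂         = ≡.cong₂ ℕ._+_ G.rank-0̂ H.rank-0̂
    }

module _ {c ℓ} (R : CommutativeRing c ℓ) where
  open CommutativeRing R
  open Sum semiring using (sum)
  open Divisibility semiring using (_∣_)

  Matrix : ℕ → ℕ → Set c
  Matrix m n = Fin m → Fin n → Carrier

  infix 4 _≈ᴹ_
  _≈ᴹ_ : ∀ {m n} → Rel (Matrix m n) ℓ
  A ≈ᴹ B = ∀ i j → A i j ≈ B i j

  infixl 6 _+ᴹ_
  _+ᴹ_ : ∀ {m n} → Matrix m n → Matrix m n → Matrix m n
  (A +ᴹ B) i j = A i j + B i j

  infixl 7 _*ᴹ_
  _*ᴹ_ : ∀ {l m n} → Matrix l m → Matrix m n → Matrix l n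
  (A *ᴹ B) i k = sum λ j → A i j * B j k

  infixl 7 _·ᴹ_
  _·ᴹ_ : ∀ {m n} → Carrier → Matrix m n → Matrix m n
  (r ·ᴹ A) i j = r * A i j

  1ᴹ : ∀ {n} → Matrix n n
  1ᴹ i j = if does (i Fin.≟ j) then 1# else 0#

  Invertible : ∀ {n} → Matrix n n → Set (c ⊔ ℓ)
  Invertible A = ∃ λ B → (A *ᴹ B ≈ᴹ 1ᴹ) × (B *ᴹ A ≈ᴹ 1ᴹ)

  record IsSmith {m n} (S : Matrix m n) : Set (c ⊔ ℓ) where
    field
      diagonal : ∀ i j → toℕ i ≢ toℕ j → S i j ≈ 0#
      divides  : ∀ i j i′ j′ → toℕ i ≡ toℕ j → toℕ i′ ≡ toℕ j′ →
                 toℕ i′ ≡ suc (toℕ i) → S i j ∣ S i′ j′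

  HasSmithNormalForm : ∀ {m n} → Matrix m n → Set (c ⊔ ℓ)
  HasSmithNormalForm A = ∃₂ λ L N → Invertible L × Invertible N × IsSmith (L *ᴹ A *ᴹ N)

-- Polynomials in one variable, as coefficient lists (constant term first),
-- equal when all coefficients agree.
module Polynomial {c ℓ} (R : CommutativeRing c ℓ) where
  open CommutativeRing R
  private module ≈-Reasoning = SetoidReasoning setoid
  open import Algebra.Properties.Ring ring using (-0#≈0#)
  open import Algebra.Properties.CommutativeSemigroup +-commutativeSemigroup using (interchange)

  Poly : Set c
  Poly = List Carrier

  coeff : Poly → ℕ → Carrier
  coeff []      _       = 0#
  coeff (a ∷ p) zero    = a
  coeff (a ∷ p) (suc n) = coeff p n

  infix 4 _≈ₚ_
  record _≈ₚ_ (p q : Poly) : Set ℓ where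
    constructor coeffs
    field at : ∀ n → coeff p n ≈ coeff q n
  open _≈ₚ_ public

  const : Carrier → Poly
  const a = a ∷ []

  X : Poly
  X = 0# ∷ 1# ∷ []

  infixl 6 _+ₚ_
  _+ₚ_ : Poly → Poly → Poly
  []      +ₚ q       = q
  (a ∷ p) +ₚ []      = a ∷ p
  (a ∷ p) +ₚ (b ∷ q) = (a + b) ∷ (p +ₚ q)

  -ₚ_ : Poly → Poly
  -ₚ p = map (λ a → - a) p

  infixr 8 _∙ₚ_
  _∙ₚ_ : Carrier → Poly → Poly
  a ∙ₚ p = map (a *_) p

  infixl 7 _*ₚ_
  _*ₚ_ : Poly → Poly → Poly
  []      *ₚ q = []
  (a ∷ p) *ₚ q = a ∙ₚ q +ₚ (0# ∷ p *ₚ q)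

  coeff-+ : ∀ p q n → coeff (p +ₚ q) n ≈ coeff p n + coeff q n
  coeff-+ []      q       n       = sym (+-identityˡ _)
  coeff-+ (a ∷ p) []      n       = sym (+-identityʳ _)
  coeff-+ (a ∷ p) (b ∷ q) zero    = refl
  coeff-+ (a ∷ p) (b ∷ q) (suc n) = coeff-+ p q n

  coeff-neg : ∀ p n → coeff (-ₚ p) n ≈ - coeff p n
  coeff-neg []      n       = sym -0#≈0#
  coeff-neg (a ∷ p) zero    = refl
  coeff-neg (a ∷ p) (suc n) = coeff-neg p n

  coeff-∙ : ∀ a p n → coeff (a ∙ₚ p) n ≈ a * coeff p n
  coeff-∙ a []      n       = sym (zeroʳ a)
  coeff-∙ a (b ∷ p) zero    = refl
  coeff-∙ a (b ∷ p) (suc n) = coeff-∙ a p n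

  ≈ₚ-refl : ∀ {p} → p ≈ₚ p
  ≈ₚ-refl = coeffs λ _ → refl

  ≈ₚ-sym : ∀ {p q} → p ≈ₚ q → q ≈ₚ p
  ≈ₚ-sym e = coeffs λ n → sym (at e n)

  ≈ₚ-trans : ∀ {p q r} → p ≈ₚ q → q ≈ₚ r → p ≈ₚ r
  ≈ₚ-trans e f = coeffs λ n → trans (at e n) (at f n)

  ≈ₚ-setoid : Setoid c ℓ
  ≈ₚ-setoid = record
    { _≈_ = _≈ₚ_
    ; isEquivalence = record { refl = ≈ₚ-refl ; sym = ≈ₚ-sym ; trans = ≈ₚ-trans }
    }

  private module ≈ₚ-Reasoning = SetoidReasoning ≈ₚ-setoid

  ∷-cong : ∀ {a b p q} → a ≈ b → p ≈ₚ q → (a ∷ p) ≈ₚ (b ∷ q)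
  ∷-cong a≈b e = coeffs λ { zero → a≈b ; (suc n) → at e n }

  0∷[]≈[] : (0# ∷ []) ≈ₚ []
  0∷[]≈[] = coeffs λ { zero → refl ; (suc _) → refl }

  +ₚ-cong : ∀ {p p′ q q′} → p ≈ₚ p′ → q ≈ₚ q′ → (p +ₚ q) ≈ₚ (p′ +ₚ q′)
  +ₚ-cong {p} {p′} {q} {q′} e f = coeffs λ n →
    trans (coeff-+ p q n) (trans (+-cong (at e n) (at f n)) (sym (coeff-+ p′ q′ n)))

  +ₚ-assoc : ∀ p q r → ((p +ₚ q) +ₚ r) ≈ₚ (p +ₚ (q +ₚ r))
  +ₚ-assoc p q r = coeffs λ n → let open ≈-Reasoning in begin
    coeff (p +ₚ q +ₚ r) n               ≈⟨ coeff-+ (p +ₚ q) r n ⟩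
    coeff (p +ₚ q) n + coeff r n        ≈⟨ +-congʳ (coeff-+ p q n) ⟩
    coeff p n + coeff q n + coeff r n   ≈⟨ +-assoc _ _ _ ⟩
    coeff p n + (coeff q n + coeff r n) ≈⟨ +-congˡ (coeff-+ q r n) ⟨
    coeff p n + coeff (q +ₚ r) n        ≈⟨ coeff-+ p (q +ₚ r) n ⟨
    coeff (p +ₚ (q +ₚ r)) n             ∎

  +ₚ-comm : ∀ p q → (p +ₚ q) ≈ₚ (q +ₚ p)
  +ₚ-comm p q = coeffs λ n →
    trans (coeff-+ p q n) (trans (+-comm _ _) (sym (coeff-+ q p n)))

  +ₚ-identityʳ : ∀ p → (p +ₚ []) ≈ₚ p
  +ₚ-identityʳ p = +ₚ-comm p []

  -ₚ-cong : ∀ {p q} → p ≈ₚ q → (-ₚ p) ≈ₚ (-ₚ q)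
  -ₚ-cong {p} {q} e = coeffs λ n →
    trans (coeff-neg p n) (trans (-‿cong (at e n)) (sym (coeff-neg q n)))

  -ₚ-inverseˡ : ∀ p → ((-ₚ p) +ₚ p) ≈ₚ []
  -ₚ-inverseˡ p = coeffs λ n →
    trans (coeff-+ (-ₚ p) p n) (trans (+-congʳ (coeff-neg p n)) (-‿inverseˡ _))

  -ₚ-inverseʳ : ∀ p → (p +ₚ (-ₚ p)) ≈ₚ []
  -ₚ-inverseʳ p = ≈ₚ-trans (+ₚ-comm p (-ₚ p)) (-ₚ-inverseˡ p)

  +ₚ-interchange : ∀ p q r s → ((p +ₚ q) +ₚ (r +ₚ s)) ≈ₚ ((p +ₚ r) +ₚ (q +ₚ s))
  +ₚ-interchange p q r s = coeffs λ n → let open ≈-Reasoning in begin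
    coeff ((p +ₚ q) +ₚ (r +ₚ s)) n                      ≈⟨ expand p q r s n ⟩
    (coeff p n + coeff q n) + (coeff r n + coeff s n)   ≈⟨ interchange _ _ _ _ ⟩
    (coeff p n + coeff r n) + (coeff q n + coeff s n)   ≈⟨ expand p r q s n ⟨
    coeff ((p +ₚ r) +ₚ (q +ₚ s)) n                      ∎
    where
    expand : ∀ p q r s n → coeff ((p +ₚ q) +ₚ (r +ₚ s)) n ≈ (coeff p n + coeff q n) + (coeff r n + coeff s n)
    expand p q r s n = trans (coeff-+ (p +ₚ q) (r +ₚ s) n) (+-cong (coeff-+ p q n) (coeff-+ r s n))

  ∙ₚ-cong : ∀ {a b p q} → a ≈ b → p ≈ₚ q → (a ∙ₚ p) ≈ₚ (b ∙ₚ q)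
  ∙ₚ-cong {a} {b} {p} {q} a≈b e = coeffs λ n →
    trans (coeff-∙ a p n) (trans (*-cong a≈b (at e n)) (sym (coeff-∙ b q n)))

  ∙ₚ-distribˡ : ∀ a p q → (a ∙ₚ (p +ₚ q)) ≈ₚ (a ∙ₚ p +ₚ a ∙ₚ q)
  ∙ₚ-distribˡ a p q = coeffs λ n → let open ≈-Reasoning in begin
    coeff (a ∙ₚ (p +ₚ q)) n              ≈⟨ coeff-∙ a (p +ₚ q) n ⟩
    a * coeff (p +ₚ q) n                 ≈⟨ *-congˡ (coeff-+ p q n) ⟩
    a * (coeff p n + coeff q n)          ≈⟨ distribˡ _ _ _ ⟩
    a * coeff p n + a * coeff q n        ≈⟨ +-cong (coeff-∙ a p n) (coeff-∙ a q n) ⟨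
    coeff (a ∙ₚ p) n + coeff (a ∙ₚ q) n  ≈⟨ coeff-+ (a ∙ₚ p) (a ∙ₚ q) n ⟨
    coeff (a ∙ₚ p +ₚ a ∙ₚ q) n           ∎

  ∙ₚ-distribʳ : ∀ a b p → ((a + b) ∙ₚ p) ≈ₚ (a ∙ₚ p +ₚ b ∙ₚ p)
  ∙ₚ-distribʳ a b p = coeffs λ n → let open ≈-Reasoning in begin
    coeff ((a + b) ∙ₚ p) n               ≈⟨ coeff-∙ (a + b) p n ⟩
    (a + b) * coeff p n                  ≈⟨ distribʳ _ _ _ ⟩
    a * coeff p n + b * coeff p n        ≈⟨ +-cong (coeff-∙ a p n) (coeff-∙ b p n) ⟨
    coeff (a ∙ₚ p) n + coeff (b ∙ₚ p) n  ≈⟨ coeff-+ (a ∙ₚ p) (b ∙ₚ p) n ⟨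
    coeff (a ∙ₚ p +ₚ b ∙ₚ p) n           ∎

  ∙ₚ-assoc : ∀ a b p → ((a * b) ∙ₚ p) ≈ₚ (a ∙ₚ (b ∙ₚ p))
  ∙ₚ-assoc a b p = coeffs λ n → let open ≈-Reasoning in begin
    coeff ((a * b) ∙ₚ p) n    ≈⟨ coeff-∙ (a * b) p n ⟩
    a * b * coeff p n         ≈⟨ *-assoc _ _ _ ⟩
    a * (b * coeff p n)       ≈⟨ *-congˡ (coeff-∙ b p n) ⟨
    a * coeff (b ∙ₚ p) n      ≈⟨ coeff-∙ a (b ∙ₚ p) n ⟨
    coeff (a ∙ₚ (b ∙ₚ p)) n   ∎

  1∙ₚ : ∀ p → (1# ∙ₚ p) ≈ₚ p
  1∙ₚ p = coeffs λ n → trans (coeff-∙ 1# p n) (*-identityˡ _)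

  0∙ₚ : ∀ p → (0# ∙ₚ p) ≈ₚ []
  0∙ₚ p = coeffs λ n → trans (coeff-∙ 0# p n) (zeroˡ _)

  0∷-+ : ∀ p q → (0# ∷ (p +ₚ q)) ≈ₚ ((0# ∷ p) +ₚ (0# ∷ q))
  0∷-+ p q = ∷-cong (sym (+-identityˡ 0#)) ≈ₚ-refl

  *ₚ-congˡ : ∀ p {q q′} → q ≈ₚ q′ → (p *ₚ q) ≈ₚ (p *ₚ q′)
  *ₚ-congˡ []      e = ≈ₚ-refl
  *ₚ-congˡ (a ∷ p) e = +ₚ-cong (∙ₚ-cong refl e) (∷-cong refl (*ₚ-congˡ p e))

  *ₚ-zeroʳ : ∀ p → (p *ₚ []) ≈ₚ []
  *ₚ-zeroʳ []      = ≈ₚ-refl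
  *ₚ-zeroʳ (a ∷ p) = ≈ₚ-trans (∷-cong refl (*ₚ-zeroʳ p)) 0∷[]≈[]

  *ₚ-∷ : ∀ p b q → (p *ₚ (b ∷ q)) ≈ₚ (b ∙ₚ p +ₚ (0# ∷ p *ₚ q))
  *ₚ-∷ []      b q = ≈ₚ-sym 0∷[]≈[]
  *ₚ-∷ (a ∷ p) b q = ∷-cong (+-congʳ (*-comm a b)) (let open ≈ₚ-Reasoning in begin
    a ∙ₚ q +ₚ p *ₚ (b ∷ q)                  ≈⟨ +ₚ-cong ≈ₚ-refl (*ₚ-∷ p b q) ⟩
    a ∙ₚ q +ₚ (b ∙ₚ p +ₚ (0# ∷ p *ₚ q))     ≈⟨ +ₚ-assoc (a ∙ₚ q) (b ∙ₚ p) (0# ∷ p *ₚ q) ⟨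
    (a ∙ₚ q +ₚ b ∙ₚ p) +ₚ (0# ∷ p *ₚ q)     ≈⟨ +ₚ-cong (+ₚ-comm (a ∙ₚ q) (b ∙ₚ p)) ≈ₚ-refl ⟩
    (b ∙ₚ p +ₚ a ∙ₚ q) +ₚ (0# ∷ p *ₚ q)     ≈⟨ +ₚ-assoc (b ∙ₚ p) (a ∙ₚ q) (0# ∷ p *ₚ q) ⟩
    b ∙ₚ p +ₚ (a ∙ₚ q +ₚ (0# ∷ p *ₚ q))     ∎)

  *ₚ-comm : ∀ p q → (p *ₚ q) ≈ₚ (q *ₚ p)
  *ₚ-comm []      q = ≈ₚ-sym (*ₚ-zeroʳ q)
  *ₚ-comm (a ∷ p) q = ≈ₚ-trans (+ₚ-cong ≈ₚ-refl (∷-cong refl (*ₚ-comm p q))) (≈ₚ-sym (*ₚ-∷ q a p))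

  *ₚ-cong : ∀ {p p′ q q′} → p ≈ₚ p′ → q ≈ₚ q′ → (p *ₚ q) ≈ₚ (p′ *ₚ q′)
  *ₚ-cong {p} {p′} {q} {q′} e f = let open ≈ₚ-Reasoning in begin
    p *ₚ q    ≈⟨ *ₚ-congˡ p f ⟩
    p *ₚ q′   ≈⟨ *ₚ-comm p q′ ⟩
    q′ *ₚ p   ≈⟨ *ₚ-congˡ q′ e ⟩
    q′ *ₚ p′  ≈⟨ *ₚ-comm q′ p′ ⟩
    p′ *ₚ q′  ∎

  *ₚ-distribˡ : ∀ p q r → (p *ₚ (q +ₚ r)) ≈ₚ (p *ₚ q +ₚ p *ₚ r)
  *ₚ-distribˡ []      q r = ≈ₚ-refl
  *ₚ-distribˡ (a ∷ p) q r = let open ≈ₚ-Reasoning in begin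
    a ∙ₚ (q +ₚ r) +ₚ (0# ∷ p *ₚ (q +ₚ r))
      ≈⟨ +ₚ-cong (∙ₚ-distribˡ a q r) (≈ₚ-trans (∷-cong refl (*ₚ-distribˡ p q r)) (0∷-+ (p *ₚ q) (p *ₚ r))) ⟩
    (a ∙ₚ q +ₚ a ∙ₚ r) +ₚ ((0# ∷ p *ₚ q) +ₚ (0# ∷ p *ₚ r))
      ≈⟨ +ₚ-interchange (a ∙ₚ q) (a ∙ₚ r) (0# ∷ p *ₚ q) (0# ∷ p *ₚ r) ⟩
    (a ∙ₚ q +ₚ (0# ∷ p *ₚ q)) +ₚ (a ∙ₚ r +ₚ (0# ∷ p *ₚ r)) ∎

  *ₚ-distribʳ : ∀ r p q → ((p +ₚ q) *ₚ r) ≈ₚ (p *ₚ r +ₚ q *ₚ r)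
  *ₚ-distribʳ r p q = let open ≈ₚ-Reasoning in begin
    (p +ₚ q) *ₚ r     ≈⟨ *ₚ-comm (p +ₚ q) r ⟩
    r *ₚ (p +ₚ q)     ≈⟨ *ₚ-distribˡ r p q ⟩
    r *ₚ p +ₚ r *ₚ q  ≈⟨ +ₚ-cong (*ₚ-comm r p) (*ₚ-comm r q) ⟩
    p *ₚ r +ₚ q *ₚ r  ∎

  ∙ₚ-*ₚ : ∀ a p q → ((a ∙ₚ p) *ₚ q) ≈ₚ (a ∙ₚ (p *ₚ q))
  ∙ₚ-*ₚ a []      q = ≈ₚ-refl
  ∙ₚ-*ₚ a (b ∷ p) q = let open ≈ₚ-Reasoning in begin
    (a * b) ∙ₚ q +ₚ (0# ∷ (a ∙ₚ p) *ₚ q)        ≈⟨ +ₚ-cong (∙ₚ-assoc a b q) (∷-cong (sym (zeroʳ a)) (∙ₚ-*ₚ a p q)) ⟩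
    a ∙ₚ (b ∙ₚ q) +ₚ a ∙ₚ (0# ∷ p *ₚ q)         ≈⟨ ∙ₚ-distribˡ a (b ∙ₚ q) (0# ∷ p *ₚ q) ⟨
    a ∙ₚ (b ∙ₚ q +ₚ (0# ∷ p *ₚ q))              ∎

  *ₚ-assoc : ∀ p q r → ((p *ₚ q) *ₚ r) ≈ₚ (p *ₚ (q *ₚ r))
  *ₚ-assoc []      q r = ≈ₚ-refl
  *ₚ-assoc (a ∷ p) q r = let open ≈ₚ-Reasoning in begin
    (a ∙ₚ q +ₚ (0# ∷ p *ₚ q)) *ₚ r
      ≈⟨ *ₚ-distribʳ r (a ∙ₚ q) (0# ∷ p *ₚ q) ⟩
    (a ∙ₚ q) *ₚ r +ₚ (0# ∙ₚ r +ₚ (0# ∷ (p *ₚ q) *ₚ r))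
      ≈⟨ +ₚ-cong (∙ₚ-*ₚ a q r) (+ₚ-cong (0∙ₚ r) (∷-cong refl (*ₚ-assoc p q r))) ⟩
    a ∙ₚ (q *ₚ r) +ₚ (0# ∷ p *ₚ (q *ₚ r)) ∎

  *ₚ-identityˡ : ∀ p → (const 1# *ₚ p) ≈ₚ p
  *ₚ-identityˡ p = ≈ₚ-trans (+ₚ-cong (1∙ₚ p) 0∷[]≈[]) (+ₚ-identityʳ p)

  *ₚ-identityʳ : ∀ p → (p *ₚ const 1#) ≈ₚ p
  *ₚ-identityʳ p = ≈ₚ-trans (*ₚ-comm p (const 1#)) (*ₚ-identityˡ p)

  polynomialRing : CommutativeRing c ℓ
  polynomialRing = record
    { Carrier = Poly
    ; _≈_ = _≈ₚ_
    ; _+_ = _+ₚ_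
    ; _*_ = _*ₚ_
    ; -_ = -ₚ_
    ; 0# = []
    ; 1# = const 1#
    ; isCommutativeRing = record
      { isRing = record
        { +-isAbelianGroup = record
          { isGroup = record
            { isMonoid = record
              { isSemigroup = record
                { isMagma = record
                  { isEquivalence = Setoid.isEquivalence ≈ₚ-setoid
                  ; ∙-cong = +ₚ-cong
                  }
                ; assoc = +ₚ-assoc
                }
              ; identity = (λ _ → ≈ₚ-refl) , +ₚ-identityʳ
              }
            ; inverse = -ₚ-inverseˡ , -ₚ-inverseʳ
            ; ⁻¹-cong = -ₚ-cong
            }
          ; comm = +ₚ-comm
          }
        ; *-cong = *ₚ-cong
        ; *-assoc = *ₚ-assoc
        ; *-identity = *ₚ-identityˡ , *ₚ-identityʳ
        ; distrib = *ₚ-distribˡ , *ₚ-distribʳ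
        }
      ; *-comm = *ₚ-comm
      }
    }

open module ℤPolynomial = Polynomial ℤ.+-*-commutativeRing public
  using (X) renaming (const to constant; polynomialRing to ℤ[x])

module _ {a ℓ₁ ℓ₂} {P : Poset a ℓ₁ ℓ₂} (G : D1 P) where
  open D1 G using (rankSize)

  [DU_]+xI : ∀ n → Matrix ℤ[x] (rankSize n) (rankSize n)
  [DU n ]+xI = _+ᴹ_ ℤ[x] (λ i j → constant (matrixOf (DU G n) i j)) (_·ᴹ_ ℤ[x] X (1ᴹ ℤ[x]))

{-# OPTIONS --safe #-}
module Submission where

-- Put R = r + s, t n for the rank sizes of P × Q and k n = t n − t (n − 1).  In P × Q
-- the up maps are the transposes of the down maps, DU = UD + R, and D is onto because it
-- is onto in one factor.  By induction on n, for all c at once, DU n + (x + c) is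
-- equivalent to diag(1, …, 1, f₁, …, f_{k n}) with f_{i+1} ∣ f_i.  For the step let
-- y = x + c + R.  In a basis adapted to the kernel of D : ℤ[rank n + 1] → ℤ[rank n],
-- DU (n + 1) + (x + c) = UD + y is the block matrix
--     DU n + y   0
--     B          y
-- and the induction hypothesis, applied to DU n + y, reduces it to
--     diag f   0
--     C        y
-- where C may be taken to be an integer matrix, since it only matters modulo y.  As U is
-- split injective, the columns of C and diag f(y = 0) together are unimodular.  Hence C
-- can be brought, by integer row operations and modulo f(y = 0), to the form (1 ; 0): this
-- is Euclid's algorithm, column by column with the largest f first, a spare row being used
-- to turn units modulo f into 1.  What is left is equivalent to diag(1, y f, y).  A spare
-- row exists because k n < k (n + 1), by the growth hypothesis on Q; the only exception is
-- n = 0 with R = 2, where all units modulo f = 2 are 1.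

open import Defs
open import Algebra.Bundles using (CommutativeRing)
open import Algebra.Morphism.Structures using (IsRingHomomorphism)
import Algebra.Properties.CommutativeSemigroup as CommutativeSemigroupProperties
import Algebra.Properties.Ring as RingProperties
import Algebra.Properties.Semiring.Divisibility as Divisibility
import Algebra.Properties.Semiring.Sum as Sum
open import Data.Bool.Base using (if_then_else_; true; false)
open import Data.Fin.Base as Fin using (Fin; zero; suc; toℕ; opposite)
import Data.Fin.Properties as Fin
open import Data.Integer.Base as ℤ using (ℤ; +_; -[1+_]; 0ℤ; 1ℤ; -1ℤ; ∣_∣; +≤+)
import Data.Integer.DivMod as ℤ
import Data.Integer.Properties as ℤ
open import Data.Integer.Tactic.RingSolver using (solve-∀)
open import Data.List.Base using (List; []; _∷_; _++_; map; filter; length; lookup; concat; applyUpTo; cartesianProduct)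
import Data.List.Membership.Setoid as Membership
import Data.List.Membership.Setoid.Properties as Membershipₚ
import Data.List.Properties as List
open import Data.List.Relation.Unary.All as All using (All; []; _∷_)
open import Data.List.Relation.Unary.AllPairs using ([]; _∷_)
open import Data.List.Relation.Unary.Any as Any using (here; there)
import Data.List.Relation.Unary.Any.Properties as Anyₚ
import Data.List.Relation.Unary.Unique.Setoid as Unique
import Data.List.Relation.Unary.Unique.Setoid.Properties as Uniqueₚ
open import Data.Nat.Base as ℕ using (ℕ; zero; suc; pred; s≤s; z≤n; _∸_)
open import Data.Nat.Induction using (Acc; acc; <-wellFounded)
import Data.Nat.Properties as ℕ
open import Data.Nat.Tactic.RingSolver using () renaming (solve-∀ to solveℕ-∀)
open import Data.Product.Base using (Σ; ∃; _×_; _,_; proj₁; proj₂)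
open import Data.Product.Relation.Binary.Pointwise.NonDependent using (×-poset)
open import Data.Sum.Base as ⊎ using (_⊎_; inj₁; inj₂; [_,_]′)
import Data.Sum.Properties as ⊎
open import Function.Base using (_∘_; id)
open import Function.Bundles using (_⇔_; mk⇔; Equivalence)
open import Level using (_⊔_)
open import Relation.Binary.Bundles using (Setoid; Poset)
open import Relation.Binary.Core using (_Preserves_⟶_)
open import Relation.Binary.Definitions using (Decidable; DecidableEquality)
import Relation.Binary.Properties.Poset as PosetProperties
open import Relation.Binary.PropositionalEquality as ≡ using (_≡_; _≢_)
import Relation.Binary.Reasoning.Setoid as SetoidReasoning
open import Relation.Nullary using (¬_; Dec; yes; no; does; contradiction)
open import Relation.Nullary.Decidable using (does-⇔; _×-dec_)

-- Matrices indexed by iterated disjoint unions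

-- ℤ[x] has no Euclidean algorithm, so every genuine elimination is done over ℤ. This works because
-- `y` is monic of degree one: division by it leaves an integer remainder, and setting `y = 0` turns
-- every invertible polynomial matrix into an invertible integer matrix. The constant `c` has to
-- vary because each step trades `c` for `c + R`. The spare row answers a real obstruction. On a
-- square C, integer row operations change the determinant by a sign only, so a unit modulo f other
-- than 1 and -1 could never become 1. With one more row this obstruction is gone, and this is why
-- strict convexity of t is required. As t is the convolution of p and q, convexity of q makes t
-- convex; strictness is extracted from the first values of q and from the positivity and
-- monotonicity of p. The order of the columns matters because treating a column leaves errors that
-- are multiples of its f. They are harmless in the later columns exactly when the later f divide
-- it.

infixr 6 _⊕_
-- Blocks of a matrix are addressed by constructors instead of arithmetic on indices, and regrouping
-- blocks is a bijection of index types. Shapes are codes rather than arbitrary types so that sums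
-- and equality tests can be defined by recursion on them.
data Shape : Set where
  fin : ℕ → Shape
  _⊕_ : Shape → Shape → Shape

El : Shape → Set
El (fin n) = Fin n
El (a ⊕ b) = El a ⊎ El b

_≟ˢ_ : ∀ {a} → DecidableEquality (El a)
_≟ˢ_ {fin n} = Fin._≟_
_≟ˢ_ {a ⊕ b} = ⊎.≡-dec (_≟ˢ_ {a}) (_≟ˢ_ {b})

record Reindexing (a b : Shape) : Set where
  field
    to      : El a → El b
    from    : El b → El a
    from-to : ∀ i → from (to i) ≡ i
    to-from : ∀ j → to (from j) ≡ j

module Matrices {c ℓ} (R : CommutativeRing c ℓ) where
  open CommutativeRing R hiding (zero)
  module Σ′ = Sum semiring
  module ≈-R = SetoidReasoning setoid

  ∑ : ∀ a → (El a → Carrier) → Carrier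
  ∑ (fin n) f = Σ′.sum f
  ∑ (a ⊕ b) f = ∑ a (f ∘ inj₁) + ∑ b (f ∘ inj₂)

  ∑-cong : ∀ a {f g : El a → Carrier} → (∀ i → f i ≈ g i) → ∑ a f ≈ ∑ a g
  ∑-cong (fin n) e = Σ′.sum-cong-≋ e
  ∑-cong (a ⊕ b) e = +-cong (∑-cong a (e ∘ inj₁)) (∑-cong b (e ∘ inj₂))

  ∑-zero : ∀ a → ∑ a (λ _ → 0#) ≈ 0#
  ∑-zero (fin n) = Σ′.sum-replicate-zero n
  ∑-zero (a ⊕ b) = trans (+-cong (∑-zero a) (∑-zero b)) (+-identityˡ 0#)

  ∑-+ : ∀ a (f g : El a → Carrier) → ∑ a (λ i → f i + g i) ≈ ∑ a f + ∑ a g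
  ∑-+ (fin n) f g = Σ′.∑-distrib-+ f g
  ∑-+ (a ⊕ b) f g = trans (+-cong (∑-+ a _ _) (∑-+ b _ _)) (interchange _ _ _ _)
    where open CommutativeSemigroupProperties +-commutativeSemigroup using (interchange)

  *-∑ : ∀ a x (f : El a → Carrier) → x * ∑ a f ≈ ∑ a (λ i → x * f i)
  *-∑ (fin n) x f = Σ′.*-distribˡ-sum x f
  *-∑ (a ⊕ b) x f = trans (distribˡ _ _ _) (+-cong (*-∑ a x _) (*-∑ b x _))

  ∑-* : ∀ a x (f : El a → Carrier) → ∑ a f * x ≈ ∑ a (λ i → f i * x)
  ∑-* a x f = trans (*-comm _ _) (trans (*-∑ a x f) (∑-cong a λ _ → *-comm _ _))

  ∑-swap : ∀ a b (f : El a → El b → Carrier) → ∑ a (λ i → ∑ b (f i)) ≈ ∑ b (λ j → ∑ a (λ i → f i j))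
  ∑-swap (fin zero)    b f = sym (∑-zero b)
  ∑-swap (fin (suc n)) b f =
    trans (+-congˡ (∑-swap (fin n) b (f ∘ suc))) (sym (∑-+ b (f zero) _))
  ∑-swap (a ⊕ a′) b f =
    trans (+-cong (∑-swap a b (f ∘ inj₁)) (∑-swap a′ b (f ∘ inj₂))) (sym (∑-+ b _ _))

  δ : ∀ {a} → El a → El a → Carrier
  δ {a} i j = if does (_≟ˢ_ {a} i j) then 1# else 0#

  δ-cong : ∀ {a b} {i j : El a} {i′ j′ : El b} → i ≡ j ⇔ i′ ≡ j′ → δ {a} i j ≈ δ {b} i′ j′
  δ-cong {a} {b} {i} {j} {i′} {j′} e =
    reflexive (≡.cong (if_then 1# else 0#) (does-⇔ e (_≟ˢ_ {a} i j) (_≟ˢ_ {b} i′ j′)))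

  δ-sym : ∀ {a} (i j : El a) → δ {a} i j ≈ δ {a} j i
  δ-sym {a} i j = δ-cong {a} {a} (mk⇔ ≡.sym ≡.sym)

  δ-∑ : ∀ a i (f : El a → Carrier) → ∑ a (λ j → δ {a} i j * f j) ≈ f i
  δ-∑ (fin (suc n)) zero f = trans
    (+-cong (*-identityˡ _) (trans (∑-cong (fin n) λ _ → zeroˡ _) (∑-zero (fin n))))
    (+-identityʳ _)
  δ-∑ (fin (suc n)) (suc i) f = trans (+-cong (zeroˡ _) (δ-∑ (fin n) i (f ∘ suc))) (+-identityˡ _)
  δ-∑ (a ⊕ b) (inj₁ i) f = trans
    (+-cong (δ-∑ a i (f ∘ inj₁)) (trans (∑-cong b λ _ → zeroˡ _) (∑-zero b)))
    (+-identityʳ _)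
  δ-∑ (a ⊕ b) (inj₂ i) f = trans
    (+-cong (trans (∑-cong a λ _ → zeroˡ _) (∑-zero a)) (δ-∑ b i (f ∘ inj₂)))
    (+-identityˡ _)

  -- A record rather than a function type: `El` is not injective, so the shapes could not be
  -- inferred from the type of a bare family of entries.
  record Mat (a b : Shape) : Set c where
    no-eta-equality
    field entry : El a → El b → Carrier
  open Mat public

  infix 4 _≋_
  record _≋_ {a b} (A B : Mat a b) : Set ℓ where
    constructor pointwise
    field at : ∀ i j → entry A i j ≈ entry B i j
  open _≋_ public

  ≋-refl : ∀ {a b} {A : Mat a b} → A ≋ A
  ≋-refl = pointwise λ _ _ → refl

  ≋-sym : ∀ {a b} {A B : Mat a b} → A ≋ B → B ≋ A
  ≋-sym e = pointwise λ i j → sym (at e i j)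

  ≋-trans : ∀ {a b} {A B C : Mat a b} → A ≋ B → B ≋ C → A ≋ C
  ≋-trans e f = pointwise λ i j → trans (at e i j) (at f i j)

  ≋-setoid : ∀ a b → Setoid c ℓ
  ≋-setoid a b = record
    { Carrier = Mat a b
    ; _≈_ = _≋_
    ; isEquivalence = record { refl = ≋-refl ; sym = ≋-sym ; trans = ≋-trans }
    }

  module ≋-R {a b} = SetoidReasoning (≋-setoid a b)

  infixl 7 _∙_
  _∙_ : ∀ {a b d} → Mat a b → Mat b d → Mat a d
  entry (_∙_ {b = b} A B) i k = ∑ b λ j → entry A i j * entry B j k

  infixl 6 _⊞_
  _⊞_ : ∀ {a b} → Mat a b → Mat a b → Mat a b
  entry (A ⊞ B) i j = entry A i j + entry B i j

  ⊟_ : ∀ {a b} → Mat a b → Mat a b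
  entry (⊟ A) i j = - entry A i j

  𝟘 : ∀ {a b} → Mat a b
  entry 𝟘 _ _ = 0#

  diag : ∀ {a} → (El a → Carrier) → Mat a a
  entry (diag {a} d) i j = d i * δ {a} i j

  𝟙 : ∀ {a} → Mat a a
  entry (𝟙 {a}) = δ {a}

  scalar : ∀ {a} → Carrier → Mat a a
  scalar y = diag λ _ → y

  _ᵀ : ∀ {a b} → Mat a b → Mat b a
  entry (A ᵀ) i j = entry A j i

  ∙-cong : ∀ {a b d} {A A′ : Mat a b} {B B′ : Mat b d} → A ≋ A′ → B ≋ B′ → A ∙ B ≋ A′ ∙ B′
  ∙-cong {b = b} e f = pointwise λ i k → ∑-cong b λ j → *-cong (at e i j) (at f j k)

  ∙-congˡ : ∀ {a b d} {A : Mat a b} {B B′ : Mat b d} → B ≋ B′ → A ∙ B ≋ A ∙ B′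
  ∙-congˡ = ∙-cong ≋-refl

  ∙-congʳ : ∀ {a b d} {A A′ : Mat a b} {B : Mat b d} → A ≋ A′ → A ∙ B ≋ A′ ∙ B
  ∙-congʳ e = ∙-cong e ≋-refl

  ⊞-cong : ∀ {a b} {A A′ B B′ : Mat a b} → A ≋ A′ → B ≋ B′ → A ⊞ B ≋ A′ ⊞ B′
  ⊞-cong e f = pointwise λ i j → +-cong (at e i j) (at f i j)

  ∙-assoc : ∀ {a b d e} (A : Mat a b) (B : Mat b d) (C : Mat d e) → A ∙ B ∙ C ≋ A ∙ (B ∙ C)
  ∙-assoc {b = b} {d} A B C = pointwise λ i l → let open ≈-R in begin
    ∑ d (λ k → ∑ b (λ j → entry A i j * entry B j k) * entry C k l)
      ≈⟨ ∑-cong d (λ k → ∑-* b _ _) ⟩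
    ∑ d (λ k → ∑ b (λ j → entry A i j * entry B j k * entry C k l))
      ≈⟨ ∑-cong d (λ k → ∑-cong b λ j → *-assoc _ _ _) ⟩
    ∑ d (λ k → ∑ b (λ j → entry A i j * (entry B j k * entry C k l)))
      ≈⟨ ∑-swap d b _ ⟩
    ∑ b (λ j → ∑ d (λ k → entry A i j * (entry B j k * entry C k l)))
      ≈⟨ ∑-cong b (λ j → *-∑ d _ _) ⟨
    ∑ b (λ j → entry A i j * ∑ d (λ k → entry B j k * entry C k l)) ∎

  ᵀ-∙ : ∀ {a b d} (A : Mat a b) (B : Mat b d) → (A ∙ B) ᵀ ≋ B ᵀ ∙ A ᵀ
  ᵀ-∙ {b = b} A B = pointwise λ i j → ∑-cong b λ _ → *-comm _ _

  ᵀ-𝟙 : ∀ {a} → 𝟙 {a} ᵀ ≋ 𝟙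
  ᵀ-𝟙 {a} = pointwise λ i j → δ-sym {a} j i

  diag-∙ : ∀ {a b} (d : El a → Carrier) (A : Mat a b) i j → entry (diag d ∙ A) i j ≈ d i * entry A i j
  diag-∙ {a} d A i j = begin
    ∑ a (λ k → d i * δ {a} i k * entry A k j)    ≈⟨ ∑-cong a (λ k → *-assoc _ _ _) ⟩
    ∑ a (λ k → d i * (δ {a} i k * entry A k j))  ≈⟨ *-∑ a _ _ ⟨
    d i * ∑ a (λ k → δ {a} i k * entry A k j)    ≈⟨ *-congˡ (δ-∑ a i _) ⟩
    d i * entry A i j                            ∎
    where open ≈-R

  ∙-diag : ∀ {a b} (A : Mat a b) (d : El b → Carrier) i j → entry (A ∙ diag d) i j ≈ entry A i j * d j
  ∙-diag {b = b} A d i j = begin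
    ∑ b (λ k → entry A i k * (d k * δ {b} k j))  ≈⟨ ∑-cong b (λ k → trans (sym (*-assoc _ _ _)) (trans (*-comm _ _) (*-congʳ (δ-sym {b} k j)))) ⟩
    ∑ b (λ k → δ {b} j k * (entry A i k * d k))  ≈⟨ δ-∑ b j _ ⟩
    entry A i j * d j                            ∎
    where open ≈-R

  ∙-identityˡ : ∀ {a b} (A : Mat a b) → 𝟙 ∙ A ≋ A
  ∙-identityˡ {a} A = pointwise λ i j → δ-∑ a i _

  ∙-identityʳ : ∀ {a b} (A : Mat a b) → A ∙ 𝟙 ≋ A
  ∙-identityʳ {b = b} A = pointwise λ i j →
    trans (∑-cong b λ k → trans (*-comm _ _) (*-congʳ (δ-sym {b} k j))) (δ-∑ b j _)

  ∙-zeroˡ : ∀ {a b d} {A : Mat b d} → 𝟘 {a} ∙ A ≋ 𝟘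
  ∙-zeroˡ {b = b} = pointwise λ i j → trans (∑-cong b λ _ → zeroˡ _) (∑-zero b)

  ∙-zeroʳ : ∀ {a b d} {A : Mat a b} → A ∙ 𝟘 {b} {d} ≋ 𝟘
  ∙-zeroʳ {b = b} = pointwise λ i j → trans (∑-cong b λ _ → zeroʳ _) (∑-zero b)

  ∙-distribˡ : ∀ {a b d} (A : Mat a b) (B C : Mat b d) → A ∙ (B ⊞ C) ≋ A ∙ B ⊞ A ∙ C
  ∙-distribˡ {b = b} A B C = pointwise λ i j → trans (∑-cong b λ _ → distribˡ _ _ _) (∑-+ b _ _)

  ∙-distribʳ : ∀ {a b d} (C : Mat b d) (A B : Mat a b) → (A ⊞ B) ∙ C ≋ A ∙ C ⊞ B ∙ C
  ∙-distribʳ {b = b} C A B = pointwise λ i j → trans (∑-cong b λ _ → distribʳ _ _ _) (∑-+ b _ _)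

  scalar-comm : ∀ {a b} y (A : Mat a b) → scalar y ∙ A ≋ A ∙ scalar y
  scalar-comm y A = pointwise λ i j →
    trans (diag-∙ _ A i j) (trans (*-comm _ _) (sym (∙-diag A _ i j)))

  ⊞-identityˡ : ∀ {a b} (A : Mat a b) → 𝟘 ⊞ A ≋ A
  ⊞-identityˡ A = pointwise λ i j → +-identityˡ _

  ⊞-identityʳ : ∀ {a b} (A : Mat a b) → A ⊞ 𝟘 ≋ A
  ⊞-identityʳ A = pointwise λ i j → +-identityʳ _

  block : ∀ {a a′ b b′} → Mat a b → Mat a b′ → Mat a′ b → Mat a′ b′ → Mat (a ⊕ a′) (b ⊕ b′)
  entry (block A B C D) (inj₁ i) (inj₁ j) = entry A i j
  entry (block A B C D) (inj₁ i) (inj₂ j) = entry B i j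
  entry (block A B C D) (inj₂ i) (inj₁ j) = entry C i j
  entry (block A B C D) (inj₂ i) (inj₂ j) = entry D i j

  block-cong : ∀ {a a′ b b′} {A A′ : Mat a b} {B B′ : Mat a b′} {C C′ : Mat a′ b} {D D′ : Mat a′ b′} →
               A ≋ A′ → B ≋ B′ → C ≋ C′ → D ≋ D′ → block A B C D ≋ block A′ B′ C′ D′
  block-cong e f g h = pointwise λ where
    (inj₁ i) (inj₁ j) → at e i j
    (inj₁ i) (inj₂ j) → at f i j
    (inj₂ i) (inj₁ j) → at g i j
    (inj₂ i) (inj₂ j) → at h i j

  block-∙ : ∀ {a a′ b b′ d d′}
            (A : Mat a b) (B : Mat a b′) (C : Mat a′ b) (D : Mat a′ b′)
            (A₁ : Mat b d) (B₁ : Mat b d′) (C₁ : Mat b′ d) (D₁ : Mat b′ d′) →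
            block A B C D ∙ block A₁ B₁ C₁ D₁ ≋
            block (A ∙ A₁ ⊞ B ∙ C₁) (A ∙ B₁ ⊞ B ∙ D₁) (C ∙ A₁ ⊞ D ∙ C₁) (C ∙ B₁ ⊞ D ∙ D₁)
  block-∙ A B C D A₁ B₁ C₁ D₁ = pointwise λ where
    (inj₁ i) (inj₁ j) → refl
    (inj₁ i) (inj₂ j) → refl
    (inj₂ i) (inj₁ j) → refl
    (inj₂ i) (inj₂ j) → refl

  block-𝟙 : ∀ {a b} → block 𝟙 𝟘 𝟘 𝟙 ≋ 𝟙 {a ⊕ b}
  block-𝟙 = pointwise λ where
    (inj₁ i) (inj₁ j) → refl
    (inj₁ i) (inj₂ j) → refl
    (inj₂ i) (inj₁ j) → refl
    (inj₂ i) (inj₂ j) → refl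

  block-diag : ∀ {a b} (d : El a → Carrier) (e : El b → Carrier) →
               block (diag d) 𝟘 𝟘 (diag e) ≋ diag {a ⊕ b} [ d , e ]′
  block-diag d e = pointwise λ where
    (inj₁ i) (inj₁ j) → refl
    (inj₁ i) (inj₂ j) → sym (zeroʳ _)
    (inj₂ i) (inj₁ j) → sym (zeroʳ _)
    (inj₂ i) (inj₂ j) → refl

  -- The two shapes may differ, so that renaming or regrouping indices is an invertible matrix like
  -- any other.
  record Iso (a b : Shape) : Set (c ⊔ ℓ) where
    field
      to      : Mat a b
      from    : Mat b a
      to-from : to ∙ from ≋ 𝟙
      from-to : from ∙ to ≋ 𝟙
  open Iso public

  Iso-refl : ∀ {a} → Iso a a
  Iso-refl = record { to = 𝟙 ; from = 𝟙 ; to-from = ∙-identityˡ 𝟙 ; from-to = ∙-identityˡ 𝟙 }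

  Iso-sym : ∀ {a b} → Iso a b → Iso b a
  Iso-sym φ = record { to = from φ ; from = to φ ; to-from = from-to φ ; from-to = to-from φ }

  cancel-inner : ∀ {a b d e} (A : Mat a b) {B : Mat b d} {C : Mat d b} (D : Mat b e) → B ∙ C ≋ 𝟙 → A ∙ B ∙ (C ∙ D) ≋ A ∙ D
  cancel-inner A {B} {C} D e = begin
    A ∙ B ∙ (C ∙ D)    ≈⟨ ∙-assoc A B (C ∙ D) ⟩
    A ∙ (B ∙ (C ∙ D))  ≈⟨ ∙-congˡ (∙-assoc B C D) ⟨
    A ∙ (B ∙ C ∙ D)    ≈⟨ ∙-congˡ (≋-trans (∙-congʳ e) (∙-identityˡ D)) ⟩
    A ∙ D              ∎
    where open ≋-R

  Iso-trans : ∀ {a b d} → Iso a b → Iso b d → Iso a d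
  Iso-trans φ ψ = record
    { to = to φ ∙ to ψ
    ; from = from ψ ∙ from φ
    ; to-from = ≋-trans (cancel-inner (to φ) (from φ) (to-from ψ)) (to-from φ)
    ; from-to = ≋-trans (cancel-inner (from ψ) (to ψ) (from-to φ)) (from-to ψ)
    }

  Iso-ᵀ : ∀ {a b} → Iso a b → Iso b a
  Iso-ᵀ φ = record
    { to = to φ ᵀ
    ; from = from φ ᵀ
    ; to-from = ≋-trans (≋-sym (ᵀ-∙ (from φ) (to φ))) (≋-trans (pointwise λ i j → at (from-to φ) j i) ᵀ-𝟙)
    ; from-to = ≋-trans (≋-sym (ᵀ-∙ (to φ) (from φ))) (≋-trans (pointwise λ i j → at (to-from φ) j i) ᵀ-𝟙)
    }

  block-𝟘-∙ : ∀ {a a′ b b′ d d′} (A : Mat a b) (D : Mat a′ b′) (A₁ : Mat b d) (D₁ : Mat b′ d′) →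
              block A 𝟘 𝟘 D ∙ block A₁ 𝟘 𝟘 D₁ ≋ block (A ∙ A₁) 𝟘 𝟘 (D ∙ D₁)
  block-𝟘-∙ A D A₁ D₁ = ≋-trans (block-∙ A 𝟘 𝟘 D A₁ 𝟘 𝟘 D₁) (block-cong
    (≋-trans (⊞-cong ≋-refl ∙-zeroˡ) (⊞-identityʳ _))
    (≋-trans (⊞-cong ∙-zeroʳ ∙-zeroˡ) (⊞-identityʳ _))
    (≋-trans (⊞-cong ∙-zeroˡ ∙-zeroʳ) (⊞-identityʳ _))
    (≋-trans (⊞-cong ∙-zeroˡ ≋-refl) (⊞-identityˡ _)))

  Iso-⊕ : ∀ {a a′ b b′} → Iso a b → Iso a′ b′ → Iso (a ⊕ a′) (b ⊕ b′)
  Iso-⊕ φ ψ = record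
    { to = block (to φ) 𝟘 𝟘 (to ψ)
    ; from = block (from φ) 𝟘 𝟘 (from ψ)
    ; to-from = ≋-trans (block-𝟘-∙ _ _ _ _) (≋-trans (block-cong (to-from φ) ≋-refl ≋-refl (to-from ψ)) block-𝟙)
    ; from-to = ≋-trans (block-𝟘-∙ _ _ _ _) (≋-trans (block-cong (from-to φ) ≋-refl ≋-refl (from-to ψ)) block-𝟙)
    }

  ⊟-⊞ : ∀ {a b} (A : Mat a b) → ⊟ A ⊞ A ≋ 𝟘
  ⊟-⊞ A = pointwise λ i j → -‿inverseˡ _

  ⊞-⊟ : ∀ {a b} (A : Mat a b) → A ⊞ ⊟ A ≋ 𝟘
  ⊞-⊟ A = pointwise λ i j → -‿inverseʳ _

  upper-∙ : ∀ {a b d d′} (X : Mat a b) (A : Mat a d) (B : Mat a d′) (C : Mat b d) (D : Mat b d′) →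
            block 𝟙 X 𝟘 𝟙 ∙ block A B C D ≋ block (A ⊞ X ∙ C) (B ⊞ X ∙ D) C D
  upper-∙ X A B C D = ≋-trans (block-∙ 𝟙 X 𝟘 𝟙 A B C D) (block-cong
    (⊞-cong (∙-identityˡ A) ≋-refl) (⊞-cong (∙-identityˡ B) ≋-refl)
    (≋-trans (⊞-cong ∙-zeroˡ (∙-identityˡ C)) (⊞-identityˡ C))
    (≋-trans (⊞-cong ∙-zeroˡ (∙-identityˡ D)) (⊞-identityˡ D)))

  lower-∙ : ∀ {a b d d′} (X : Mat b a) (A : Mat a d) (B : Mat a d′) (C : Mat b d) (D : Mat b d′) →
            block 𝟙 𝟘 X 𝟙 ∙ block A B C D ≋ block A B (X ∙ A ⊞ C) (X ∙ B ⊞ D)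
  lower-∙ X A B C D = ≋-trans (block-∙ 𝟙 𝟘 X 𝟙 A B C D) (block-cong
    (≋-trans (⊞-cong (∙-identityˡ A) ∙-zeroˡ) (⊞-identityʳ A))
    (≋-trans (⊞-cong (∙-identityˡ B) ∙-zeroˡ) (⊞-identityʳ B))
    (⊞-cong ≋-refl (∙-identityˡ C)) (⊞-cong ≋-refl (∙-identityˡ D)))

  ∙-lower : ∀ {a b d d′} (X : Mat b a) (A : Mat d a) (B : Mat d b) (C : Mat d′ a) (D : Mat d′ b) →
            block A B C D ∙ block 𝟙 𝟘 X 𝟙 ≋ block (A ⊞ B ∙ X) B (C ⊞ D ∙ X) D
  ∙-lower X A B C D = ≋-trans (block-∙ A B C D 𝟙 𝟘 X 𝟙) (block-cong
    (⊞-cong (∙-identityʳ A) ≋-refl)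
    (≋-trans (⊞-cong ∙-zeroʳ (∙-identityʳ B)) (⊞-identityˡ B))
    (⊞-cong (∙-identityʳ C) ≋-refl)
    (≋-trans (⊞-cong ∙-zeroʳ (∙-identityʳ D)) (⊞-identityˡ D)))

  ∙-upper : ∀ {a b d d′} (X : Mat a b) (A : Mat d a) (B : Mat d b) (C : Mat d′ a) (D : Mat d′ b) →
            block A B C D ∙ block 𝟙 X 𝟘 𝟙 ≋ block A (A ∙ X ⊞ B) C (C ∙ X ⊞ D)
  ∙-upper X A B C D = ≋-trans (block-∙ A B C D 𝟙 X 𝟘 𝟙) (block-cong
    (≋-trans (⊞-cong (∙-identityʳ A) ∙-zeroʳ) (⊞-identityʳ A))
    (⊞-cong ≋-refl (∙-identityʳ B))
    (≋-trans (⊞-cong (∙-identityʳ C) ∙-zeroʳ) (⊞-identityʳ C))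
    (⊞-cong ≋-refl (∙-identityʳ D)))

  Iso-upper : ∀ {a b} → Mat a b → Iso (a ⊕ b) (a ⊕ b)
  Iso-upper X = record
    { to = block 𝟙 X 𝟘 𝟙
    ; from = block 𝟙 (⊟ X) 𝟘 𝟙
    ; to-from = inv X (⊟ X) (⊟-⊞ X)
    ; from-to = inv (⊟ X) X (⊞-⊟ X)
    }
    where
    inv : ∀ X Y → Y ⊞ X ≋ 𝟘 → block 𝟙 X 𝟘 𝟙 ∙ block 𝟙 Y 𝟘 𝟙 ≋ 𝟙
    inv X Y e = ≋-trans (upper-∙ X 𝟙 Y 𝟘 𝟙) (≋-trans (block-cong
      (≋-trans (⊞-cong ≋-refl ∙-zeroʳ) (⊞-identityʳ 𝟙))
      (≋-trans (⊞-cong ≋-refl (∙-identityʳ X)) e) ≋-refl ≋-refl) block-𝟙)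

  Iso-lower : ∀ {a b} → Mat b a → Iso (a ⊕ b) (a ⊕ b)
  Iso-lower X = record
    { to = block 𝟙 𝟘 X 𝟙
    ; from = block 𝟙 𝟘 (⊟ X) 𝟙
    ; to-from = inv X (⊟ X) (⊞-⊟ X)
    ; from-to = inv (⊟ X) X (⊟-⊞ X)
    }
    where
    inv : ∀ X Y → X ⊞ Y ≋ 𝟘 → block 𝟙 𝟘 X 𝟙 ∙ block 𝟙 𝟘 Y 𝟙 ≋ 𝟙
    inv X Y e = ≋-trans (lower-∙ X 𝟙 𝟘 Y 𝟙) (≋-trans (block-cong
      ≋-refl ≋-refl (≋-trans (⊞-cong (∙-identityʳ X) ≋-refl) e)
      (≋-trans (⊞-cong ∙-zeroʳ ≋-refl) (⊞-identityˡ 𝟙))) block-𝟙)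

  permutation : ∀ {a b} → (El a → El b) → Mat a b
  entry (permutation {b = b} φ) i = δ {b} (φ i)

  permutation-∙ : ∀ {a b d} (φ : El a → El b) (A : Mat b d) i j → entry (permutation φ ∙ A) i j ≈ entry A (φ i) j
  permutation-∙ {b = b} φ A i j = δ-∑ b (φ i) _

  module _ {a b} (φ : Reindexing a b) where
    private module φ = Reindexing φ

    ∙-permutation : ∀ {d} (A : Mat d b) i j → entry (A ∙ permutation φ.from) i j ≈ entry A i (φ.to j)
    ∙-permutation A i j = trans
      (∑-cong b λ k → trans (*-comm _ _) (*-congʳ (δ-cong {a} {b} (mk⇔
        (λ e → ≡.trans (≡.cong φ.to (≡.sym e)) (φ.to-from k))
        (λ e → ≡.trans (≡.cong φ.from (≡.sym e)) (φ.from-to j))))))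
      (δ-∑ b (φ.to j) _)

    Iso-reindex : Iso a b
    Iso-reindex = record
      { to = permutation φ.to
      ; from = permutation φ.from
      ; to-from = pointwise λ i j → trans (permutation-∙ φ.to (permutation φ.from) i j)
          (reflexive (≡.cong (λ k → δ {a} k j) (φ.from-to i)))
      ; from-to = pointwise λ i j → trans (permutation-∙ φ.from (permutation φ.to) i j)
          (reflexive (≡.cong (λ k → δ {b} k j) (φ.to-from i)))
      }

  -- Equivalence of matrices under row and column operations

  infix 4 _∼_
  record _∼_ {a b a′ b′} (A : Mat a b) (B : Mat a′ b′) : Set (c ⊔ ℓ) where
    constructor equivalent
    field
      left  : Iso a′ a
      right : Iso b b′
      eq    : to left ∙ A ∙ to right ≋ B
  open _∼_ public

  ∼-reflexive : ∀ {a b} {A B : Mat a b} → A ≋ B → A ∼ B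
  ∼-reflexive {A = A} e = equivalent Iso-refl Iso-refl
    (≋-trans (∙-identityʳ _) (≋-trans (∙-identityˡ A) e))

  ∼-trans : ∀ {a b a′ b′ a″ b″} {A : Mat a b} {B : Mat a′ b′} {C : Mat a″ b″} → A ∼ B → B ∼ C → A ∼ C
  ∼-trans {A = A} {B} {C} p q = equivalent (Iso-trans (left q) (left p)) (Iso-trans (right p) (right q)) (begin
    L′ ∙ L ∙ A ∙ (N ∙ N′)    ≈⟨ ∙-assoc (L′ ∙ L ∙ A) N N′ ⟨
    L′ ∙ L ∙ A ∙ N ∙ N′      ≈⟨ ∙-congʳ (∙-congʳ (∙-assoc L′ L A)) ⟩
    L′ ∙ (L ∙ A) ∙ N ∙ N′    ≈⟨ ∙-congʳ (∙-assoc L′ (L ∙ A) N) ⟩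
    L′ ∙ (L ∙ A ∙ N) ∙ N′    ≈⟨ ∙-congʳ (∙-congˡ (eq p)) ⟩
    L′ ∙ B ∙ N′              ≈⟨ eq q ⟩
    C ∎)
    where
    open ≋-R
    L = to (left p); L′ = to (left q); N = to (right p); N′ = to (right q)

  ∼-rows : ∀ {a b a′} {A : Mat a b} {B : Mat a′ b} (φ : Iso a′ a) → to φ ∙ A ≋ B → A ∼ B
  ∼-rows φ e = equivalent φ Iso-refl (≋-trans (∙-identityʳ _) e)

  ∼-columns : ∀ {a b b′} {A : Mat a b} {B : Mat a b′} (φ : Iso b b′) → A ∙ to φ ≋ B → A ∼ B
  ∼-columns φ e = equivalent Iso-refl φ (≋-trans (∙-congʳ (∙-identityˡ _)) e)

  ∼-reindex : ∀ {a b a′ b′} {A : Mat a b} {B : Mat a′ b′} (φ : Reindexing a′ a) (ψ : Reindexing b′ b) →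
              (∀ i j → entry A (Reindexing.to φ i) (Reindexing.to ψ j) ≈ entry B i j) → A ∼ B
  ∼-reindex {A = A} φ ψ e = equivalent (Iso-reindex φ) (Iso-sym (Iso-reindex ψ)) (pointwise λ i j →
    trans (∙-permutation ψ (permutation (Reindexing.to φ) ∙ A) i j)
      (trans (permutation-∙ (Reindexing.to φ) A i (Reindexing.to ψ j)) (e i j)))

  ∼-⊕ : ∀ {a b a′ b′ d e d′ e′} {A : Mat a b} {A′ : Mat a′ b′} {D : Mat d e} {D′ : Mat d′ e′} →
        A ∼ A′ → D ∼ D′ → block A 𝟘 𝟘 D ∼ block A′ 𝟘 𝟘 D′
  ∼-⊕ p q = equivalent (Iso-⊕ (left p) (left q)) (Iso-⊕ (right p) (right q))
    (≋-trans (∙-congʳ (block-𝟘-∙ _ _ _ _)) (≋-trans (block-𝟘-∙ _ _ _ _)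
      (block-cong (eq p) ≋-refl ≋-refl (eq q))))

  stack : ∀ {a b d} → Mat a d → Mat b d → Mat (a ⊕ b) d
  entry (stack A B) (inj₁ i) = entry A i
  entry (stack A B) (inj₂ i) = entry B i

  beside : ∀ {a b d} → Mat d a → Mat d b → Mat d (a ⊕ b)
  entry (beside A B) i (inj₁ j) = entry A i j
  entry (beside A B) i (inj₂ j) = entry B i j

  top : ∀ {a b d} → Mat (a ⊕ b) d → Mat a d
  entry (top A) i = entry A (inj₁ i)

  bottom : ∀ {a b d} → Mat (a ⊕ b) d → Mat b d
  entry (bottom A) i = entry A (inj₂ i)

  leftPart : ∀ {a b d} → Mat d (a ⊕ b) → Mat d a
  entry (leftPart A) i j = entry A i (inj₁ j)

  rightPart : ∀ {a b d} → Mat d (a ⊕ b) → Mat d b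
  entry (rightPart A) i j = entry A i (inj₂ j)

  stack-η : ∀ {a b d} (A : Mat (a ⊕ b) d) → A ≋ stack (top A) (bottom A)
  stack-η A = pointwise λ where
    (inj₁ i) j → refl
    (inj₂ i) j → refl

  stack-cong : ∀ {a b d} {A A′ : Mat a d} {B B′ : Mat b d} → A ≋ A′ → B ≋ B′ → stack A B ≋ stack A′ B′
  stack-cong e f = pointwise λ where
    (inj₁ i) j → at e i j
    (inj₂ i) j → at f i j

  stack-∙ : ∀ {a b d e} (A : Mat a d) (B : Mat b d) (C : Mat d e) → stack A B ∙ C ≋ stack (A ∙ C) (B ∙ C)
  stack-∙ A B C = pointwise λ where
    (inj₁ i) j → refl
    (inj₂ i) j → refl

  block-∙-stack : ∀ {a a′ b b′ d} (A : Mat a b) (B : Mat a b′) (C : Mat a′ b) (D : Mat a′ b′) (E : Mat b d) (F : Mat b′ d) →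
                  block A B C D ∙ stack E F ≋ stack (A ∙ E ⊞ B ∙ F) (C ∙ E ⊞ D ∙ F)
  block-∙-stack A B C D E F = pointwise λ where
    (inj₁ i) j → refl
    (inj₂ i) j → refl

  infix 4 _⇝_
  -- The columns stay fixed in the Euclidean reduction, because each of them carries its own
  -- modulus; hence a separate relation for row operations alone.
  record _⇝_ {a a′ b} (A : Mat a b) (B : Mat a′ b) : Set (c ⊔ ℓ) where
    constructor rows
    field
      iso  : Iso a′ a
      maps : to iso ∙ A ≋ B
  open _⇝_ public

  ⇝-reflexive : ∀ {a b} {A B : Mat a b} → A ≋ B → A ⇝ B
  ⇝-reflexive {A = A} e = rows Iso-refl (≋-trans (∙-identityˡ A) e)

  ⇝-trans : ∀ {a a′ a″ b} {A : Mat a b} {B : Mat a′ b} {C : Mat a″ b} → A ⇝ B → B ⇝ C → A ⇝ C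
  ⇝-trans {A = A} p q = rows (Iso-trans (iso q) (iso p))
    (≋-trans (∙-assoc (to (iso q)) (to (iso p)) A) (≋-trans (∙-congˡ (maps p)) (maps q)))

  ⇝-reindex : ∀ {a a′ b} {A : Mat a b} {B : Mat a′ b} (φ : Reindexing a′ a) →
              (∀ i j → entry A (Reindexing.to φ i) j ≈ entry B i j) → A ⇝ B
  ⇝-reindex {A = A} φ e = rows (Iso-reindex φ)
    (pointwise λ i j → trans (permutation-∙ (Reindexing.to φ) A i j) (e i j))

  ⇝-stack : ∀ {a a′ b b′ d} {A : Mat a d} {A′ : Mat a′ d} {B : Mat b d} {B′ : Mat b′ d} →
            A ⇝ A′ → B ⇝ B′ → stack A B ⇝ stack A′ B′
  ⇝-stack {A = A} {B = B} p q = rows (Iso-⊕ (iso p) (iso q)) (≋-trans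
    (block-∙-stack (to (iso p)) 𝟘 𝟘 (to (iso q)) A B)
    (stack-cong
      (≋-trans (⊞-cong (maps p) ∙-zeroˡ) (⊞-identityʳ _))
      (≋-trans (⊞-cong ∙-zeroˡ (maps q)) (⊞-identityˡ _))))

  ⇝-upper : ∀ {a b d} (X : Mat a b) (A : Mat a d) (B : Mat b d) → stack A B ⇝ stack (A ⊞ X ∙ B) B
  ⇝-upper X A B = rows (Iso-upper X) (≋-trans (block-∙-stack 𝟙 X 𝟘 𝟙 A B) (stack-cong
    (⊞-cong (∙-identityˡ A) ≋-refl) (≋-trans (⊞-cong ∙-zeroˡ (∙-identityˡ B)) (⊞-identityˡ B))))

  ⇝-lower : ∀ {a b d} (X : Mat b a) (A : Mat a d) (B : Mat b d) → stack A B ⇝ stack A (X ∙ A ⊞ B)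
  ⇝-lower X A B = rows (Iso-lower X) (≋-trans (block-∙-stack 𝟙 𝟘 X 𝟙 A B) (stack-cong
    (≋-trans (⊞-cong (∙-identityˡ A) ∙-zeroˡ) (⊞-identityʳ A)) (⊞-cong ≋-refl (∙-identityˡ B))))

  -- Congruence of the j-th columns modulo d j, for all j.
  infix 4 _≡_[mod_]
  record _≡_[mod_] {a b} (A B : Mat a b) (d : El b → Carrier) : Set (c ⊔ ℓ) where
    constructor multiple
    field
      quotient : Mat a b
      equality : A ≋ B ⊞ quotient ∙ diag d
  open _≡_[mod_] public

  mod-∙ : ∀ {a b e} {A B : Mat a b} {d : El b → Carrier} (G : Mat e a) → A ≡ B [mod d ] → G ∙ A ≡ G ∙ B [mod d ]
  mod-∙ {B = B} {d} G (multiple Z e) = multiple (G ∙ Z) (≋-trans (∙-congˡ e)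
    (≋-trans (∙-distribˡ G B (Z ∙ diag d)) (⊞-cong ≋-refl (≋-sym (∙-assoc G Z (diag d))))))

  mod-resp : ∀ {a b} {A A′ B B′ : Mat a b} {d : El b → Carrier} → A′ ≋ A → B ≋ B′ → A ≡ B [mod d ] → A′ ≡ B′ [mod d ]
  mod-resp e f (multiple Z g) = multiple Z (≋-trans e (≋-trans g (⊞-cong f ≋-refl)))

  mod-stack : ∀ {a b e} {A : Mat e b} {B B′ : Mat a b} {d : El b → Carrier} → B ≡ B′ [mod d ] → stack A B ≡ stack A B′ [mod d ]
  mod-stack {A = A} {B} {B′} {d} (multiple Z g) = multiple (stack 𝟘 Z) (pointwise λ where
    (inj₁ i) j → sym (trans (+-congˡ (at (∙-zeroˡ {A = diag d}) i j)) (+-identityʳ _))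
    (inj₂ i) j → at g i j)

  𝟙≋diag : ∀ {a} → 𝟙 {a} ≋ diag λ _ → 1#
  𝟙≋diag = pointwise λ i j → sym (*-identityˡ _)

  diag-cong : ∀ {a} {d e : El a → Carrier} → (∀ i → d i ≈ e i) → diag {a} d ≋ diag e
  diag-cong p = pointwise λ i j → *-congʳ (p i)

  diag-⊞ : ∀ {a} (d e : El a → Carrier) → diag {a} d ⊞ diag e ≋ diag λ i → d i + e i
  diag-⊞ d e = pointwise λ i j → sym (distribʳ _ _ _)

  diag-∙-diag : ∀ {a} (d e : El a → Carrier) → diag {a} d ∙ diag e ≋ diag λ i → d i * e i
  diag-∙-diag d e = pointwise λ i j → trans (diag-∙ d (diag e) i j) (sym (*-assoc _ _ _))

  diag-reindex : ∀ {a b} {d : El a → Carrier} (φ : Reindexing b a) → diag {a} d ∼ diag {b} (d ∘ Reindexing.to φ)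
  diag-reindex {a} {b} φ = ∼-reindex φ φ λ i j → *-congˡ (δ-cong {a} {b} (mk⇔
    (λ e → ≡.trans (≡.sym (φ.from-to i)) (≡.trans (≡.cong φ.from e) (φ.from-to j))) (≡.cong φ.to)))
    where module φ = Reindexing φ

  scalar-conjugate : ∀ {a b} y (φ : Iso a b) → to φ ∙ scalar y ∙ from φ ≋ scalar y
  scalar-conjugate y φ = begin
    to φ ∙ scalar y ∙ from φ    ≈⟨ ∙-congʳ (scalar-comm y (to φ)) ⟨
    scalar y ∙ to φ ∙ from φ    ≈⟨ ∙-assoc (scalar y) (to φ) (from φ) ⟩
    scalar y ∙ (to φ ∙ from φ)  ≈⟨ ∙-congˡ (to-from φ) ⟩
    scalar y ∙ 𝟙                ≈⟨ ∙-identityʳ (scalar y) ⟩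
    scalar y                    ∎
    where open ≋-R

  beside-𝟙-∙ : ∀ {a b d} (A : Mat (a ⊕ b) d) → beside 𝟙 𝟘 ∙ A ≋ top A
  beside-𝟙-∙ A = ≋-trans (pointwise λ _ _ → refl)
    (≋-trans (⊞-cong (∙-identityˡ (top A)) (∙-zeroˡ {A = bottom A})) (⊞-identityʳ (top A)))

  stack-∙-beside : ∀ {a b d e} (A : Mat a d) (B : Mat b d) → stack A B ∙ beside 𝟙 (𝟘 {d} {e}) ≋ block A 𝟘 B 𝟘
  stack-∙-beside A B = pointwise λ where
    (inj₁ i) (inj₁ j) → at (∙-identityʳ A) i j
    (inj₁ i) (inj₂ j) → at (∙-zeroʳ {A = A}) i j
    (inj₂ i) (inj₁ j) → at (∙-identityʳ B) i j
    (inj₂ i) (inj₂ j) → at (∙-zeroʳ {A = B}) i j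

-- Base change of matrices along a ring homomorphism

module _ {c₁ ℓ₁ c₂ ℓ₂} {R : CommutativeRing c₁ ℓ₁} {S : CommutativeRing c₂ ℓ₂} where
  private
    module R = CommutativeRing R
    module S = CommutativeRing S
    module RM = Matrices R
    module SM = Matrices S

  module BaseChange {h : R.Carrier → S.Carrier} (hom : IsRingHomomorphism R.rawRing S.rawRing h) where
    open IsRingHomomorphism hom

    h-∑ : ∀ a (f : El a → R.Carrier) → h (RM.∑ a f) S.≈ SM.∑ a (h ∘ f)
    h-∑ (fin zero)    f = 0#-homo
    h-∑ (fin (suc n)) f = S.trans (+-homo _ _) (S.+-congˡ (h-∑ (fin n) (f ∘ suc)))
    h-∑ (a ⊕ b) f = S.trans (+-homo _ _) (S.+-cong (h-∑ a _) (h-∑ b _))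

    mapᴹ : ∀ {a b} → RM.Mat a b → SM.Mat a b
    SM.entry (mapᴹ A) i j = h (RM.entry A i j)

    map-cong : ∀ {a b} {A B : RM.Mat a b} → A RM.≋ B → mapᴹ A SM.≋ mapᴹ B
    map-cong e = SM.pointwise λ i j → ⟦⟧-cong (RM.at e i j)

    map-∙ : ∀ {a b d} (A : RM.Mat a b) (B : RM.Mat b d) → mapᴹ (A RM.∙ B) SM.≋ mapᴹ A SM.∙ mapᴹ B
    map-∙ {b = b} A B = SM.pointwise λ i j → S.trans (h-∑ b _) (SM.∑-cong b λ k → *-homo _ _)

    map-⊞ : ∀ {a b} (A B : RM.Mat a b) → mapᴹ (A RM.⊞ B) SM.≋ mapᴹ A SM.⊞ mapᴹ B
    map-⊞ A B = SM.pointwise λ i j → +-homo _ _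

    h-δ : ∀ a (i j : El a) → h (RM.δ {a} i j) S.≈ SM.δ {a} i j
    h-δ a i j with does (_≟ˢ_ {a} i j)
    ... | true  = 1#-homo
    ... | false = 0#-homo

    map-𝟙 : ∀ {a} → mapᴹ (RM.𝟙 {a}) SM.≋ SM.𝟙
    map-𝟙 {a} = SM.pointwise λ i j → h-δ a i j

    map-diag : ∀ {a} (d : El a → R.Carrier) → mapᴹ (RM.diag {a} d) SM.≋ SM.diag (h ∘ d)
    map-diag {a} d = SM.pointwise λ i j → S.trans (*-homo _ _) (S.*-congˡ (h-δ a i j))

    map-Iso : ∀ {a b} → RM.Iso a b → SM.Iso a b
    map-Iso φ = record
      { to = mapᴹ (RM.to φ)
      ; from = mapᴹ (RM.from φ)
      ; to-from = SM.≋-trans (SM.≋-sym (map-∙ (RM.to φ) (RM.from φ))) (SM.≋-trans (map-cong (RM.to-from φ)) map-𝟙)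
      ; from-to = SM.≋-trans (SM.≋-sym (map-∙ (RM.from φ) (RM.to φ))) (SM.≋-trans (map-cong (RM.from-to φ)) map-𝟙)
      }

-- Completing columns to a basis of ℤᵐ

module ℤM = Matrices ℤ.+-*-commutativeRing

swapʳ : ∀ {a b} → Reindexing (a ⊕ b) (b ⊕ a)
swapʳ = record
  { to = ⊎.swap ; from = ⊎.swap
  ; from-to = λ { (inj₁ _) → ≡.refl ; (inj₂ _) → ≡.refl }
  ; to-from = λ { (inj₁ _) → ≡.refl ; (inj₂ _) → ≡.refl }
  }

assocʳ : ∀ {a b c} → Reindexing ((a ⊕ b) ⊕ c) (a ⊕ (b ⊕ c))
assocʳ = record
  { to = ⊎.assocʳ ; from = ⊎.assocˡ
  ; from-to = λ { (inj₁ (inj₁ _)) → ≡.refl ; (inj₁ (inj₂ _)) → ≡.refl ; (inj₂ _) → ≡.refl }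
  ; to-from = λ { (inj₁ _) → ≡.refl ; (inj₂ (inj₁ _)) → ≡.refl ; (inj₂ (inj₂ _)) → ≡.refl }
  }

symʳ : ∀ {a b} → Reindexing a b → Reindexing b a
symʳ φ = record { to = from ; from = to ; from-to = to-from ; to-from = from-to }
  where open Reindexing φ

transʳ : ∀ {a b c} → Reindexing a b → Reindexing b c → Reindexing a c
transʳ φ ψ = record
  { to = ψ.to ∘ φ.to ; from = φ.from ∘ ψ.from
  ; from-to = λ i → ≡.trans (≡.cong φ.from (ψ.from-to _)) (φ.from-to i)
  ; to-from = λ j → ≡.trans (≡.cong ψ.to (φ.to-from _)) (ψ.to-from j)
  }
  where
  module φ = Reindexing φ
  module ψ = Reindexing ψ

⊕ʳ : ∀ {a b c d} → Reindexing a b → Reindexing c d → Reindexing (a ⊕ c) (b ⊕ d)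
⊕ʳ φ ψ = record
  { to = ⊎.map φ.to ψ.to ; from = ⊎.map φ.from ψ.from
  ; from-to = λ { (inj₁ i) → ≡.cong inj₁ (φ.from-to i) ; (inj₂ i) → ≡.cong inj₂ (ψ.from-to i) }
  ; to-from = λ { (inj₁ i) → ≡.cong inj₁ (φ.to-from i) ; (inj₂ i) → ≡.cong inj₂ (ψ.to-from i) }
  }
  where
  module φ = Reindexing φ
  module ψ = Reindexing ψ

reflʳ : ∀ {a} → Reindexing a a
reflʳ = record { to = id ; from = id ; from-to = λ _ → ≡.refl ; to-from = λ _ → ≡.refl }

joinʳ : ∀ m n → Reindexing (fin m ⊕ fin n) (fin (m ℕ.+ n))
joinʳ m n = record
  { to = Fin.join m n ; from = Fin.splitAt m
  ; from-to = Fin.splitAt-join m n ; to-from = Fin.join-splitAt m n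
  }

module Unimodular where
  open ℤM

  ⟨_⟩ : ℤ → Mat (fin 1) (fin 1)
  entry ⟨ a ⟩ _ _ = a

  -- Passing from (a , b) to (b , a mod b) is one row addition and one swap, and the absolute value
  -- of the second entry decreases. The split into two mutual functions supplies the nonzero
  -- instance that division asks for.
  euclid-pair : ∀ a b → Acc ℕ._<_ ∣ b ∣ → ∃ λ g → stack ⟨ a ⟩ ⟨ b ⟩ ⇝ stack ⟨ g ⟩ (𝟘 {fin 1})
  euclid-step : ∀ a b .{{_ : ℤ.NonZero b}} → Acc ℕ._<_ ∣ b ∣ → ∃ λ g → stack ⟨ a ⟩ ⟨ b ⟩ ⇝ stack ⟨ g ⟩ (𝟘 {fin 1})

  euclid-pair a (+ 0)       rs = a , ⇝-reflexive (stack-cong ≋-refl (pointwise λ _ _ → ≡.refl))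
  euclid-pair a b@(+ suc _) rs = euclid-step a b rs
  euclid-pair a b@(-[1+ _ ]) rs = euclid-step a b rs

  euclid-step a b (acc rs) =
    let g , p = euclid-pair b (+ r) (rs (ℤ.n%d<d a b)) in
    g , ⇝-trans (⇝-upper ⟨ ℤ.- q ⟩ ⟨ a ⟩ ⟨ b ⟩) (⇝-trans (⇝-reindex swapʳ swapped) p)
    where
    q = a ℤ./ b
    r = a ℤ.% b
    swapped : ∀ i j → entry (stack (⟨ a ⟩ ⊞ ⟨ ℤ.- q ⟩ ∙ ⟨ b ⟩) ⟨ b ⟩) (⊎.swap i) j ≡ entry (stack ⟨ b ⟩ ⟨ + r ⟩) i j
    swapped (inj₁ _) _ = ≡.refl
    swapped (inj₂ _) _ = ≡.trans (≡.cong (ℤ._+ (ℤ.- q ℤ.* b ℤ.+ 0ℤ)) (ℤ.a≡a%n+[a/n]*n a b)) (lemma (+ r) q b)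
      where
      lemma : ∀ r q b → r ℤ.+ q ℤ.* b ℤ.+ (ℤ.- q ℤ.* b ℤ.+ 0ℤ) ≡ r
      lemma = solve-∀

  consʳ : ∀ n → Reindexing (fin 1 ⊕ fin n) (fin (suc n))
  consʳ n = joinʳ 1 n

  -- Indexed flatly so that it can sit below one more entry: an operation on two rows then extends
  -- to `m + 2` rows in `⇝-pair`.
  leading : ∀ {m} → ℤ → Mat (fin (suc m)) (fin 1)
  entry (leading a) zero    _ = a
  entry (leading a) (suc _) _ = 0ℤ

  ⇝-pair : ∀ {m a b a′ b′} → stack ⟨ a ⟩ ⟨ b ⟩ ⇝ stack ⟨ a′ ⟩ ⟨ b′ ⟩ →
           stack ⟨ a ⟩ (leading {m} b) ⇝ stack ⟨ a′ ⟩ (leading {m} b′)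
  ⇝-pair {m} {a} {b} {a′} {b′} p =
    ⇝-trans (⇝-reindex {B = stack (stack ⟨ a ⟩ ⟨ b ⟩) (𝟘 {fin m})} φ λ where
      (inj₁ (inj₁ _))    _ → ≡.refl
      (inj₁ (inj₂ zero)) _ → ≡.refl
      (inj₂ _)           _ → ≡.refl)
    (⇝-trans (⇝-stack p (⇝-reflexive ≋-refl)) (⇝-reindex (symʳ φ) λ where
      (inj₁ zero)    _ → ≡.refl
      (inj₂ zero)    _ → ≡.refl
      (inj₂ (suc _)) _ → ≡.refl))
    where
    φ = transʳ assocʳ (⊕ʳ reflʳ (consʳ m))

  𝟘≋leading : ∀ {m} → 𝟘 ≋ leading {m} 0ℤ
  𝟘≋leading = pointwise λ { zero _ → ≡.refl ; (suc _) _ → ≡.refl }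

  euclid : ∀ m (c : Mat (fin (suc m)) (fin 1)) → ∃ λ g → c ⇝ stack ⟨ g ⟩ (𝟘 {fin m})
  euclid zero c = entry c zero zero , ⇝-reindex (consʳ 0) λ { (inj₁ zero) zero → ≡.refl }
  euclid (suc m) c =
    let g′ , p = euclid m c′
        g , q = euclid-pair c₀ g′ (<-wellFounded ∣ g′ ∣)
    in g , ⇝-trans (⇝-reindex {B = stack ⟨ c₀ ⟩ c′} (consʳ (suc m)) λ where
              (inj₁ zero) zero → ≡.refl
              (inj₂ _)    _    → ≡.refl)
          (⇝-trans (⇝-stack (⇝-reflexive ≋-refl) (⇝-trans p (⇝-reindex {B = leading g′} (symʳ (consʳ m)) λ where
              zero    _ → ≡.refl
              (suc _) _ → ≡.refl)))
          (⇝-trans (⇝-pair (⇝-trans q (⇝-reflexive (stack-cong ≋-refl (pointwise λ _ _ → ≡.refl)))))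
          (⇝-reflexive (stack-cong ≋-refl (≋-sym 𝟘≋leading)))))
    where
    c₀ = entry c zero zero
    c′ : Mat (fin (suc m)) (fin 1)
    entry c′ i j = entry c (suc i) j

  e₁ : ∀ {m} → Mat (fin 1 ⊕ fin m) (fin 1)
  e₁ = stack 𝟙 𝟘

  -- Units modulo 0 or 2 are ±1, so no spare row is needed to normalise them.
  ZeroOrTwo : ℤ → Set
  ZeroOrTwo f = f ≡ 0ℤ ⊎ f ≡ + 2

  record Reduction {a} (c : Mat a (fin 1)) (f : ℤ) (m : ℕ) : Set where
    field
      {reduced} : Mat (fin 1 ⊕ fin m) (fin 1)
      reduction : c ⇝ reduced
      congruent : reduced ≡ e₁ [mod (λ _ → f) ]

  mod-e₁ : ∀ {m f} (A z : Mat (fin 1 ⊕ fin m) (fin 1)) →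
           (∀ i → entry A i zero ≡ entry e₁ i zero ℤ.+ entry z i zero ℤ.* f) → A ≡ e₁ [mod (λ _ → f) ]
  mod-e₁ {f = f} A z e = multiple z (pointwise λ { i zero →
    ≡.trans (e i) (≡.cong (λ u → entry e₁ i zero ℤ.+ u) (≡.sym (∙-diag z (λ _ → f) i zero))) })

  even≢1 : ∀ u → u ℤ.* + 2 ≢ 1ℤ
  even≢1 u eq = 2∤1 (≡.trans (≡.sym (ℤ.abs-* u (+ 2))) (≡.cong ∣_∣ eq))
    where
    2∤1 : ∣ u ∣ ℕ.* 2 ≢ 1
    2∤1 p with ∣ u ∣
    2∤1 () | zero
    2∤1 () | suc _

  -- A unit g modulo f is turned into 1 by (g , 0) ↦ (g , hg) ≡ (g , 1) ↦ (1 , 1) ↦ (1 , 0).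
  normalise : ∀ m g h y f → h ℤ.* g ℤ.+ y ℤ.* f ≡ 1ℤ → 1 ℕ.≤ m ⊎ ZeroOrTwo f → Reduction (stack ⟨ g ⟩ (𝟘 {fin m})) f m
  normalise (suc m) g h y f e (inj₁ _) = record
    { reduction = ⇝-trans (⇝-reflexive (stack-cong ≋-refl 𝟘≋leading)) (⇝-pair pair)
    ; congruent = mod-e₁ _ (stack ⟨ z₁ ⟩ (leading z₂)) λ where
        (inj₁ zero)    → ≡.refl
        (inj₂ zero)    → ≡.sym (ℤ.+-identityˡ _)
        (inj₂ (suc _)) → ≡.refl
    }
    where
    -- With `h g = 1 - y f`, the entry `g + (1 - g) h g` equals `1 + (g - 1) y f`, and subtracting
    -- it from `h g` leaves `- g y f`. So `z₁` and `z₂` are the quotients by `f`.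
    z₁ = (g ℤ.- 1ℤ) ℤ.* y
    z₂ = ℤ.- (g ℤ.* y)
    a = 1ℤ ℤ.+ z₁ ℤ.* f
    b = h ℤ.* g
    b≡ : b ≡ 1ℤ ℤ.- y ℤ.* f
    b≡ = ≡.trans (lemma b (y ℤ.* f)) (≡.cong (ℤ._- y ℤ.* f) e)
      where
      lemma : ∀ u v → u ≡ u ℤ.+ v ℤ.- v
      lemma = solve-∀
    top≡ : ∀ g y f → g ℤ.+ ((1ℤ ℤ.- g) ℤ.* (1ℤ ℤ.- y ℤ.* f) ℤ.+ 0ℤ) ≡ 1ℤ ℤ.+ (g ℤ.- 1ℤ) ℤ.* y ℤ.* f
    top≡ = solve-∀
    bottom≡ : ∀ g y f → -1ℤ ℤ.* (1ℤ ℤ.+ (g ℤ.- 1ℤ) ℤ.* y ℤ.* f) ℤ.+ 0ℤ ℤ.+ (1ℤ ℤ.- y ℤ.* f) ≡ ℤ.- (g ℤ.* y) ℤ.* f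
    bottom≡ = solve-∀
    pair : stack ⟨ g ⟩ ⟨ 0ℤ ⟩ ⇝ stack ⟨ a ⟩ ⟨ z₂ ℤ.* f ⟩
    pair =
      ⇝-trans (⇝-lower ⟨ h ⟩ ⟨ g ⟩ ⟨ 0ℤ ⟩)
      (⇝-trans (⇝-reflexive {B = stack ⟨ g ⟩ ⟨ b ⟩} (stack-cong ≋-refl (pointwise λ _ _ →
        ≡.trans (ℤ.+-identityʳ (b ℤ.+ 0ℤ)) (ℤ.+-identityʳ b))))
      (⇝-trans (⇝-upper ⟨ 1ℤ ℤ.- g ⟩ ⟨ g ⟩ ⟨ b ⟩)
      (⇝-trans (⇝-reflexive {B = stack ⟨ a ⟩ ⟨ b ⟩} (stack-cong (pointwise λ _ _ →
        ≡.trans (≡.cong (λ u → g ℤ.+ ((1ℤ ℤ.- g) ℤ.* u ℤ.+ 0ℤ)) b≡) (top≡ g y f)) ≋-refl))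
      (⇝-trans (⇝-lower ⟨ -1ℤ ⟩ ⟨ a ⟩ ⟨ b ⟩)
      (⇝-reflexive (stack-cong ≋-refl (pointwise λ _ _ →
        ≡.trans (≡.cong (λ u → -1ℤ ℤ.* a ℤ.+ 0ℤ ℤ.+ u) b≡) (bottom≡ g y f))))))))
  -- For `f = 0` the Bézout relation reads `h g = 1`, so multiplying the row by `h` is an invertible
  -- operation.
  normalise m g h y f e (inj₂ (inj₁ ≡.refl)) = record
    { reduction = ⇝-stack (rows sign sign-∙) (⇝-reflexive ≋-refl)
    ; congruent = mod-e₁ _ 𝟘 λ { (inj₁ zero) → ≡.refl ; (inj₂ i) → ≡.refl }
    }
    where
    hg≡1 : h ℤ.* g ≡ 1ℤ
    hg≡1 = ≡.trans (lemma (h ℤ.* g) y) e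
      where
      lemma : ∀ u y → u ≡ u ℤ.+ y ℤ.* 0ℤ
      lemma = solve-∀
    hg≋𝟙 : ⟨ h ⟩ ∙ ⟨ g ⟩ ≋ 𝟙
    hg≋𝟙 = pointwise λ { zero zero → ≡.trans (ℤ.+-identityʳ (h ℤ.* g)) hg≡1 }
    gh≋𝟙 : ⟨ g ⟩ ∙ ⟨ h ⟩ ≋ 𝟙
    gh≋𝟙 = pointwise λ { zero zero → ≡.trans (ℤ.+-identityʳ (g ℤ.* h)) (≡.trans (ℤ.*-comm g h) hg≡1) }
    sign : Iso (fin 1) (fin 1)
    sign = record { to = ⟨ h ⟩ ; from = ⟨ g ⟩ ; to-from = hg≋𝟙 ; from-to = gh≋𝟙 }
    sign-∙ : ⟨ h ⟩ ∙ ⟨ g ⟩ ≋ ⟨ 1ℤ ⟩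
    sign-∙ = pointwise λ _ _ → ≡.trans (ℤ.+-identityʳ (h ℤ.* g)) hg≡1
  -- For `f = 2` the relation forces `g` to be odd, and then `g` is already 1 modulo 2.
  normalise m g h y f e (inj₂ (inj₂ ≡.refl)) = record
    { reduction = ⇝-reflexive ≋-refl
    ; congruent = mod-e₁ _ (stack ⟨ proj₁ (odd g e) ⟩ 𝟘) λ { (inj₁ zero) → proj₂ (odd g e) ; (inj₂ i) → ≡.refl }
    }
    where
    odd : ∀ g → h ℤ.* g ℤ.+ y ℤ.* + 2 ≡ 1ℤ → ∃ λ z → g ≡ 1ℤ ℤ.+ z ℤ.* + 2
    odd g e with g ℤ.% + 2 | ℤ.n%d<d g (+ 2) | ℤ.a≡a%n+[a/n]*n g (+ 2)
    ... | 0 | _ | g≡ = contradiction (≡.trans (lemma h (g ℤ./ + 2) y) (≡.trans (≡.cong (λ u → h ℤ.* u ℤ.+ y ℤ.* + 2) (≡.sym g≡)) e)) (even≢1 (h ℤ.* (g ℤ./ + 2) ℤ.+ y))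
      where
      lemma : ∀ h q y → (h ℤ.* q ℤ.+ y) ℤ.* + 2 ≡ h ℤ.* (0ℤ ℤ.+ q ℤ.* + 2) ℤ.+ y ℤ.* + 2
      lemma = solve-∀
    ... | 1 | _ | g≡ = g ℤ./ + 2 , g≡
    ... | suc (suc _) | s≤s (s≤s ()) | _

  firstColumn : ∀ {a k} → Mat a (fin (suc k)) → Mat a (fin 1)
  entry (firstColumn C) i _ = entry C i zero

  otherColumns : ∀ {a k} → Mat a (fin (suc k)) → Mat a (fin k)
  entry (otherColumns C) i j = entry C i (suc j)

  -- Euclid brings `c` to `(g ; 0)`. Carrying the row `x` along by the inverse operations rewrites
  -- `x ∙ c` as `h g`, with `h` the first entry of `x̂`; so the hypothesis becomes the Bézout
  -- relation for `g` and `f`.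
  reduce-column : ∀ m (c : Mat (fin (suc m)) (fin 1)) (x : Mat (fin 1) (fin (suc m))) y f →
                  entry (x ∙ c) zero zero ℤ.+ y ℤ.* f ≡ 1ℤ → 1 ℕ.≤ m ⊎ ZeroOrTwo f → Reduction c f m
  reduce-column m c x y f e cond = record { reduction = ⇝-trans p n.reduction ; congruent = n.congruent }
    where
    g = proj₁ (euclid m c)
    p = proj₂ (euclid m c)
    x̂ = x ∙ from (iso p)
    h = entry x̂ zero (inj₁ zero)
    x∙c≡hg : entry (x ∙ c) zero zero ≡ h ℤ.* g
    x∙c≡hg = ≡.trans (≡.sym (at (≋-trans (cancel-inner x c (from-to (iso p))) ≋-refl) zero zero))
      (≡.trans (at (∙-congˡ {A = x̂} (maps p)) zero zero)
      (≡.trans (≡.cong₂ ℤ._+_ (ℤ.+-identityʳ (h ℤ.* g)) (at (∙-zeroʳ {d = fin 1} {A = rightPart x̂}) zero zero))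
      (ℤ.+-identityʳ (h ℤ.* g))))
    module n = Reduction (normalise m g h y f (≡.trans (≡.cong (ℤ._+ y ℤ.* f) (≡.sym x∙c≡hg)) e) cond)

  mod-columns : ∀ {a k} {A B : Mat a (fin (suc k))} {f : Fin (suc k) → ℤ} →
                firstColumn A ≡ firstColumn B [mod (λ _ → f zero) ] →
                otherColumns A ≡ otherColumns B [mod f ∘ suc ] → A ≡ B [mod f ]
  mod-columns {a} {k} {A} {B} {f} (multiple z e) (multiple Z e′) = multiple q (pointwise λ where
    i zero    → ≡.trans (at e i zero) (≡.cong (λ t → entry B i zero ℤ.+ t)
                  (≡.trans (∙-diag z (λ _ → f zero) i zero) (≡.sym (∙-diag q f i zero))))
    i (suc j) → ≡.trans (at e′ i j) (≡.cong (λ t → entry B i (suc j) ℤ.+ t)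
                  (≡.trans (∙-diag Z (f ∘ suc) i j) (≡.sym (∙-diag q f i (suc j))))))
    where
    q : Mat a (fin (suc k))
    entry q i zero    = entry z i zero
    entry q i (suc j) = entry Z i j

  -- For `f = 0` this says that the columns of `C` are part of a basis of ℤᵐ; that case later yields
  -- the bases adapted to the kernels of the down maps.
  record Completion {m k} (C : Mat (fin m) (fin k)) (f : Fin k → ℤ) : Set where
    field
      extra     : ℕ
      size      : m ≡ k ℕ.+ extra
      {reduced} : Mat (fin k ⊕ fin extra) (fin k)
      reduction : C ⇝ reduced
      congruent : reduced ≡ stack 𝟙 𝟘 [mod f ]

  Descending : ∀ {k} → (Fin k → ℤ) → Set
  Descending f = ∀ i j → i Fin.≤ j → ∃ λ d → f i ≡ f j ℤ.* d

  -- The matrix relation says that the rows of `C` and of `diag f` together span ℤᵏ. It survives the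
  -- removal of the first column: once that column is `e₁` modulo `f₀`, the remaining rows of `X̂`
  -- start with a multiple of `f₀`, hence of every later `f`, and the contribution of the first row
  -- can be moved into `Y`.
  complete : ∀ k m (C : Mat (fin m) (fin k)) (f : Fin k → ℤ) (X : Mat (fin k) (fin m)) (Y : Mat (fin k) (fin k)) →
             Descending f → X ∙ C ⊞ Y ∙ diag f ≋ 𝟙 → k ℕ.< m ⊎ (∀ i → ZeroOrTwo (f i)) → Completion C f
  complete zero m C f X Y desc e cond = record
    { extra = m
    ; size = ≡.refl
    ; reduction = ⇝-reindex {B = 𝟘} (joinʳ 0 m) λ _ ()
    ; congruent = multiple 𝟘 (pointwise λ _ ())
    }
  -- Without rows, `Y ∙ diag f` would be the identity and `f zero` a unit of ℤ.
  complete (suc k) zero C f X Y desc e (inj₂ zeroOrTwo) = contradiction Yf≡1 (Yf≢1 (zeroOrTwo zero))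
    where
    u = entry Y zero zero
    Yf≡1 : u ℤ.* f zero ≡ 1ℤ
    Yf≡1 = ≡.trans (≡.sym (≡.trans (ℤ.+-identityˡ _) (∙-diag Y f zero zero))) (at e zero zero)
    Yf≢1 : ∀ {f} → ZeroOrTwo f → u ℤ.* f ≢ 1ℤ
    Yf≢1 (inj₁ ≡.refl) eq = contradiction (≡.trans (≡.sym (ℤ.*-zeroʳ u)) eq) λ ()
    Yf≢1 (inj₂ ≡.refl) eq = even≢1 u eq
  complete (suc k) (suc m) C f X Y desc e cond = record
    { extra = ih.extra
    ; size = ≡.cong suc ih.size
    ; reduction = rows (Iso-trans (Iso-reindex φ) (Iso-trans (Iso-upper W) (Iso-trans (Iso-⊕ Iso-refl E₁) E₀))) ≋-refl
    ; congruent = mod-columns first others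
    }
    where
    f₀ = f zero
    f′ = f ∘ suc

    x : Mat (fin 1) (fin (suc m))
    entry x _ j = entry X zero j
    x-eq : entry (x ∙ firstColumn C) zero zero ℤ.+ entry Y zero zero ℤ.* f₀ ≡ 1ℤ
    x-eq = ≡.trans (≡.cong (λ u → entry (X ∙ C) zero zero ℤ.+ u) (≡.sym (∙-diag Y f zero zero))) (at e zero zero)

    -- The bound `suc k < suc m` leaves a row below the first one; this is the spare row used by
    -- `normalise`.
    module r = Reduction (reduce-column m (firstColumn C) x (entry Y zero zero) f₀ x-eq
      (⊎.map (ℕ.≤-trans (s≤s z≤n) ∘ ℕ.≤-pred) (λ z → z zero) cond))

    E₀ = iso r.reduction
    X̂ = X ∙ from E₀
    Ĉ = to E₀ ∙ otherColumns C
    a = top Ĉ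
    A′ = bottom Ĉ

    X′ : Mat (fin k) (fin m)
    entry X′ i j = entry X̂ (suc i) (inj₂ j)

    z = quotient r.congruent
    u : Fin k → ℤ
    u i = entry (X̂ ∙ z) (suc i) zero ℤ.+ entry Y (suc i) zero

    -- Off the first row, column 0 of the hypothesis has right-hand side 0, and `X ∙ C` there is
    -- this entry plus a multiple of `f₀`.
    X̂-top : ∀ i → entry X̂ (suc i) (inj₁ zero) ≡ ℤ.- (u i ℤ.* f₀)
    X̂-top i = solve-v v w y f₀ (begin
      v ℤ.+ w ℤ.* f₀ ℤ.+ y ℤ.* f₀
        ≡⟨ ≡.cong₂ ℤ._+_ (≡.sym X∙c≡) (≡.sym (∙-diag Y f (suc i) zero)) ⟩
      entry (X ∙ C) (suc i) zero ℤ.+ entry (Y ∙ diag f) (suc i) zero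
        ≡⟨ at e (suc i) zero ⟩
      0ℤ ∎)
      where
      open ≡.≡-Reasoning
      v = entry X̂ (suc i) (inj₁ zero)
      w = entry (X̂ ∙ z) (suc i) zero
      y = entry Y (suc i) zero
      solve-v : ∀ v w y f → v ℤ.+ w ℤ.* f ℤ.+ y ℤ.* f ≡ 0ℤ → v ≡ ℤ.- ((w ℤ.+ y) ℤ.* f)
      solve-v v w y f eq = ≡.trans (lemma v w y f) (≡.trans (≡.cong (ℤ._- (w ℤ.+ y) ℤ.* f) eq) (ℤ.+-identityˡ _))
        where
        lemma : ∀ v w y f → v ≡ v ℤ.+ w ℤ.* f ℤ.+ y ℤ.* f ℤ.- (w ℤ.+ y) ℤ.* f
        lemma = solve-∀
      X∙c≡ : entry (X ∙ C) (suc i) zero ≡ v ℤ.+ w ℤ.* f₀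
      X∙c≡ = begin
        entry (X ∙ firstColumn C) (suc i) zero
          ≡⟨ at (cancel-inner X (firstColumn C) (from-to E₀)) (suc i) zero ⟨
        entry (X̂ ∙ (to E₀ ∙ firstColumn C)) (suc i) zero
          ≡⟨ at (∙-congˡ {A = X̂} (maps r.reduction)) (suc i) zero ⟩
        entry (X̂ ∙ r.reduced) (suc i) zero
          ≡⟨ at (equality (mod-∙ X̂ r.congruent)) (suc i) zero ⟩
        entry (X̂ ∙ e₁) (suc i) zero ℤ.+ entry (X̂ ∙ z ∙ diag (λ _ → f₀)) (suc i) zero
          ≡⟨ ≡.cong₂ ℤ._+_ X̂∙e₁ (∙-diag (X̂ ∙ z) (λ _ → f₀) (suc i) zero) ⟩
        v ℤ.+ w ℤ.* f₀ ∎
        where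
        X̂∙e₁ : entry (X̂ ∙ e₁) (suc i) zero ≡ v
        X̂∙e₁ = ≡.trans
          (≡.cong₂ ℤ._+_ (at (∙-identityʳ (leftPart X̂)) (suc i) zero) (at (∙-zeroʳ {d = fin 1} {A = rightPart X̂}) (suc i) zero))
          (ℤ.+-identityʳ v)

    Y′ : Mat (fin k) (fin k)
    -- The first row `a` of the transformed columns enters with coefficient `- u i * f₀`. As
    -- `f₀ = f′ j * d`, the product is a multiple of `f′ j` and is charged to `Y′`.
    entry Y′ i j = entry Y (suc i) (suc j) ℤ.- u i ℤ.* proj₁ (desc zero (suc j) z≤n) ℤ.* entry a zero j

    eq′ : X′ ∙ A′ ⊞ Y′ ∙ diag f′ ≋ 𝟙
    eq′ = pointwise λ i j →
      let v = entry X̂ (suc i) (inj₁ zero)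
          S = entry (X′ ∙ A′) i j
          y = entry Y (suc i) (suc j)
          d , f₀≡ = desc zero (suc j) z≤n
      in begin
      S ℤ.+ entry (Y′ ∙ diag f′) i j
        ≡⟨ ≡.cong (λ t → S ℤ.+ t) (∙-diag Y′ f′ i j) ⟩
      S ℤ.+ (y ℤ.- u i ℤ.* d ℤ.* entry a zero j) ℤ.* f′ j
        ≡⟨ lemma S y (u i) d (entry a zero j) (f′ j) ⟩
      ℤ.- (u i ℤ.* (f′ j ℤ.* d)) ℤ.* entry a zero j ℤ.+ 0ℤ ℤ.+ S ℤ.+ y ℤ.* f′ j
        ≡⟨ ≡.cong (λ t → t ℤ.* entry a zero j ℤ.+ 0ℤ ℤ.+ S ℤ.+ y ℤ.* f′ j)
             (≡.trans (≡.cong (λ t → ℤ.- (u i ℤ.* t)) (≡.sym f₀≡)) (≡.sym (X̂-top i))) ⟩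
      v ℤ.* entry a zero j ℤ.+ 0ℤ ℤ.+ S ℤ.+ y ℤ.* f′ j
        ≡⟨ ≡.cong₂ ℤ._+_ (at (cancel-inner X (otherColumns C) (from-to E₀)) (suc i) j) (≡.sym (∙-diag Y f (suc i) (suc j))) ⟩
      entry (X ∙ C) (suc i) (suc j) ℤ.+ entry (Y ∙ diag f) (suc i) (suc j)
        ≡⟨ at e (suc i) (suc j) ⟩
      entry 𝟙 i j ∎
      where
      open ≡.≡-Reasoning
      lemma : ∀ S y u d a f → S ℤ.+ (y ℤ.- u ℤ.* d ℤ.* a) ℤ.* f ≡ ℤ.- (u ℤ.* (f ℤ.* d)) ℤ.* a ℤ.+ 0ℤ ℤ.+ S ℤ.+ y ℤ.* f
      lemma = solve-∀

    module ih = Completion (complete k m A′ f′ X′ Y′ (λ i j i≤j → desc (suc i) (suc j) (s≤s i≤j)) eq′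
      (⊎.map ℕ.≤-pred (λ z → z ∘ suc) cond))

    E₁ = iso ih.reduction

    φ : Reindexing (fin (suc k) ⊕ fin ih.extra) (fin 1 ⊕ (fin k ⊕ fin ih.extra))
    φ = transʳ (⊕ʳ (symʳ (consʳ k)) reflʳ) assocʳ

    W : Mat (fin 1) (fin k ⊕ fin ih.extra)
    -- Clears `a` against the identity block that now stands below it. The first column is not
    -- disturbed, since modulo `f₀` it vanishes below its first entry.
    W = beside (⊟ a) 𝟘

    G₁ = to (Iso-reindex φ)
    G₂ = to (Iso-upper W)
    G₃ = to (Iso-⊕ (Iso-refl {fin 1}) E₁)

    unfold : ∀ {n} (A : Mat (fin (suc m)) (fin n)) → G₁ ∙ (G₂ ∙ (G₃ ∙ to E₀)) ∙ A ≋ G₁ ∙ (G₂ ∙ (G₃ ∙ (to E₀ ∙ A)))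
    unfold A = ≋-trans (∙-assoc G₁ _ A) (∙-congˡ (≋-trans (∙-assoc G₂ _ A) (∙-congˡ (∙-assoc G₃ (to E₀) A))))

    G₂-stack : ∀ {n} (A : Mat (fin 1) (fin n)) (B : Mat (fin k ⊕ fin ih.extra) (fin n)) →
               G₂ ∙ stack A B ≋ stack (A ⊞ W ∙ B) B
    G₂-stack A B = maps (⇝-upper W A B)

    G₃-stack : ∀ {n} (A : Mat (fin 1) (fin n)) (B : Mat (fin m) (fin n)) → G₃ ∙ stack A B ≋ stack A (to E₁ ∙ B)
    G₃-stack A B = maps (⇝-stack (⇝-reflexive {A = A} ≋-refl) (rows {A = B} E₁ ≋-refl))

    G : Mat (fin (suc k) ⊕ fin ih.extra) (fin (suc k))
    G = G₁ ∙ (G₂ ∙ (G₃ ∙ to E₀)) ∙ C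

    first : firstColumn G ≡ firstColumn (stack 𝟙 𝟘) [mod (λ _ → f₀) ]
    first = mod-resp
      (≋-trans (pointwise λ _ _ → ≡.refl) (≋-trans (unfold (firstColumn C))
        (∙-congˡ {A = G₁} (∙-congˡ {A = G₂} (∙-congˡ {A = G₃} (maps r.reduction))))))
      (begin
        G₁ ∙ (G₂ ∙ (G₃ ∙ stack 𝟙 𝟘))
          ≈⟨ ∙-congˡ {A = G₁} (∙-congˡ {A = G₂} (≋-trans (G₃-stack 𝟙 𝟘) (stack-cong ≋-refl (∙-zeroʳ {A = to E₁})))) ⟩
        G₁ ∙ (G₂ ∙ stack 𝟙 𝟘)
          ≈⟨ ∙-congˡ {A = G₁} (≋-trans (G₂-stack 𝟙 𝟘) (stack-cong (≋-trans (⊞-cong ≋-refl ∙-zeroʳ) (⊞-identityʳ 𝟙)) ≋-refl)) ⟩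
        G₁ ∙ stack 𝟙 𝟘
          ≈⟨ pointwise (λ i j → ≡.trans (permutation-∙ (Reindexing.to φ) (stack 𝟙 𝟘) i j) (collect i j)) ⟩
        firstColumn (stack 𝟙 𝟘) ∎)
      (mod-∙ G₁ (mod-∙ G₂ (mod-∙ G₃ r.congruent)))
      where
      open ≋-R
      collect : ∀ i j → entry (stack 𝟙 (𝟘 {fin k ⊕ fin ih.extra})) (Reindexing.to φ i) j ≡ entry (firstColumn {k = k} (stack 𝟙 𝟘)) i j
      collect (inj₁ zero)    zero = ≡.refl
      collect (inj₁ (suc i)) zero = ≡.refl
      collect (inj₂ i)       zero = ≡.refl

    others : otherColumns G ≡ otherColumns (stack 𝟙 𝟘) [mod f′ ]
    others = mod-resp
      (begin
        otherColumns G
          ≈⟨ (pointwise λ _ _ → ≡.refl) ⟩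
        G₁ ∙ (G₂ ∙ (G₃ ∙ to E₀)) ∙ otherColumns C
          ≈⟨ unfold (otherColumns C) ⟩
        G₁ ∙ (G₂ ∙ (G₃ ∙ Ĉ))
          ≈⟨ ∙-congˡ {A = G₁} (∙-congˡ {A = G₂} (≋-trans (∙-congˡ {A = G₃} (stack-η Ĉ))
               (≋-trans (G₃-stack a A′) (stack-cong ≋-refl (maps ih.reduction))))) ⟩
        G₁ ∙ (G₂ ∙ stack a ih.reduced) ∎)
      (begin
        G₁ ∙ (G₂ ∙ stack a (stack 𝟙 𝟘))
          ≈⟨ ∙-congˡ {A = G₁} (G₂-stack a (stack 𝟙 𝟘)) ⟩
        G₁ ∙ stack (a ⊞ W ∙ stack 𝟙 𝟘) (stack 𝟙 𝟘)
          ≈⟨ ∙-congˡ {A = G₁} (stack-cong (≋-trans (⊞-cong ≋-refl W-stack) (⊞-⊟ a)) ≋-refl) ⟩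
        G₁ ∙ stack 𝟘 (stack 𝟙 𝟘)
          ≈⟨ pointwise (λ i j → ≡.trans (permutation-∙ (Reindexing.to φ) (stack 𝟘 (stack 𝟙 𝟘)) i j) (collect i j)) ⟩
        otherColumns (stack 𝟙 𝟘) ∎)
      (mod-∙ G₁ (mod-∙ G₂ (mod-stack ih.congruent)))
      where
      open ≋-R
      W-stack : W ∙ stack 𝟙 𝟘 ≋ ⊟ a
      W-stack = ≋-trans (pointwise λ _ _ → ≡.refl) (≋-trans
        (⊞-cong (∙-identityʳ (⊟ a)) (∙-zeroʳ {A = 𝟘 {fin 1} {fin ih.extra}})) (⊞-identityʳ (⊟ a)))
      collect : ∀ i j → entry (stack 𝟘 (stack 𝟙 (𝟘 {fin ih.extra}))) (Reindexing.to φ i) j ≡ entry (otherColumns (stack 𝟙 𝟘)) i j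
      collect (inj₁ zero)    j = ≡.refl
      collect (inj₁ (suc i)) j = ≡.refl
      collect (inj₂ i)       j = ≡.refl

-- The inductive step

-- The order of a concatenation: no constructor puts an `inj₂` before an `inj₁`. It carries
-- divisibility chains through `splitAt`, for the new list of factors and again for the Smith
-- diagonal.
data Ordered {k l} : Fin k ⊎ Fin l → Fin k ⊎ Fin l → Set where
  first : ∀ {i j} → i Fin.≤ j → Ordered (inj₁ i) (inj₁ j)
  cross : ∀ {i j} → Ordered (inj₁ i) (inj₂ j)
  last  : ∀ {i j} → i Fin.≤ j → Ordered (inj₂ i) (inj₂ j)

splitAt-ordered : ∀ k {l} (i j : Fin (k ℕ.+ l)) → i Fin.≤ j → Ordered (Fin.splitAt k i) (Fin.splitAt k j)
splitAt-ordered zero    i       j       i≤j = last i≤j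
splitAt-ordered (suc k) zero    zero    i≤j = first z≤n
splitAt-ordered (suc k) zero    (suc j) i≤j with Fin.splitAt k j
... | inj₁ _ = first z≤n
... | inj₂ _ = cross
splitAt-ordered (suc k) (suc i) (suc j) (s≤s i≤j) with Fin.splitAt k i | Fin.splitAt k j | splitAt-ordered k i j i≤j
... | _ | _ | first p = first (s≤s p)
... | _ | _ | cross = cross
... | _ | _ | last p = last p

split-ordered : ∀ {m} k l → m ≡ k ℕ.+ l →
                Σ (Reindexing (fin m) (fin k ⊕ fin l)) λ φ →
                ∀ i j → i Fin.≤ j → Ordered (Reindexing.to φ i) (Reindexing.to φ j)
split-ordered k l ≡.refl = symʳ (joinʳ k l) , splitAt-ordered k

∣_∣ˢ : Shape → ℕ
∣ fin n ∣ˢ = n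
∣ a ⊕ b ∣ˢ = ∣ a ∣ˢ ℕ.+ ∣ b ∣ˢ

flattenʳ : ∀ a → Reindexing a (fin ∣ a ∣ˢ)
flattenʳ (fin n) = reflʳ
flattenʳ (a ⊕ b) = transʳ (⊕ʳ (flattenʳ a) (flattenʳ b)) (joinʳ ∣ a ∣ˢ ∣ b ∣ˢ)

-- The step asks of the coefficient ring only a homomorphism from ℤ and division by `y` with integer
-- remainder, so polynomials stay out of the argument.
module Elimination {c ℓ} (A : CommutativeRing c ℓ) {ι : ℤ → CommutativeRing.Carrier A}
  (ι-hom : IsRingHomomorphism (CommutativeRing.rawRing ℤ.+-*-commutativeRing) (CommutativeRing.rawRing A) ι) where
  open CommutativeRing A hiding (zero)
  open Matrices A
  module Z = Matrices ℤ.+-*-commutativeRing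
  open BaseChange {R = ℤ.+-*-commutativeRing} {S = A} ι-hom
    renaming (mapᴹ to map-ι; map-cong to ι-cong; map-∙ to ι-∙; map-⊞ to ι-⊞; map-𝟙 to ι-𝟙; map-diag to ι-diag; map-Iso to ι-Iso)

  -- The homomorphism A → ℤ with kernel yA.
  record Evaluation (y : Carrier) : Set (c ⊔ ℓ) where
    field
      ev       : Carrier → ℤ
      ev-hom   : IsRingHomomorphism rawRing (CommutativeRing.rawRing ℤ.+-*-commutativeRing) ev
      ev-ι     : ∀ n → ev (ι n) ≡ n
      ev-y     : ev y ≡ 0ℤ
      division : ∀ a → ∃ λ q → a ≈ ι (ev a) + y * q

  -- The factors run against the Smith order because `complete` treats the column with the most
  -- divisible factor first. The number `k` is part of the type since it is compared with the next
  -- one; the units form an arbitrary shape that simply grows from step to step.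
  record DiagonalForm {n} (M : Mat (fin n) (fin n)) (k : ℕ) : Set (c ⊔ ℓ) where
    field
      units       : Shape
      total       : n ≡ ∣ units ∣ˢ ℕ.+ k
      factors     : Fin k → Carrier
      descending  : ∀ i j → i Fin.≤ j → ∃ λ d → factors i ≈ factors j * d
      equivalence : M ∼ block (𝟙 {units}) 𝟘 𝟘 (diag {fin k} factors)

  +-cancel-outer : ∀ {a b j c} → a + c ≈ 0# → (a + b) + (j + c) ≈ j + b
  +-cancel-outer {a} {b} {j} {c} a+c≈0 = begin
    (a + b) + (j + c)  ≈⟨ +-congˡ (+-comm j c) ⟩
    (a + b) + (c + j)  ≈⟨ interchange a b c j ⟩
    (a + c) + (b + j)  ≈⟨ +-cong a+c≈0 (+-comm b j) ⟩
    0# + (j + b)       ≈⟨ +-identityˡ _ ⟩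
    j + b              ∎
    where
    open ≈-R
    open CommutativeSemigroupProperties +-commutativeSemigroup using (interchange)

  clear-corner : ∀ {a b e} (W : Mat b a) (Z : Mat b e) → block (𝟙 {a}) (𝟘 {a} {e}) W Z ∼ block 𝟙 𝟘 𝟘 Z
  clear-corner W Z = ∼-rows (Iso-lower (⊟ W)) (≋-trans (lower-∙ (⊟ W) 𝟙 𝟘 W Z) (block-cong ≋-refl ≋-refl
    (≋-trans (⊞-cong (∙-identityʳ (⊟ W)) ≋-refl) (⊟-⊞ W))
    (≋-trans (⊞-cong ∙-zeroʳ ≋-refl) (⊞-identityˡ Z))))

  reduce-corner : ∀ {a b} {F : Mat a a} {B C : Mat b a} {y} (Q : Mat b a) → B ≋ C ⊞ scalar y ∙ Q →
                  block F 𝟘 B (scalar y) ∼ block F 𝟘 C (scalar y)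
  reduce-corner {F = F} {B} {C} {y} Q e = ∼-columns (Iso-lower (⊟ Q)) (≋-trans (∙-lower (⊟ Q) F 𝟘 B (scalar y))
    (block-cong (≋-trans (⊞-cong ≋-refl ∙-zeroˡ) (⊞-identityʳ F)) ≋-refl
      (pointwise λ i j → begin
        entry B i j + entry (scalar y ∙ ⊟ Q) i j
          ≈⟨ +-cong (trans (at e i j) (+-congˡ (diag-∙ _ Q i j))) (diag-∙ _ (⊟ Q) i j) ⟩
        entry C i j + y * entry Q i j + y * - entry Q i j
          ≈⟨ +-assoc _ _ _ ⟩
        entry C i j + (y * entry Q i j + y * - entry Q i j)
          ≈⟨ +-congˡ (trans (sym (distribˡ _ _ _)) (trans (*-congˡ (-‿inverseʳ _)) (zeroʳ y))) ⟩
        entry C i j + 0#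
          ≈⟨ +-identityʳ _ ⟩
        entry C i j ∎)
      ≋-refl))
    where open ≈-R

  add-rows : ∀ {a b} {F : Mat a a} {B : Mat b a} {Y : Mat b b} (X : Mat b a) →
             block F 𝟘 B Y ∼ block F 𝟘 (X ∙ F ⊞ B) Y
  add-rows {F = F} {B} {Y} X = ∼-rows (Iso-lower X) (≋-trans (lower-∙ X F 𝟘 B Y)
    (block-cong ≋-refl ≋-refl ≋-refl (≋-trans (⊞-cong ∙-zeroʳ ≋-refl) (⊞-identityˡ Y))))

  block-∙-lowerTriangular : ∀ {a a′ b b′ d} (L : Mat a′ a) (M : Mat a b) (N : Mat b b′) (B : Mat d b) (Y : Mat d d) →
    block L 𝟘 𝟘 𝟙 ∙ block M 𝟘 B Y ∙ block N 𝟘 𝟘 𝟙 ≋ block (L ∙ M ∙ N) 𝟘 (B ∙ N) Y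
  block-∙-lowerTriangular L M N B Y = ≋-trans
    (∙-congʳ (≋-trans (block-∙ L 𝟘 𝟘 𝟙 M 𝟘 B Y) (block-cong
      (≋-trans (⊞-cong ≋-refl ∙-zeroˡ) (⊞-identityʳ _))
      (≋-trans (⊞-cong ∙-zeroʳ ∙-zeroˡ) (⊞-identityʳ _))
      (≋-trans (⊞-cong ∙-zeroˡ (∙-identityˡ B)) (⊞-identityˡ _))
      (≋-trans (⊞-cong ∙-zeroˡ (∙-identityˡ Y)) (⊞-identityˡ _)))))
    (≋-trans (block-∙ (L ∙ M) 𝟘 B Y N 𝟘 𝟘 𝟙) (block-cong
      (≋-trans (⊞-cong ≋-refl ∙-zeroˡ) (⊞-identityʳ _))
      (≋-trans (⊞-cong ∙-zeroʳ ∙-zeroˡ) (⊞-identityʳ _))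
      (≋-trans (⊞-cong ≋-refl ∙-zeroʳ) (⊞-identityʳ _))
      (≋-trans (⊞-cong ∙-zeroʳ (∙-identityʳ Y)) (⊞-identityˡ _))))

  -- Row operations `E` on the corner turn the neighbouring block `y` into `E y`. Applying the
  -- inverse of `E` to the columns of that block restores `y`, as scalars are central, and does not
  -- touch the corner.
  corner-∼ : ∀ {a b b′} {F : Mat a a} {B : Mat b a} {B′ : Mat b′ a} {y} → B ⇝ B′ →
             block F 𝟘 B (scalar y) ∼ block F 𝟘 B′ (scalar y)
  corner-∼ {F = F} {B} {B′} {y} p = equivalent (Iso-⊕ Iso-refl (iso p)) (Iso-⊕ Iso-refl (Iso-sym (iso p))) (≋-trans
    (∙-congʳ (≋-trans (block-∙ 𝟙 𝟘 𝟘 E F 𝟘 B (scalar y)) (block-cong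
      (≋-trans (⊞-cong (∙-identityˡ F) ∙-zeroˡ) (⊞-identityʳ _))
      (≋-trans (⊞-cong ∙-zeroʳ ∙-zeroˡ) (⊞-identityʳ _))
      (≋-trans (⊞-cong ∙-zeroˡ (maps p)) (⊞-identityˡ _))
      (≋-trans (⊞-cong ∙-zeroˡ ≋-refl) (⊞-identityˡ _)))))
    (≋-trans (block-∙ F 𝟘 B′ (E ∙ scalar y) 𝟙 𝟘 𝟘 (from (iso p))) (block-cong
      (≋-trans (⊞-cong (∙-identityʳ F) ∙-zeroˡ) (⊞-identityʳ _))
      (≋-trans (⊞-cong ∙-zeroʳ ∙-zeroˡ) (⊞-identityʳ _))
      (≋-trans (⊞-cong (∙-identityʳ B′) ∙-zeroʳ) (⊞-identityʳ _))
      (≋-trans (⊞-cong ∙-zeroʳ (scalar-conjugate y (iso p))) (⊞-identityˡ _)))))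
    where E = to (iso p)

  -- f 0       0 −fy       1  y        1  0
  -- 1 y   ↦   1  y    ↦   0 −fy   ↦   0 −fy
  merge : ∀ {k} (f : El k → Carrier) y → block (diag {k} f) 𝟘 𝟙 (scalar y) ∼ block (𝟙 {k}) 𝟘 𝟘 (diag {k} λ i → - f i * y)
  merge {k} f y =
    ∼-trans (∼-rows (Iso-upper (diag -f)) (≋-trans (upper-∙ (diag -f) (diag f) 𝟘 𝟙 (scalar y)) (block-cong
      (≋-trans (⊞-cong ≋-refl (∙-identityʳ (diag -f)))
        (≋-trans (diag-⊞ f -f) (pointwise λ i j → trans (*-congʳ (-‿inverseʳ _)) (zeroˡ _))))
      (≋-trans (⊞-identityˡ _) (diag-∙-diag -f (λ _ → y))) ≋-refl ≋-refl)))
    (∼-trans (∼-reindex {A = block 𝟘 (diag -fy) 𝟙 (scalar y)} {B = block 𝟙 (scalar y) 𝟘 (diag -fy)} swapʳ reflʳ λ where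
      (inj₁ i) (inj₁ j) → refl
      (inj₁ i) (inj₂ j) → refl
      (inj₂ i) (inj₁ j) → refl
      (inj₂ i) (inj₂ j) → refl)
    (∼-columns (Iso-upper (⊟ scalar y)) (≋-trans (∙-upper (⊟ scalar y) 𝟙 (scalar y) 𝟘 (diag -fy)) (block-cong
      ≋-refl (≋-trans (⊞-cong (∙-identityˡ _) ≋-refl) (⊟-⊞ (scalar y))) ≋-refl
      (≋-trans (⊞-cong ∙-zeroˡ ≋-refl) (⊞-identityˡ _))))))
    where
    -f -fy : El k → Carrier
    -f i = - f i
    -fy i = - f i * y

  -- `P` is the adapted basis: its last `k′` columns lie in the kernel of `D`, its first `t` columns
  -- are preimages of the standard basis. The left inverse `V` expresses that `U` is split
  -- injective.
  module Step {t t′ k k′} (size : t′ ≡ t ℕ.+ k′) (U : Z.Mat (fin t′) (fin t)) (D : Z.Mat (fin t) (fin t′)) (V : Z.Mat (fin t) (fin t′))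
    (P : Z.Iso (fin t′) (fin t ⊕ fin k′)) (D∙P : D Z.∙ Z.to P Z.≋ Z.beside Z.𝟙 Z.𝟘) (V∙U : V Z.∙ U Z.≋ Z.𝟙)
    {y : Carrier} (evaluation : Evaluation y) (form : DiagonalForm (map-ι (D Z.∙ U) ⊞ scalar y) k) where
    open Evaluation evaluation
    open DiagonalForm form
    private
      module E = BaseChange {R = A} {S = ℤ.+-*-commutativeRing} ev-hom
      module ev = IsRingHomomorphism ev-hom
      module ι = IsRingHomomorphism ι-hom

    f₀ : Fin k → ℤ
    f₀ i = ev (factors i)

    private
      L = left equivalence
      N = right equivalence
      H = D Z.∙ U
      B = Z.bottom (Z.from P) Z.∙ U

      -- Multiplying `D ∙ P = (1 0)` by the inverse of `P` on the right exhibits `D` as the upper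
      -- part of that inverse.
      from-P : Z.from P Z.≋ Z.stack D (Z.bottom (Z.from P))
      from-P = Z.≋-trans (Z.stack-η (Z.from P)) (Z.stack-cong (begin
        Z.top (Z.from P)                    ≈⟨ Z.beside-𝟙-∙ (Z.from P) ⟨
        Z.beside Z.𝟙 Z.𝟘 Z.∙ Z.from P       ≈⟨ Z.∙-congʳ D∙P ⟨
        D Z.∙ Z.to P Z.∙ Z.from P           ≈⟨ Z.∙-assoc D (Z.to P) (Z.from P) ⟩
        D Z.∙ (Z.to P Z.∙ Z.from P)         ≈⟨ Z.∙-congˡ (Z.to-from P) ⟩
        D Z.∙ Z.𝟙                           ≈⟨ Z.∙-identityʳ D ⟩
        D                                   ∎) Z.≋-refl)
        where open Z.≋-R

      from-P-U : Z.from P Z.∙ U Z.≋ Z.stack H B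
      from-P-U = Z.≋-trans (Z.∙-congʳ from-P) (Z.stack-∙ D _ U)

      conjugate-UD : Z.from P Z.∙ (U Z.∙ D) Z.∙ Z.to P Z.≋ Z.block H Z.𝟘 B Z.𝟘
      conjugate-UD = begin
        Z.from P Z.∙ (U Z.∙ D) Z.∙ Z.to P     ≈⟨ Z.∙-congʳ (Z.∙-assoc (Z.from P) U D) ⟨
        Z.from P Z.∙ U Z.∙ D Z.∙ Z.to P       ≈⟨ Z.∙-assoc (Z.from P Z.∙ U) D (Z.to P) ⟩
        Z.from P Z.∙ U Z.∙ (D Z.∙ Z.to P)     ≈⟨ Z.∙-cong from-P-U D∙P ⟩
        Z.stack H B Z.∙ Z.beside Z.𝟙 Z.𝟘     ≈⟨ Z.stack-∙-beside H B ⟩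
        Z.block H Z.𝟘 B Z.𝟘                  ∎
        where open Z.≋-R

      split-kernel : map-ι (U Z.∙ D) ⊞ scalar y ∼ block (map-ι H ⊞ scalar y) 𝟘 (map-ι B) (scalar y)
      split-kernel = equivalent (Iso-sym (ι-Iso P)) (ι-Iso P) (begin
        F ∙ (map-ι (U Z.∙ D) ⊞ scalar y) ∙ T
          ≈⟨ ∙-congʳ (∙-distribˡ F (map-ι (U Z.∙ D)) (scalar y)) ⟩
        (F ∙ map-ι (U Z.∙ D) ⊞ F ∙ scalar y) ∙ T
          ≈⟨ ∙-distribʳ T (F ∙ map-ι (U Z.∙ D)) (F ∙ scalar y) ⟩
        F ∙ map-ι (U Z.∙ D) ∙ T ⊞ F ∙ scalar y ∙ T
          ≈⟨ ⊞-cong (≋-trans (∙-congʳ (≋-sym (ι-∙ (Z.from P) (U Z.∙ D)))) (≋-sym (ι-∙ (Z.from P Z.∙ (U Z.∙ D)) (Z.to P))))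
               (scalar-conjugate y (Iso-sym (ι-Iso P))) ⟩
        map-ι (Z.from P Z.∙ (U Z.∙ D) Z.∙ Z.to P) ⊞ scalar y
          ≈⟨ ⊞-cong (ι-cong conjugate-UD) ≋-refl ⟩
        map-ι (Z.block H Z.𝟘 B Z.𝟘) ⊞ scalar y
          ≈⟨ (pointwise λ where
               (inj₁ i) (inj₁ j) → refl
               (inj₁ i) (inj₂ j) → trans (+-cong ι.0#-homo (zeroʳ y)) (+-identityˡ 0#)
               (inj₂ i) (inj₁ j) → trans (+-congˡ (zeroʳ y)) (+-identityʳ _)
               (inj₂ i) (inj₂ j) → trans (+-congʳ ι.0#-homo) (+-identityˡ _)) ⟩
        block (map-ι H ⊞ scalar y) 𝟘 (map-ι B) (scalar y) ∎)
        where
        open ≋-R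
        F = map-ι (Z.from P)
        T = map-ι (Z.to P)

      BN = map-ι B ∙ to N
      B₁ = leftPart BN
      B₂ = rightPart BN

      use-form : block (map-ι H ⊞ scalar y) 𝟘 (map-ι B) (scalar y) ∼
                 block 𝟙 𝟘 (stack 𝟘 B₁) (block (diag {fin k} factors) 𝟘 B₂ (scalar y))
      use-form = ∼-trans (equivalent (Iso-⊕ L Iso-refl) (Iso-⊕ N Iso-refl) (≋-trans
          (block-∙-lowerTriangular (to L) (map-ι H ⊞ scalar y) (to N) (map-ι B) (scalar y))
          (block-cong (eq equivalence) ≋-refl ≋-refl ≋-refl)))
        (∼-reindex (symʳ assocʳ) (symʳ assocʳ) λ where
          (inj₁ i)        (inj₁ j)        → refl
          (inj₁ i)        (inj₂ (inj₁ j)) → refl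
          (inj₁ i)        (inj₂ (inj₂ j)) → refl
          (inj₂ (inj₁ i)) (inj₁ j)        → refl
          (inj₂ (inj₁ i)) (inj₂ (inj₁ j)) → refl
          (inj₂ (inj₁ i)) (inj₂ (inj₂ j)) → refl
          (inj₂ (inj₂ i)) (inj₁ j)        → refl
          (inj₂ (inj₂ i)) (inj₂ (inj₁ j)) → refl
          (inj₂ (inj₂ i)) (inj₂ (inj₂ j)) → refl)

      -- The column transformation `N` has entries in `A`, so `B₂` need not be integral; `C` is its
      -- residue modulo `y`.
      C : Z.Mat (fin k′) (fin k)
      C = E.mapᴹ B₂

      residue : ∀ {a b} (M : Mat a b) → ∃ λ Q → M ≋ map-ι (E.mapᴹ M) ⊞ scalar y ∙ Q
      residue {a} {b} M = Q , pointwise λ i j →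
        trans (proj₂ (division (entry M i j))) (+-congˡ (sym (diag-∙ _ Q i j)))
        where
        Q : Mat a b
        entry Q i j = proj₁ (division (entry M i j))

      N₀ = E.map-Iso N
      L₀ = E.map-Iso L

      -- At `y = 0` the diagonal form over `A` becomes one for the integer matrix `D ∙ U` itself.
      -- This ties the values `f₀` to the same basis change `N₀` that produces `C`.
      ev-DU : Z.to L₀ Z.∙ H Z.∙ Z.to N₀ Z.≋ Z.block Z.𝟙 Z.𝟘 Z.𝟘 (Z.diag {fin k} f₀)
      ev-DU = begin
        Z.to L₀ Z.∙ H Z.∙ Z.to N₀
          ≈⟨ Z.∙-congʳ (Z.∙-congˡ (Z.pointwise λ i j → ≡.sym (ev-scalar i j))) ⟩
        Z.to L₀ Z.∙ E.mapᴹ (map-ι H ⊞ scalar y) Z.∙ Z.to N₀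
          ≈⟨ Z.∙-congʳ (E.map-∙ (to L) (map-ι H ⊞ scalar y)) ⟨
        E.mapᴹ (to L ∙ (map-ι H ⊞ scalar y)) Z.∙ Z.to N₀
          ≈⟨ E.map-∙ (to L ∙ (map-ι H ⊞ scalar y)) (to N) ⟨
        E.mapᴹ (to L ∙ (map-ι H ⊞ scalar y) ∙ to N)
          ≈⟨ E.map-cong (eq equivalence) ⟩
        E.mapᴹ (block 𝟙 𝟘 𝟘 (diag {fin k} factors))
          ≈⟨ (Z.pointwise λ where
               (inj₁ i) (inj₁ j) → E.h-δ units i j
               (inj₁ i) (inj₂ j) → ev.0#-homo
               (inj₂ i) (inj₁ j) → ev.0#-homo
               (inj₂ i) (inj₂ j) → Z.at (E.map-diag {fin k} factors) i j) ⟩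
        Z.block Z.𝟙 Z.𝟘 Z.𝟘 (Z.diag {fin k} f₀) ∎
        where
        open Z.≋-R
        ev-scalar : ∀ i j → ev (ι (Z.entry H i j) + y * δ {fin t} i j) ≡ Z.entry H i j
        ev-scalar i j = ≡.trans (ev.+-homo _ _) (≡.trans (≡.cong₂ ℤ._+_ (ev-ι _)
          (≡.trans (ev.*-homo _ _) (≡.cong (ℤ._* ev (δ {fin t} i j)) ev-y))) (ℤ.+-identityʳ _))

      W = V Z.∙ Z.to P
      W₁ = Z.leftPart W
      W₂ = Z.rightPart W

      V-split : W₁ Z.∙ H Z.⊞ W₂ Z.∙ B Z.≋ Z.𝟙
      V-split = begin
        W₁ Z.∙ H Z.⊞ W₂ Z.∙ B           ≈⟨ (Z.pointwise λ _ _ → ≡.refl) ⟩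
        W Z.∙ Z.stack H B               ≈⟨ Z.∙-congˡ from-P-U ⟨
        W Z.∙ (Z.from P Z.∙ U)           ≈⟨ Z.cancel-inner V U (Z.to-from P) ⟩
        V Z.∙ U                          ≈⟨ V∙U ⟩
        Z.𝟙                              ∎
        where open Z.≋-R

      X̂ = Z.from N₀ Z.∙ W₂
      Ŷ = Z.from N₀ Z.∙ W₁ Z.∙ Z.from L₀

      -- The relation `V-split` conjugated by `N₀`, with `H` rewritten through its diagonal form.
      ev-split : Ŷ Z.∙ Z.block Z.𝟙 Z.𝟘 Z.𝟘 (Z.diag {fin k} f₀) Z.⊞ X̂ Z.∙ (B Z.∙ Z.to N₀) Z.≋ Z.𝟙
      ev-split = begin
        Ŷ Z.∙ Z.block Z.𝟙 Z.𝟘 Z.𝟘 (Z.diag {fin k} f₀) Z.⊞ X̂ Z.∙ (B Z.∙ Z.to N₀)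
          ≈⟨ Z.⊞-cong (Z.∙-congˡ {A = Ŷ} (Z.≋-sym ev-DU)) Z.≋-refl ⟩
        Ŷ Z.∙ (Z.to L₀ Z.∙ H Z.∙ Z.to N₀) Z.⊞ X̂ Z.∙ (B Z.∙ Z.to N₀)
          ≈⟨ Z.⊞-cong (Z.≋-trans (Z.∙-congˡ {A = Ŷ} (Z.∙-assoc (Z.to L₀) H (Z.to N₀)))
               (Z.cancel-inner (Z.from N₀ Z.∙ W₁) (H Z.∙ Z.to N₀) (Z.from-to L₀))) Z.≋-refl ⟩
        Z.from N₀ Z.∙ W₁ Z.∙ (H Z.∙ Z.to N₀) Z.⊞ X̂ Z.∙ (B Z.∙ Z.to N₀)
          ≈⟨ Z.⊞-cong (regroup W₁ H) (regroup W₂ B) ⟩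
        Z.from N₀ Z.∙ (W₁ Z.∙ H) Z.∙ Z.to N₀ Z.⊞ Z.from N₀ Z.∙ (W₂ Z.∙ B) Z.∙ Z.to N₀
          ≈⟨ Z.∙-distribʳ (Z.to N₀) (Z.from N₀ Z.∙ (W₁ Z.∙ H)) (Z.from N₀ Z.∙ (W₂ Z.∙ B)) ⟨
        (Z.from N₀ Z.∙ (W₁ Z.∙ H) Z.⊞ Z.from N₀ Z.∙ (W₂ Z.∙ B)) Z.∙ Z.to N₀
          ≈⟨ Z.∙-congʳ (Z.∙-distribˡ (Z.from N₀) (W₁ Z.∙ H) (W₂ Z.∙ B)) ⟨
        Z.from N₀ Z.∙ (W₁ Z.∙ H Z.⊞ W₂ Z.∙ B) Z.∙ Z.to N₀
          ≈⟨ Z.∙-congʳ (Z.≋-trans (Z.∙-congˡ V-split) (Z.∙-identityʳ _)) ⟩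
        Z.from N₀ Z.∙ Z.to N₀
          ≈⟨ Z.from-to N₀ ⟩
        Z.𝟙 ∎
        where
        open Z.≋-R
        regroup : ∀ {a} (G : Z.Mat (fin t) a) (H : Z.Mat a (fin t)) →
                  Z.from N₀ Z.∙ G Z.∙ (H Z.∙ Z.to N₀) Z.≋ Z.from N₀ Z.∙ (G Z.∙ H) Z.∙ Z.to N₀
        regroup G H = Z.≋-trans (Z.≋-sym (Z.∙-assoc (Z.from N₀ Z.∙ G) H (Z.to N₀)))
          (Z.∙-congʳ (Z.∙-assoc (Z.from N₀) G H))

      X₀ = Z.bottom X̂
      Y₀ = Z.bottom (Z.rightPart Ŷ)

      -- The lower right block of `ev-split`, to which the unit part of the diagonal contributes
      -- nothing.
      C-unimodular : X₀ Z.∙ C Z.⊞ Y₀ Z.∙ Z.diag f₀ Z.≋ Z.𝟙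
      C-unimodular = Z.pointwise λ i j → begin
        Z.entry (X₀ Z.∙ C) i j ℤ.+ Z.entry (Y₀ Z.∙ Z.diag f₀) i j
          ≡⟨ ℤ.+-comm (Z.entry (X₀ Z.∙ C) i j) _ ⟩
        Z.entry (Y₀ Z.∙ Z.diag f₀) i j ℤ.+ Z.entry (X₀ Z.∙ C) i j
          ≡⟨ ≡.cong₂ ℤ._+_
               (≡.trans (≡.sym (ℤ.+-identityˡ (Z.entry (Y₀ Z.∙ Z.diag f₀) i j))) (≡.cong (ℤ._+ Z.entry (Y₀ Z.∙ Z.diag f₀) i j)
                 (≡.sym (Z.at (Z.∙-zeroʳ {d = fin k} {A = Z.bottom (Z.leftPart Ŷ)}) i j))))
               (Z.at (Z.∙-congˡ {A = X₀} C≋) i j) ⟩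
        Z.entry (Ŷ Z.∙ Z.block Z.𝟙 Z.𝟘 Z.𝟘 (Z.diag {fin k} f₀)) (inj₂ i) (inj₂ j) ℤ.+ Z.entry (X̂ Z.∙ (B Z.∙ Z.to N₀)) (inj₂ i) (inj₂ j)
          ≡⟨ Z.at ev-split (inj₂ i) (inj₂ j) ⟩
        Z.entry Z.𝟙 i j ∎
        where
        open ≡.≡-Reasoning
        C≋ : C Z.≋ Z.rightPart (B Z.∙ Z.to N₀)
        C≋ = Z.pointwise λ i j → ≡.trans (Z.at (E.map-∙ (map-ι B) (to N)) i (inj₂ j))
          (Z.at (Z.∙-congʳ {A = E.mapᴹ (map-ι B)} {A′ = B} {B = Z.to N₀} (Z.pointwise λ i j → ev-ι _)) i (inj₂ j))

      f₀-descending : Unimodular.Descending f₀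
      f₀-descending i j i≤j = let d , e = descending i j i≤j in
        ev d , ≡.trans (ev.⟦⟧-cong e) (ev.*-homo _ _)

    module _ (cond : k ℕ.< k′ ⊎ (∀ i → Unimodular.ZeroOrTwo (f₀ i))) where
      private
        module K = Unimodular.Completion (Unimodular.complete k k′ C f₀ X₀ Y₀ f₀-descending C-unimodular cond)
        l = K.extra
        J : Mat (fin k ⊕ fin l) (fin k)
        J = stack 𝟙 𝟘
        Qf = residue (diag {fin k} factors)

        ι-reduction : map-ι C ⇝ map-ι K.reduced
        ι-reduction = rows (ι-Iso (Z.iso K.reduction))
          (≋-trans (≋-sym (ι-∙ (Z.to (Z.iso K.reduction)) C)) (ι-cong (Z.maps K.reduction)))

        ζ = map-ι (Z.quotient K.congruent)

        -- The error in `K.reduced` is `ζ` times the values of the factors at `y = 0`, whereas the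
        -- rows at hand contain the factors themselves. The two differ by `y` times `proj₁ Qf`, so
        -- subtracting `ζ ∙ diag factors` leaves `J` modulo `y`.
        cleared : ⊟ ζ ∙ diag factors ⊞ map-ι K.reduced ≋ J ⊞ scalar y ∙ (⊟ ζ ∙ proj₁ Qf)
        cleared = begin
          ⊟ ζ ∙ diag factors ⊞ map-ι K.reduced
            ≈⟨ ⊞-cong (≋-trans (∙-congˡ (proj₂ Qf)) (∙-distribˡ (⊟ ζ) F₀ (scalar y ∙ proj₁ Qf))) ι-congruent ⟩
          (⊟ ζ ∙ F₀ ⊞ ⊟ ζ ∙ (scalar y ∙ proj₁ Qf)) ⊞ (J ⊞ ζ ∙ F₀)
            ≈⟨ (pointwise λ i j → +-cancel-outer (at cancels i j)) ⟩
          J ⊞ ⊟ ζ ∙ (scalar y ∙ proj₁ Qf)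
            ≈⟨ ⊞-cong ≋-refl (≋-trans (≋-sym (∙-assoc (⊟ ζ) (scalar y) (proj₁ Qf)))
                 (≋-trans (∙-congʳ (≋-sym (scalar-comm y (⊟ ζ)))) (∙-assoc (scalar y) (⊟ ζ) (proj₁ Qf)))) ⟩
          J ⊞ scalar y ∙ (⊟ ζ ∙ proj₁ Qf) ∎
          where
          open ≋-R
          F₀ = map-ι (E.mapᴹ (diag {fin k} factors))
          cancels : ⊟ ζ ∙ F₀ ⊞ ζ ∙ F₀ ≋ 𝟘
          cancels = ≋-trans (≋-sym (∙-distribʳ F₀ (⊟ ζ) ζ)) (≋-trans (∙-congʳ (⊟-⊞ ζ)) ∙-zeroˡ)
          ι-congruent : map-ι K.reduced ≋ J ⊞ ζ ∙ F₀
          ι-congruent = ≋-trans (ι-cong (Z.equality K.congruent)) (≋-trans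
            (ι-⊞ (Z.stack Z.𝟙 Z.𝟘) (Z.quotient K.congruent Z.∙ Z.diag f₀))
            (⊞-cong
              (pointwise λ where
                (inj₁ i) j → at (ι-𝟙 {fin k}) i j
                (inj₂ i) j → ι.0#-homo)
              (≋-trans (ι-∙ (Z.quotient K.congruent) (Z.diag f₀))
                (∙-congˡ (ι-cong (Z.≋-sym (E.map-diag {fin k} factors)))))))

        inner : block (diag {fin k} factors) 𝟘 B₂ (scalar y) ∼
                block (block (𝟙 {fin k}) 𝟘 𝟘 (diag {fin k} λ i → - factors i * y)) 𝟘 𝟘 (scalar {fin l} y)
        inner =
          ∼-trans (reduce-corner (proj₁ (residue B₂)) (proj₂ (residue B₂)))
          (∼-trans (corner-∼ ι-reduction)
          (∼-trans (add-rows (⊟ ζ))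
          (∼-trans (reduce-corner (⊟ ζ ∙ proj₁ Qf) cleared)
          -- Grouping the `k` rows that hold the identity with the rows of the factors leaves `l`
          -- rows that carry only `y`.
          (∼-trans (∼-reindex {B = block (block (diag {fin k} factors) 𝟘 𝟙 (scalar y)) 𝟘 𝟘 (scalar y)} assocʳ assocʳ λ where
            (inj₁ (inj₁ i)) (inj₁ (inj₁ j)) → refl
            (inj₁ (inj₁ i)) (inj₁ (inj₂ j)) → refl
            (inj₁ (inj₁ i)) (inj₂ j)        → refl
            (inj₁ (inj₂ i)) (inj₁ (inj₁ j)) → refl
            (inj₁ (inj₂ i)) (inj₁ (inj₂ j)) → refl
            (inj₁ (inj₂ i)) (inj₂ j)        → zeroʳ y
            (inj₂ i)        (inj₁ (inj₁ j)) → refl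
            (inj₂ i)        (inj₁ (inj₂ j)) → zeroʳ y
            (inj₂ i)        (inj₂ j)        → refl)
          (∼-⊕ (merge {fin k} factors y) (∼-reflexive ≋-refl))))))

        φ = proj₁ (split-ordered k l K.size)
        φ-ordered = proj₂ (split-ordered k l K.size)

        -- The `l` remaining copies of `y` come last because `y` divides every `- factors i * y`.
        factor : Fin k ⊎ Fin l → Carrier
        factor = [ (λ i → - factors i * y) , (λ _ → y) ]′

        factor-descending : ∀ {i j} → Ordered i j → ∃ λ d → factor i ≈ factor j * d
        factor-descending (first {i} {j} i≤j) = let d , e = descending i j i≤j in d , (begin
          - factors i * y        ≈⟨ *-congʳ (-‿cong e) ⟩
          - (factors j * d) * y  ≈⟨ *-congʳ (-‿distribˡ-* (factors j) d) ⟩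
          - factors j * d * y    ≈⟨ *-assoc _ d y ⟩
          - factors j * (d * y)  ≈⟨ *-congˡ (*-comm d y) ⟩
          - factors j * (y * d)  ≈⟨ *-assoc _ y d ⟨
          - factors j * y * d    ∎)
          where
          open ≈-R
          open RingProperties ring using (-‿distribˡ-*)
        factor-descending (cross {i}) = - factors i , *-comm _ y
        factor-descending (last _)    = 1# , sym (*-identityʳ y)

      step : DiagonalForm (map-ι (U Z.∙ D) ⊞ scalar y) k′
      step = record
        { units = units ⊕ fin k
        ; total = ≡.trans size (≡.cong (ℕ._+ k′) total)
        ; factors = factor ∘ Reindexing.to φ
        ; descending = λ i j i≤j → factor-descending (φ-ordered i j i≤j)
        ; equivalence =
            ∼-trans split-kernel
            (∼-trans use-form
            (∼-trans (clear-corner (stack 𝟘 B₁) _)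
            (∼-trans (∼-⊕ (∼-reflexive 𝟙≋diag) (∼-trans inner
               (∼-reflexive (≋-trans (block-cong (≋-trans (block-cong 𝟙≋diag ≋-refl ≋-refl ≋-refl) (block-diag {fin k} {fin k} _ _)) ≋-refl ≋-refl ≋-refl)
                  (block-diag {fin k ⊕ fin k} {fin l} _ _)))))
            (∼-trans (∼-reflexive (block-diag {units} {(fin k ⊕ fin k) ⊕ fin l} _ _))
            (∼-trans (diag-reindex ψ)
            (∼-reflexive (pointwise λ where
              (inj₁ (inj₁ i)) (inj₁ j) → *-identityˡ _
              (inj₁ (inj₂ i)) (inj₁ j) → *-identityˡ _
              (inj₁ i)        (inj₂ j) → zeroʳ _
              (inj₂ i)        (inj₁ j) → zeroʳ _
              (inj₂ i)        (inj₂ j) → *-congʳ (factor≈ (Reindexing.to φ i)))))))))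
        }
        where
        ψ : Reindexing ((units ⊕ fin k) ⊕ fin k′) (units ⊕ ((fin k ⊕ fin k) ⊕ fin l))
        ψ = transʳ (⊕ʳ reflʳ φ) (transʳ assocʳ (⊕ʳ reflʳ (symʳ assocʳ)))
        d̂ : El (units ⊕ ((fin k ⊕ fin k) ⊕ fin l)) → Carrier
        d̂ = [ (λ _ → 1#) , [ [ (λ _ → 1#) , (λ i → - factors i * y) ]′ , (λ _ → y) ]′ ]′
        factor≈ : ∀ s → d̂ (Reindexing.to (transʳ (assocʳ {units} {fin k} {fin k ⊕ fin l}) (⊕ʳ reflʳ (symʳ assocʳ))) (inj₂ s)) ≈ factor s
        factor≈ (inj₁ i) = refl
        factor≈ (inj₂ i) = refl

-- Smith normal form from a tower of down maps

oppositeʳ : ∀ k → Reindexing (fin k) (fin k)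
oppositeʳ k = record
  { to = opposite ; from = opposite
  ; from-to = Fin.opposite-involutive ; to-from = Fin.opposite-involutive }

opposite-anti : ∀ {k} {i j : Fin k} → i Fin.≤ j → opposite j Fin.≤ opposite i
opposite-anti {k} {i} {j} i≤j = ≡.subst₂ ℕ._≤_ (≡.sym (Fin.opposite-prop j)) (≡.sym (Fin.opposite-prop i))
  (ℕ.∸-monoʳ-≤ k (s≤s i≤j))

-- The down matrices of an R-differential poset with surjective down maps and strictly
-- convex rank sizes t; the up matrices are their transposes.
record Ladder (t : ℕ → ℕ) (R : ℕ) : Set where
  open ℤM
  field
    down      : ∀ n → Mat (fin (t n)) (fin (t (suc n)))
    section  : ∀ n → Mat (fin (t (suc n))) (fin (t n))
    down∙section : ∀ n → down n ∙ section n ≋ 𝟙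
    base     : down 0 ∙ down 0 ᵀ ≋ scalar (+ R)
    commute  : ∀ n → down (suc n) ∙ down (suc n) ᵀ ≋ down n ᵀ ∙ down n ⊞ scalar (+ R)
    t₀       : t 0 ≡ 1
    t₁       : 2 ℕ.< t 1 ⊎ R ≡ 2
    convex   : ∀ n → t (suc n) ℕ.+ t (suc n) ℕ.< t n ℕ.+ t (suc (suc n))

module _ {c ℓ} (A : CommutativeRing c ℓ) {ι : ℤ → CommutativeRing.Carrier A}
  (ι-hom : IsRingHomomorphism (CommutativeRing.rawRing ℤ.+-*-commutativeRing) (CommutativeRing.rawRing A) ι) where
  open CommutativeRing A hiding (zero)
  open Matrices A
  open Elimination A ι-hom
  open BaseChange {R = ℤ.+-*-commutativeRing} {S = A} ι-hom
    renaming (mapᴹ to map-ι; map-cong to ι-cong; map-∙ to ι-∙; map-⊞ to ι-⊞; map-𝟙 to ι-𝟙; map-diag to ι-diag; map-Iso to ι-Iso)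
  private module ι = IsRingHomomorphism ι-hom

  DiagonalForm-resp : ∀ {n k} {M M′ : Mat (fin n) (fin n)} → M ≋ M′ → DiagonalForm M′ k → DiagonalForm M k
  DiagonalForm-resp e F = record
    { units = units ; total = total ; factors = factors ; descending = descending
    ; equivalence = ∼-trans (∼-reflexive e) equivalence }
    where open DiagonalForm F

  hasSmithNormalForm : ∀ {n k} {M : Mat (fin n) (fin n)} → DiagonalForm M k → HasSmithNormalForm A (entry M)
  hasSmithNormalForm {n} {k} {M} F =
    entry (to (left smith)) , entry (to (right smith)) ,
    (entry (from (left smith)) , at (to-from (left smith)) , at (from-to (left smith))) ,
    (entry (from (right smith)) , at (to-from (right smith)) , at (from-to (right smith))) ,
    record
      { diagonal = λ i j i≢j → trans (at (eq smith) i j) (off-diagonal i j (i≢j ∘ ≡.cong toℕ))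
      ; divides = λ i j i′ j′ i≡j i′≡j′ i′≡1+i → divides i j i′ j′ (Fin.toℕ-injective i≡j) (Fin.toℕ-injective i′≡j′)
          (ℕ.≤-trans (ℕ.n≤1+n _) (ℕ.≤-reflexive (≡.sym i′≡1+i)))
      }
    where
    open DiagonalForm F
    open Divisibility semiring using (_∣_) renaming (_,_ to _∣,_)
    u = ∣ units ∣ˢ
    φ = proj₁ (split-ordered u k total)

    ψ : Reindexing (fin n) (units ⊕ fin k)
    ψ = transʳ φ (⊕ʳ (symʳ (flattenʳ units)) (oppositeʳ k))

    e : Fin u ⊎ Fin k → Carrier
    -- A diagonal form lists its factors from most to least divisible; the Smith form needs the
    -- reverse.
    e = [ (λ _ → 1#) , factors ∘ opposite ]′

    d : Fin n → Carrier
    d = e ∘ Reindexing.to φ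

    smith : M ∼ diag {fin n} d
    smith = ∼-trans equivalence
      (∼-trans (∼-reflexive (≋-trans (block-cong 𝟙≋diag ≋-refl ≋-refl ≋-refl) (block-diag {units} {fin k} _ _)))
      (∼-trans (diag-reindex ψ) (∼-reflexive (diag-cong {fin n} (λ i → e≈ (Reindexing.to φ i))))))
      where
      e≈ : ∀ s → [ (λ _ → 1#) , factors ]′ (Reindexing.to (⊕ʳ (symʳ (flattenʳ units)) (oppositeʳ k)) s) ≈ e s
      e≈ (inj₁ _) = refl
      e≈ (inj₂ _) = refl

    off-diagonal : ∀ i j → i ≢ j → entry (diag {fin n} d) i j ≈ 0#
    off-diagonal i j i≢j with i Fin.≟ j
    ... | yes i≡j = contradiction i≡j i≢j
    ... | no _ = zeroʳ (d i)

    on-diagonal : ∀ i → entry (diag {fin n} d) i i ≈ d i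
    on-diagonal i with i Fin.≟ i
    ... | yes _ = *-identityʳ (d i)
    ... | no i≢i = contradiction ≡.refl i≢i

    ascending : ∀ {i j} → Ordered i j → ∃ λ q → q * e i ≈ e j
    ascending (first _)   = 1# , *-identityˡ 1#
    ascending (cross {j = j}) = factors (opposite j) , *-identityʳ _
    ascending (last {i} {j} i≤j) = let q , p = descending (opposite j) (opposite i) (opposite-anti i≤j) in
      q , trans (*-comm _ _) (sym p)

    divides : ∀ i j i′ j′ → i ≡ j → i′ ≡ j′ → i Fin.≤ i′ →
              entry (to (left smith) ∙ M ∙ to (right smith)) i j ∣ entry (to (left smith) ∙ M ∙ to (right smith)) i′ j′
    divides i .i i′ .i′ ≡.refl ≡.refl i≤i′ =
      let q , p = ascending (proj₂ (split-ordered u k total) i i′ i≤i′) in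
      q ∣, trans (*-congˡ (on i)) (trans p (sym (on i′)))
      where
      on : ∀ i → entry (to (left smith) ∙ M ∙ to (right smith)) i i ≈ d i
      on i = trans (at (eq smith) i i) (on-diagonal i)

  module _ (x : Carrier) (evaluations : ∀ c → Evaluation (x + ι (+ c))) {t : ℕ → ℕ} {R : ℕ} (T : Ladder t R) where
    open Ladder T
    private
      module Z′ = Matrices ℤ.+-*-commutativeRing

      up : ∀ n → Z′.Mat (fin (t (suc n))) (fin (t n))
      up n = down n Z′.ᵀ

      V : ∀ n → Z′.Mat (fin (t n)) (fin (t (suc n)))
      V n = section n Z′.ᵀ

      V∙up : ∀ n → V n Z′.∙ up n Z′.≋ Z′.𝟙
      V∙up n = Z′.≋-trans (Z′.≋-sym (Z′.ᵀ-∙ (down n) (section n)))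
        (Z′.≋-trans (Z′.pointwise λ i j → Z′.at (down∙section n) j i) Z′.ᵀ-𝟙)

      -- Modulo 0 a congruence is an equality, so this extends the columns of `up n` to a basis of
      -- the next rank. The value 0 falls under `ZeroOrTwo`, which also covers ranks of equal size.
      module K n = Unimodular.Completion (Unimodular.complete (t n) (t (suc n)) (up n) (λ _ → 0ℤ) (V n) Z′.𝟘
        (λ _ _ _ → 0ℤ , ≡.refl)
        (Z′.≋-trans (Z′.⊞-cong (V∙up n) Z′.∙-zeroˡ) (Z′.⊞-identityʳ Z′.𝟙))
        (inj₂ λ _ → inj₁ ≡.refl))

      -- The differences of the rank sizes, by `K.size`; the value at 0 is `t 0`, nothing lying
      -- below rank 0.
      k : ℕ → ℕ
      k zero    = 1
      k (suc n) = K.extra n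

      P : ∀ n → Z′.Iso (fin (t (suc n))) (fin (t n) ⊕ fin (k (suc n)))
      P n = Z′.Iso-ᵀ (Z′.iso (K.reduction n))

      down∙P : ∀ n → down n Z′.∙ Z′.to (P n) Z′.≋ Z′.beside Z′.𝟙 Z′.𝟘
      down∙P n = Z′.≋-trans (Z′.∙-congʳ {A′ = up n Z′.ᵀ} (Z′.pointwise λ _ _ → ≡.refl))
        (Z′.≋-trans (Z′.≋-sym (Z′.ᵀ-∙ E (up n))) (Z′.pointwise λ where
        i (inj₁ j) → ≡.trans (reduced≡ (inj₁ j) i) (Z′.at (Z′.ᵀ-𝟙 {fin (t n)}) i j)
        i (inj₂ j) → reduced≡ (inj₂ j) i))
        where
        E = Z′.to (Z′.iso (K.reduction n))
        q = Z′.quotient (K.congruent n)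
        reduced≡ : ∀ i j → Z′.entry (E Z′.∙ up n) i j ≡ Z′.entry (Z′.stack Z′.𝟙 Z′.𝟘) i j
        reduced≡ i j = ≡.trans (Z′.at (Z′.maps (K.reduction n)) i j) (≡.trans (Z′.at (Z′.equality (K.congruent n)) i j)
          (≡.trans (≡.cong (λ s → Z′.entry (Z′.stack Z′.𝟙 Z′.𝟘) i j ℤ.+ s)
            (≡.trans (Z′.∙-diag q (λ _ → 0ℤ) i j) (ℤ.*-zeroʳ (Z′.entry q i j)))) (ℤ.+-identityʳ _)))

      k₁ : 1 ℕ.< k 1 ⊎ R ≡ 2
      k₁ = ⊎.map₁ (λ 2<t₁ → ℕ.+-cancelˡ-< 1 1 (k 1) (ℕ.≤-trans 2<t₁ (ℕ.≤-reflexive (≡.trans (K.size 0) (≡.cong (ℕ._+ k 1) t₀))))) t₁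

      k-increasing : ∀ n → k (suc n) ℕ.< k (suc (suc n))
      k-increasing n = ℕ.+-cancelˡ-< (t n ℕ.+ t (suc n)) (k (suc n)) (k (suc (suc n))) (begin-strict
        t n ℕ.+ t (suc n) ℕ.+ k (suc n)         ≡⟨ ≡.cong (ℕ._+ k (suc n)) (ℕ.+-comm (t n) (t (suc n))) ⟩
        t (suc n) ℕ.+ t n ℕ.+ k (suc n)         ≡⟨ ℕ.+-assoc (t (suc n)) (t n) (k (suc n)) ⟩
        t (suc n) ℕ.+ (t n ℕ.+ k (suc n))       ≡⟨ ≡.cong (t (suc n) ℕ.+_) (K.size n) ⟨
        t (suc n) ℕ.+ t (suc n)                 <⟨ convex n ⟩
        t n ℕ.+ t (suc (suc n))                 ≡⟨ ≡.cong (t n ℕ.+_) (K.size (suc n)) ⟩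
        t n ℕ.+ (t (suc n) ℕ.+ k (suc (suc n))) ≡⟨ ℕ.+-assoc (t n) (t (suc n)) (k (suc (suc n))) ⟨
        t n ℕ.+ t (suc n) ℕ.+ k (suc (suc n))   ∎)
        where open ℕ.≤-Reasoning

      shift : ∀ c → ι (+ R) + (x + ι (+ c)) ≈ x + ι (+ (c ℕ.+ R))
      shift c = begin
        ι (+ R) + (x + ι (+ c))  ≈⟨ +-comm _ _ ⟩
        x + ι (+ c) + ι (+ R)    ≈⟨ +-assoc _ _ _ ⟩
        x + (ι (+ c) + ι (+ R))  ≈⟨ +-congˡ (ι.+-homo (+ c) (+ R)) ⟨
        x + ι (+ (c ℕ.+ R))      ∎
        where open ≈-R

    Form : ℕ → ℕ → Set (c ⊔ ℓ)
    Form n c = DiagonalForm (map-ι (down n Z′.∙ down n Z′.ᵀ) ⊞ scalar (x + ι (+ c))) (k n)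

    base-form : ∀ c → Form 0 c
    base-form c = record
      { units = fin 0
      ; total = t₀
      ; factors = λ _ → ι (+ R) + (x + ι (+ c))
      ; descending = λ _ _ _ → 1# , sym (*-identityʳ _)
      ; equivalence = ∼-trans
          (∼-reflexive (≋-trans (⊞-cong (≋-trans (ι-cong base) (ι-diag _)) ≋-refl) (diag-⊞ _ _)))
          (∼-trans (diag-reindex (≡.subst (λ n → Reindexing (fin 0 ⊕ fin 1) (fin n)) (≡.sym t₀) (joinʳ 0 1)))
          (∼-reflexive (pointwise λ { (inj₂ zero) (inj₂ zero) → refl })))
      }

    form : ∀ n c → Form n c
    form-suc : ∀ n c (F : Form n (c ℕ.+ R)) →
               k n ℕ.< k (suc n) ⊎ (∀ i → Unimodular.ZeroOrTwo (Evaluation.ev (evaluations (c ℕ.+ R)) (DiagonalForm.factors F i))) →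
               Form (suc n) c

    form-suc n c F cond = DiagonalForm-resp (begin
      map-ι (down (suc n) Z′.∙ up (suc n)) ⊞ scalar (x + ι (+ c))
        ≈⟨ ⊞-cong (≋-trans (ι-cong (commute n)) (≋-trans (ι-⊞ (up n Z′.∙ down n) (Z′.scalar (+ R))) (⊞-cong ≋-refl (ι-diag _)))) ≋-refl ⟩
      map-ι (up n Z′.∙ down n) ⊞ scalar (ι (+ R)) ⊞ scalar (x + ι (+ c))
        ≈⟨ (pointwise λ i j → +-assoc _ _ _) ⟩
      map-ι (up n Z′.∙ down n) ⊞ (scalar (ι (+ R)) ⊞ scalar (x + ι (+ c)))
        ≈⟨ ⊞-cong ≋-refl (≋-trans (diag-⊞ _ _) (diag-cong λ _ → shift c)) ⟩
      map-ι (up n Z′.∙ down n) ⊞ scalar (x + ι (+ (c ℕ.+ R))) ∎)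
      (Step.step (K.size n) (up n) (down n) (V n) (P n) (down∙P n) (V∙up n) (evaluations (c ℕ.+ R)) F cond)
      where open ≋-R

    form zero          c = base-form c
    -- The only factor at rank 0 is `R + y`, with value `R` at `y = 0`. So in the exceptional case
    -- `R = 2` the modulus is 2.
    form (suc zero)    c = form-suc 0 c (base-form (c ℕ.+ R)) (⊎.map₂ (λ R≡2 _ → inj₂ (≡.trans ev-factor (≡.cong +_ R≡2))) k₁)
      where
      open Evaluation (evaluations (c ℕ.+ R))
      module ev = IsRingHomomorphism ev-hom
      ev-factor : ev (ι (+ R) + (x + ι (+ (c ℕ.+ R)))) ≡ + R
      ev-factor = ≡.trans (ev.+-homo _ _) (≡.trans (≡.cong₂ ℤ._+_ (ev-ι (+ R)) ev-y) (ℤ.+-identityʳ (+ R)))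
    form (suc (suc n)) c = form-suc (suc n) c (form (suc n) (c ℕ.+ R)) (inj₁ (k-increasing n))

-- Positivity

module _ where
  open ℤM
  open Unimodular using (euclid; ⟨_⟩)

  firstRow : ∀ {m b} → Mat (fin (suc m)) b → Mat (fin 1) b
  entry (firstRow A) _ j = entry A zero j

  otherRows : ∀ {m b} → Mat (fin (suc m)) b → Mat (fin m) b
  entry (otherRows A) i j = entry A (suc i) j

  -- Euclid on the transposed first row is a change of coordinates after which that row is `(g 0)`.
  -- It then annihilates every vector with first coordinate 0, and the other rows are solved in the
  -- remaining coordinates by induction.
  kernel : ∀ {m k} → m ℕ.< k → (A : Mat (fin m) (fin k)) → ∃ λ (v : Mat (fin k) (fin 1)) → ¬ (v ≋ 𝟘) × A ∙ v ≋ 𝟘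
  kernel {zero} {suc k} _ A = (mat₁ , (λ e → contradiction (at e zero zero) λ ()) , pointwise λ ())
    where
    mat₁ : Mat (fin (suc k)) (fin 1)
    entry mat₁ _ _ = 1ℤ
  kernel {suc m} {suc k} (s≤s m<k) A = v , v≢0 , pointwise Av≡0
    where
    g = proj₁ (euclid k (firstRow A ᵀ))
    p = proj₂ (euclid k (firstRow A ᵀ))
    F = to (iso p) ᵀ
    A′ = rightPart (otherRows A ∙ F)
    w = proj₁ (kernel m<k A′)
    w≢0 = proj₁ (proj₂ (kernel m<k A′))
    A′w≡0 = proj₂ (proj₂ (kernel m<k A′))
    ŵ = stack (𝟘 {fin 1}) w
    v = F ∙ ŵ

    v≢0 : ¬ (v ≋ 𝟘)
    v≢0 e = w≢0 (pointwise λ i j → at ŵ≡0 (inj₂ i) j)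
      where
      ŵ≡0 : ŵ ≋ 𝟘
      ŵ≡0 = ≋-trans (≋-sym (∙-identityˡ ŵ)) (≋-trans (∙-congʳ (≋-sym (from-to (Iso-ᵀ (iso p)))))
        (≋-trans (∙-assoc (from (iso p) ᵀ) F ŵ) (≋-trans (∙-congˡ e) ∙-zeroʳ)))

    row-F : firstRow A ∙ F ≋ beside ⟨ g ⟩ 𝟘
    row-F = ≋-trans (∙-congʳ {A′ = firstRow A ᵀ ᵀ} (pointwise λ _ _ → ≡.refl))
      (≋-trans (≋-sym (ᵀ-∙ (to (iso p)) (firstRow A ᵀ))) (pointwise λ where
        i (inj₁ j) → at (maps p) (inj₁ j) i
        i (inj₂ j) → at (maps p) (inj₂ j) i))

    Av≡0 : ∀ i j → entry (A ∙ v) i j ≡ 0ℤ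
    Av≡0 zero j = ≡.trans (at (≋-sym (∙-assoc (firstRow A) F ŵ)) zero j)
      (≡.trans (at (∙-congʳ {B = ŵ} row-F) zero j)
        (≡.cong₂ ℤ._+_ (at (∙-zeroʳ {d = fin 1} {A = ⟨ g ⟩}) zero j) (at (∙-zeroˡ {fin 1} {A = w}) zero j)))
    Av≡0 (suc i) j = ≡.trans (at (≋-sym (∙-assoc (otherRows A) F ŵ)) i j)
      (≡.cong₂ ℤ._+_ (at (∙-zeroʳ {d = fin 1} {A = leftPart (otherRows A ∙ F)}) i j) (at A′w≡0 i j))

  square-nonneg : ∀ i → 0ℤ ℤ.≤ i ℤ.* i
  square-nonneg i = ≡.subst (0ℤ ℤ.≤_) (lemma i) (+≤+ z≤n)
    where
    lemma : ∀ i → + (∣ i ∣ ℕ.* ∣ i ∣) ≡ i ℤ.* i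
    lemma (+ n)      = ℤ.pos-* n n
    lemma (-[1+ n ]) = ≡.refl

  norm-nonneg : ∀ {n} (v : Mat (fin n) (fin 1)) → 0ℤ ℤ.≤ entry (v ᵀ ∙ v) zero zero
  norm-nonneg {zero}  v = ℤ.≤-refl
  norm-nonneg {suc n} v = ℤ.+-mono-≤ (square-nonneg (entry v zero zero)) (norm-nonneg (otherRows v))

  nonneg-sum-zero : ∀ {i j} → 0ℤ ℤ.≤ i → 0ℤ ℤ.≤ j → i ℤ.+ j ≡ 0ℤ → i ≡ 0ℤ × j ≡ 0ℤ
  nonneg-sum-zero {+ m} {+ n} (+≤+ _) (+≤+ _) e =
    ≡.cong +_ (ℕ.m+n≡0⇒m≡0 m (ℤ.+-injective e)) , ≡.cong +_ (ℕ.m+n≡0⇒n≡0 m (ℤ.+-injective e))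

  norm-zero : ∀ {n} (v : Mat (fin n) (fin 1)) → entry (v ᵀ ∙ v) zero zero ≡ 0ℤ → v ≋ 𝟘
  norm-zero {zero}  v e = pointwise λ ()
  norm-zero {suc n} v e =
    let e₀ , e′ = nonneg-sum-zero (square-nonneg (entry v zero zero)) (norm-nonneg (otherRows v)) e
    in pointwise λ where
      zero    zero → [ id , id ]′ (ℤ.i*j≡0⇒i≡0∨j≡0 (entry v zero zero) e₀)
      (suc i) j    → at (norm-zero (otherRows v) e′) i j

  -- If D Dᵀ = Eᵀ E + r with r > 0, then D Dᵀ is positive definite, so Dᵀ is injective.
  rows≤columns : ∀ {m n l r} → 0 ℕ.< r → (D : Mat (fin m) (fin n)) (E : Mat (fin l) (fin m)) →
                 D ∙ D ᵀ ≋ E ᵀ ∙ E ⊞ scalar (+ r) → m ℕ.≤ n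
  rows≤columns {m} {n} {l} {r} r>0 D E e = ℕ.≮⇒≥ λ n<m →
    let v , v≢0 , Dᵀv≡0 = kernel n<m (D ᵀ)
    in v≢0 (norm-zero v (scaled-zero (proj₂ (nonneg-sum-zero
         (norm-nonneg (E ∙ v)) (scaled-nonneg (norm-nonneg v)) (energy v Dᵀv≡0)))))
    where
    scaled-nonneg : ∀ {i} → 0ℤ ℤ.≤ i → 0ℤ ℤ.≤ + r ℤ.* i
    scaled-nonneg {i} 0≤i = ≡.subst (ℤ._≤ + r ℤ.* i) (ℤ.*-zeroʳ (+ r)) (ℤ.*-monoˡ-≤-nonNeg (+ r) 0≤i)
    scaled-zero : ∀ {i} → + r ℤ.* i ≡ 0ℤ → i ≡ 0ℤ
    scaled-zero eq = [ (λ r≡0 → contradiction (ℤ.+-injective r≡0) (ℕ.m<n⇒n≢0 r>0)) , id ]′ (ℤ.i*j≡0⇒i≡0∨j≡0 (+ r) eq)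
    -- The left side is the squared norm of `E v` plus `r` times that of `v`, which by `e` is the
    -- squared norm of `Dᵀ v`.
    energy : ∀ v → D ᵀ ∙ v ≋ 𝟘 → entry ((E ∙ v) ᵀ ∙ (E ∙ v)) zero zero ℤ.+ + r ℤ.* entry (v ᵀ ∙ v) zero zero ≡ 0ℤ
    energy v Dᵀv≡0 = ≡.trans (≡.cong (λ u → entry ((E ∙ v) ᵀ ∙ (E ∙ v)) zero zero ℤ.+ u)
      (≡.sym (diag-∙ (λ _ → + r) (v ᵀ ∙ v) zero zero))) (at (begin
      (E ∙ v) ᵀ ∙ (E ∙ v) ⊞ scalar (+ r) ∙ (v ᵀ ∙ v)
        ≈⟨ ⊞-cong (≋-trans (∙-congʳ (ᵀ-∙ E v)) (≋-trans (∙-assoc (v ᵀ) (E ᵀ) (E ∙ v)) (∙-congˡ (≋-sym (∙-assoc (E ᵀ) E v)))))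
             (≋-trans (≋-sym (∙-assoc (scalar (+ r)) (v ᵀ) v)) (≋-trans (∙-congʳ (scalar-comm (+ r) (v ᵀ))) (∙-assoc (v ᵀ) (scalar (+ r)) v))) ⟩
      v ᵀ ∙ (E ᵀ ∙ E ∙ v) ⊞ v ᵀ ∙ (scalar (+ r) ∙ v)
        ≈⟨ ∙-distribˡ (v ᵀ) (E ᵀ ∙ E ∙ v) (scalar (+ r) ∙ v) ⟨
      v ᵀ ∙ (E ᵀ ∙ E ∙ v ⊞ scalar (+ r) ∙ v)
        ≈⟨ ∙-congˡ (∙-distribʳ v (E ᵀ ∙ E) (scalar (+ r))) ⟨
      v ᵀ ∙ ((E ᵀ ∙ E ⊞ scalar (+ r)) ∙ v)
        ≈⟨ ∙-congˡ (∙-congʳ e) ⟨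
      v ᵀ ∙ (D ∙ D ᵀ ∙ v)
        ≈⟨ ∙-congˡ (≋-trans (∙-assoc D (D ᵀ) v) (≋-trans (∙-congˡ Dᵀv≡0) ∙-zeroʳ)) ⟩
      v ᵀ ∙ 𝟘
        ≈⟨ ∙-zeroʳ ⟩
      𝟘 ∎) zero zero)
      where open ≋-R

-- Evaluation of integer polynomials

module _ {c ℓ} (R : CommutativeRing c ℓ) where
  open CommutativeRing R
  open SetoidReasoning setoid

  -- One Horner step of synthetic division by `y + d`: in `a + y * p` with `p = e + (y + d) * q`,
  -- the factor `y` in front of the remainder `e` is replaced by `(y + d) - d`.
  divide-identity : ∀ a e q y d → a + y * (e + (y + d) * q) ≈ (a + (- d) * e) + (y + d) * (e + y * q)
  divide-identity a e q y d = begin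
    a + y * (e + (y + d) * q)                              ≈⟨ +-congˡ (distribˡ y e _) ⟩
    a + (y * e + y * ((y + d) * q))                        ≈⟨ +-congˡ (+-cong (*-congʳ y≈) swap) ⟩
    a + ((- d + (y + d)) * e + (y + d) * (y * q))          ≈⟨ +-congˡ (+-congʳ (distribʳ e (- d) (y + d))) ⟩
    a + ((- d) * e + (y + d) * e + (y + d) * (y * q))      ≈⟨ +-congˡ (+-assoc _ _ _) ⟩
    a + ((- d) * e + ((y + d) * e + (y + d) * (y * q)))    ≈⟨ +-assoc _ _ _ ⟨
    (a + (- d) * e) + ((y + d) * e + (y + d) * (y * q))    ≈⟨ +-congˡ (distribˡ (y + d) e _) ⟨
    (a + (- d) * e) + (y + d) * (e + y * q)                ∎
    where
    y≈ : y ≈ - d + (y + d)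
    y≈ = sym (trans (+-comm _ _) (trans (+-assoc y d (- d)) (trans (+-congˡ (-‿inverseʳ d)) (+-identityʳ y))))
    swap : y * ((y + d) * q) ≈ (y + d) * (y * q)
    swap = trans (sym (*-assoc _ _ _)) (trans (*-congʳ (*-comm _ _)) (*-assoc _ _ _))

private
  module ℤ[X] = CommutativeRing ℤ[x]
open ℤPolynomial using (Poly; coeff; _+ₚ_; _*ₚ_; -ₚ_; _∙ₚ_; _≈ₚ_)

constant-hom : IsRingHomomorphism (CommutativeRing.rawRing ℤ.+-*-commutativeRing) ℤ[X].rawRing constant
constant-hom = record
  { isSemiringHomomorphism = record
    { isNearSemiringHomomorphism = record
      { +-isMonoidHomomorphism = record
        { isMagmaHomomorphism = record
          { isRelHomomorphism = record { cong = λ { ≡.refl → ℤ[X].refl } }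
          ; homo = λ _ _ → ℤ[X].refl
          }
        ; ε-homo = ℤPolynomial.0∷[]≈[]
        }
      ; *-homo = λ a b → ℤPolynomial.∷-cong (≡.sym (ℤ.+-identityʳ (a ℤ.* b))) ℤ[X].refl
      }
    ; 1#-homo = ℤ[X].refl
    }
  ; -‿homo = λ _ → ℤ[X].refl
  }

eval : ℤ → Poly → ℤ
eval z []      = 0ℤ
eval z (a ∷ p) = a ℤ.+ z ℤ.* eval z p

module _ (z : ℤ) where
  -- Equal polynomials may be lists of different lengths; this takes care of the trailing zeros of
  -- the longer one.
  eval-zero : ∀ p → (∀ n → coeff p n ≡ 0ℤ) → eval z p ≡ 0ℤ
  eval-zero []      e = ≡.refl
  eval-zero (a ∷ p) e = ≡.trans (≡.cong₂ (λ a b → a ℤ.+ z ℤ.* b) (e 0) (eval-zero p (e ∘ suc))) (≡.trans (ℤ.+-identityˡ _) (ℤ.*-zeroʳ z))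

  eval-cong : ∀ p q → (∀ n → coeff p n ≡ coeff q n) → eval z p ≡ eval z q
  eval-cong []      q       e = ≡.sym (eval-zero q (≡.sym ∘ e))
  eval-cong (a ∷ p) []      e = eval-zero (a ∷ p) e
  eval-cong (a ∷ p) (b ∷ q) e = ≡.cong₂ (λ a b → a ℤ.+ z ℤ.* b) (e 0) (eval-cong p q (e ∘ suc))

  eval-+ : ∀ p q → eval z (p +ₚ q) ≡ eval z p ℤ.+ eval z q
  eval-+ []      q       = ≡.sym (ℤ.+-identityˡ (eval z q))
  eval-+ (a ∷ p) []      = ≡.sym (ℤ.+-identityʳ _)
  eval-+ (a ∷ p) (b ∷ q) = ≡.trans (≡.cong (λ u → a ℤ.+ b ℤ.+ z ℤ.* u) (eval-+ p q)) (lemma a b z (eval z p) (eval z q))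
    where
    lemma : ∀ a b z u v → a ℤ.+ b ℤ.+ z ℤ.* (u ℤ.+ v) ≡ a ℤ.+ z ℤ.* u ℤ.+ (b ℤ.+ z ℤ.* v)
    lemma = solve-∀

  eval-∙ : ∀ a p → eval z (a ∙ₚ p) ≡ a ℤ.* eval z p
  eval-∙ a []      = ≡.sym (ℤ.*-zeroʳ a)
  eval-∙ a (b ∷ p) = ≡.trans (≡.cong (λ u → a ℤ.* b ℤ.+ z ℤ.* u) (eval-∙ a p)) (lemma a b z (eval z p))
    where
    lemma : ∀ a b z u → a ℤ.* b ℤ.+ z ℤ.* (a ℤ.* u) ≡ a ℤ.* (b ℤ.+ z ℤ.* u)
    lemma = solve-∀

  eval-* : ∀ p q → eval z (p *ₚ q) ≡ eval z p ℤ.* eval z q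
  eval-* []      q = ≡.refl
  eval-* (a ∷ p) q = ≡.trans (eval-+ (a ∙ₚ q) (0ℤ ∷ p *ₚ q)) (≡.trans
    (≡.cong₂ (λ u v → u ℤ.+ (0ℤ ℤ.+ z ℤ.* v)) (eval-∙ a q) (eval-* p q))
    (lemma a z (eval z p) (eval z q)))
    where
    lemma : ∀ a z u v → a ℤ.* v ℤ.+ (0ℤ ℤ.+ z ℤ.* (u ℤ.* v)) ≡ (a ℤ.+ z ℤ.* u) ℤ.* v
    lemma = solve-∀

  eval-neg : ∀ p → eval z (-ₚ p) ≡ ℤ.- eval z p
  eval-neg []      = ≡.refl
  eval-neg (a ∷ p) = ≡.trans (≡.cong (λ u → ℤ.- a ℤ.+ z ℤ.* u) (eval-neg p)) (lemma a z (eval z p))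
    where
    lemma : ∀ a z u → ℤ.- a ℤ.+ z ℤ.* ℤ.- u ≡ ℤ.- (a ℤ.+ z ℤ.* u)
    lemma = solve-∀

  eval-constant : ∀ a → eval z (constant a) ≡ a
  eval-constant a = ≡.trans (≡.cong (λ u → a ℤ.+ u) (ℤ.*-zeroʳ z)) (ℤ.+-identityʳ a)

  eval-hom : IsRingHomomorphism ℤ[X].rawRing (CommutativeRing.rawRing ℤ.+-*-commutativeRing) (eval z)
  eval-hom = record
    { isSemiringHomomorphism = record
      { isNearSemiringHomomorphism = record
        { +-isMonoidHomomorphism = record
          { isMagmaHomomorphism = record
            { isRelHomomorphism = record { cong = λ {p} {q} e → eval-cong p q (ℤPolynomial.at e) }
            ; homo = eval-+
            }
          ; ε-homo = ≡.refl
          }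
        ; *-homo = eval-*
        }
      ; 1#-homo = eval-constant 1ℤ
      }
    ; -‿homo = eval-neg
    }

∷≈constant+X* : ∀ a p → (a ∷ p) ≈ₚ constant a +ₚ X *ₚ p
∷≈constant+X* a p = ℤ[X].sym (begin
  constant a +ₚ (0ℤ ∙ₚ p +ₚ (0ℤ ∷ constant 1ℤ *ₚ p))
    ≈⟨ ℤ[X].+-congˡ {constant a} (ℤPolynomial.+ₚ-cong (ℤPolynomial.0∙ₚ p) (ℤPolynomial.∷-cong ≡.refl (ℤPolynomial.*ₚ-identityˡ p))) ⟩
  constant a +ₚ (0ℤ ∷ p)
    ≈⟨ ℤPolynomial.∷-cong (ℤ.+-identityʳ a) ℤ[X].refl ⟩
  a ∷ p ∎)
  where open SetoidReasoning ℤ[X].setoid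

divide : ∀ c p → ∃ λ q → p ≈ₚ constant (eval (ℤ.- c) p) +ₚ (X +ₚ constant c) *ₚ q
divide c []      = [] , ℤ[X].sym (ℤ[X].trans (ℤ[X].+-congˡ {constant 0ℤ} (ℤPolynomial.*ₚ-zeroʳ (X +ₚ constant c))) ℤPolynomial.0∷[]≈[])
divide c (a ∷ p) =
  let q , p≈ = divide c p
      e = eval (ℤ.- c) p
  in constant e +ₚ X *ₚ q , (begin
    a ∷ p
      ≈⟨ ∷≈constant+X* a p ⟩
    constant a +ₚ X *ₚ p
      ≈⟨ ℤ[X].+-congˡ {constant a} (ℤ[X].*-congˡ {X} p≈) ⟩
    constant a +ₚ X *ₚ (constant e +ₚ (X +ₚ constant c) *ₚ q)
      ≈⟨ divide-identity ℤ[x] (constant a) (constant e) q X (constant c) ⟩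
    (constant a +ₚ constant (ℤ.- c) *ₚ constant e) +ₚ (X +ₚ constant c) *ₚ (constant e +ₚ X *ₚ q)
      ≈⟨ ℤ[X].+-congʳ {(X +ₚ constant c) *ₚ (constant e +ₚ X *ₚ q)} (ℤ[X].+-congˡ {constant a} (ℤ[X].sym (IsRingHomomorphism.*-homo constant-hom (ℤ.- c) e))) ⟩
    constant (a ℤ.+ ℤ.- c ℤ.* e) +ₚ (X +ₚ constant c) *ₚ (constant e +ₚ X *ₚ q) ∎)
  where open SetoidReasoning ℤ[X].setoid

-- As `x + c` is monic, dividing by it needs no inverses in ℤ, and the remainder is the value at
-- `- c`.
evaluation : ∀ c → Elimination.Evaluation ℤ[x] constant-hom (X +ₚ constant (+ c))
evaluation c = record
  { ev = eval (ℤ.- + c)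
  ; ev-hom = eval-hom (ℤ.- + c)
  ; ev-ι = eval-constant (ℤ.- + c)
  ; ev-y = lemma (+ c)
  ; division = divide (+ c)
  }
  where
  lemma : ∀ c → 0ℤ ℤ.+ c ℤ.+ ℤ.- c ℤ.* (1ℤ ℤ.+ ℤ.- c ℤ.* 0ℤ) ≡ 0ℤ
  lemma = solve-∀

-- Sums over finite sets

module _ {a b} {A : Set a} {B : Set b} where
  indicator-⇔ : A ⇔ B → (a? : Dec A) (b? : Dec B) → indicator a? ≡ indicator b?
  indicator-⇔ e a? b? = ≡.cong (if_then 1ℤ else 0ℤ) (does-⇔ e a? b?)

  indicator-× : (a? : Dec A) (b? : Dec B) → indicator (a? ×-dec b?) ≡ indicator a? ℤ.* indicator b?
  indicator-× (yes _) (yes _) = ≡.refl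
  indicator-× (yes _) (no _)  = ≡.refl
  indicator-× (no _)  b?      = ≡.refl

module _ {a} {A : Set a} where
  indicator-yes : (a? : Dec A) → A → indicator a? ≡ 1ℤ
  indicator-yes (yes _) x = ≡.refl
  indicator-yes (no ¬x) x = contradiction x ¬x

  indicator-no : (a? : Dec A) → ¬ A → indicator a? ≡ 0ℤ
  indicator-no (yes x) ¬x = contradiction x ¬x
  indicator-no (no _)  ¬x = ≡.refl

  indicator-*-cong : (a? : Dec A) {u v : ℤ} → (A → u ≡ v) → indicator a? ℤ.* u ≡ indicator a? ℤ.* v
  indicator-*-cong (yes x) e = ≡.cong (λ u → 1ℤ ℤ.* u) (e x)
  indicator-*-cong (no _)  e = ≡.refl

  ∑ᴸ : (A → ℤ) → List A → ℤ
  ∑ᴸ f []       = 0ℤ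
  ∑ᴸ f (x ∷ xs) = f x ℤ.+ ∑ᴸ f xs

  ∑ᴸ-cong : ∀ {f g : A → ℤ} xs → (∀ x → f x ≡ g x) → ∑ᴸ f xs ≡ ∑ᴸ g xs
  ∑ᴸ-cong []       e = ≡.refl
  ∑ᴸ-cong (x ∷ xs) e = ≡.cong₂ ℤ._+_ (e x) (∑ᴸ-cong xs e)

  ∑ᴸ-zero : ∀ (xs : List A) → ∑ᴸ (λ _ → 0ℤ) xs ≡ 0ℤ
  ∑ᴸ-zero []       = ≡.refl
  ∑ᴸ-zero (x ∷ xs) = ≡.trans (ℤ.+-identityˡ _) (∑ᴸ-zero xs)

  ∑ᴸ-+ : ∀ (f g : A → ℤ) xs → ∑ᴸ (λ x → f x ℤ.+ g x) xs ≡ ∑ᴸ f xs ℤ.+ ∑ᴸ g xs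
  ∑ᴸ-+ f g []       = ≡.refl
  ∑ᴸ-+ f g (x ∷ xs) = ≡.trans (≡.cong (λ u → f x ℤ.+ g x ℤ.+ u) (∑ᴸ-+ f g xs)) (lemma (f x) (g x) (∑ᴸ f xs) (∑ᴸ g xs))
    where
    lemma : ∀ a b c d → a ℤ.+ b ℤ.+ (c ℤ.+ d) ≡ a ℤ.+ c ℤ.+ (b ℤ.+ d)
    lemma = solve-∀

  *-∑ᴸ : ∀ u (f : A → ℤ) xs → u ℤ.* ∑ᴸ f xs ≡ ∑ᴸ (λ x → u ℤ.* f x) xs
  *-∑ᴸ u f []       = ℤ.*-zeroʳ u
  *-∑ᴸ u f (x ∷ xs) = ≡.trans (ℤ.*-distribˡ-+ u (f x) (∑ᴸ f xs)) (≡.cong (λ v → u ℤ.* f x ℤ.+ v) (*-∑ᴸ u f xs))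

  ∑ᴸ-* : ∀ u (f : A → ℤ) xs → ∑ᴸ f xs ℤ.* u ≡ ∑ᴸ (λ x → f x ℤ.* u) xs
  ∑ᴸ-* u f xs = ≡.trans (ℤ.*-comm (∑ᴸ f xs) u) (≡.trans (*-∑ᴸ u f xs) (∑ᴸ-cong xs λ x → ℤ.*-comm u (f x)))

  ∑ᴸ-++ : ∀ (f : A → ℤ) xs ys → ∑ᴸ f (xs ++ ys) ≡ ∑ᴸ f xs ℤ.+ ∑ᴸ f ys
  ∑ᴸ-++ f []       ys = ≡.sym (ℤ.+-identityˡ _)
  ∑ᴸ-++ f (x ∷ xs) ys = ≡.trans (≡.cong (λ u → f x ℤ.+ u) (∑ᴸ-++ f xs ys)) (≡.sym (ℤ.+-assoc (f x) (∑ᴸ f xs) (∑ᴸ f ys)))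

  ∑ᴸ-1 : ∀ (f : A → ℤ) xs → All (λ x → f x ≡ 1ℤ) xs → ∑ᴸ f xs ≡ + length xs
  ∑ᴸ-1 f []       []       = ≡.refl
  ∑ᴸ-1 f (x ∷ xs) (e ∷ es) = ≡.cong₂ ℤ._+_ e (∑ᴸ-1 f xs es)

  ∑ᴸ-lookup : ∀ (f : A → ℤ) xs → Sum.sum (CommutativeRing.semiring ℤ.+-*-commutativeRing) (λ i → f (lookup xs i)) ≡ ∑ᴸ f xs
  ∑ᴸ-lookup f []       = ≡.refl
  ∑ᴸ-lookup f (x ∷ xs) = ≡.cong (λ u → f x ℤ.+ u) (∑ᴸ-lookup f xs)

module _ {a b} {A : Set a} {B : Set b} where
  ∑ᴸ-map : ∀ (f : B → ℤ) (g : A → B) xs → ∑ᴸ f (map g xs) ≡ ∑ᴸ (f ∘ g) xs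
  ∑ᴸ-map f g []       = ≡.refl
  ∑ᴸ-map f g (x ∷ xs) = ≡.cong (λ u → f (g x) ℤ.+ u) (∑ᴸ-map f g xs)

  ∑ᴸ-swap : ∀ (f : A → B → ℤ) xs ys → ∑ᴸ (λ x → ∑ᴸ (f x) ys) xs ≡ ∑ᴸ (λ y → ∑ᴸ (λ x → f x y) xs) ys
  ∑ᴸ-swap f []       ys = ≡.sym (∑ᴸ-zero ys)
  ∑ᴸ-swap f (x ∷ xs) ys = ≡.trans (≡.cong (λ u → ∑ᴸ (f x) ys ℤ.+ u) (∑ᴸ-swap f xs ys)) (≡.sym (∑ᴸ-+ (f x) _ ys))

  ∑ᴸ-interchange : ∀ (u : A → ℤ) (v : B → ℤ) (f : A → B → ℤ) xs ys →
    ∑ᴸ (λ x → u x ℤ.* ∑ᴸ (λ y → v y ℤ.* f x y) ys) xs ≡ ∑ᴸ (λ y → v y ℤ.* ∑ᴸ (λ x → u x ℤ.* f x y) xs) ys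
  ∑ᴸ-interchange u v f xs ys = begin
    ∑ᴸ (λ x → u x ℤ.* ∑ᴸ (λ y → v y ℤ.* f x y) ys) xs
      ≡⟨ ∑ᴸ-cong xs (λ x → *-∑ᴸ (u x) (λ y → v y ℤ.* f x y) ys) ⟩
    ∑ᴸ (λ x → ∑ᴸ (λ y → u x ℤ.* (v y ℤ.* f x y)) ys) xs
      ≡⟨ ∑ᴸ-swap _ xs ys ⟩
    ∑ᴸ (λ y → ∑ᴸ (λ x → u x ℤ.* (v y ℤ.* f x y)) xs) ys
      ≡⟨ ∑ᴸ-cong ys (λ y → ∑ᴸ-cong xs λ x → lemma (u x) (v y) (f x y)) ⟩
    ∑ᴸ (λ y → ∑ᴸ (λ x → v y ℤ.* (u x ℤ.* f x y)) xs) ys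
      ≡⟨ ∑ᴸ-cong ys (λ y → *-∑ᴸ (v y) (λ x → u x ℤ.* f x y) xs) ⟨
    ∑ᴸ (λ y → v y ℤ.* ∑ᴸ (λ x → u x ℤ.* f x y) xs) ys ∎
    where
    open ≡.≡-Reasoning
    lemma : ∀ u v f → u ℤ.* (v ℤ.* f) ≡ v ℤ.* (u ℤ.* f)
    lemma = solve-∀

module FiniteSums {a ℓ} (S : Setoid a ℓ) (_≟_ : Decidable (Setoid._≈_ S)) where
  open Setoid S
  open Membership S using (_∈_)
  open Unique S using (Unique)

  Respects : (Carrier → ℤ) → Set _
  Respects f = f Preserves _≈_ ⟶ _≡_

  ∑ᴸ-cong-∈ : ∀ {f g : Carrier → ℤ} xs → (∀ x → x ∈ xs → f x ≡ g x) → ∑ᴸ f xs ≡ ∑ᴸ g xs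
  ∑ᴸ-cong-∈ []       e = ≡.refl
  ∑ᴸ-cong-∈ (x ∷ xs) e = ≡.cong₂ ℤ._+_ (e x (here refl)) (∑ᴸ-cong-∈ xs λ y → e y ∘ there)

  ∑ᴸ-δ-∉ : ∀ {x} xs → All (λ y → ¬ x ≈ y) xs → (f : Carrier → ℤ) → ∑ᴸ (λ y → indicator (x ≟ y) ℤ.* f y) xs ≡ 0ℤ
  ∑ᴸ-δ-∉ []       []         f = ≡.refl
  ∑ᴸ-δ-∉ {x} (y ∷ xs) (x≉y ∷ ps) f = ≡.cong₂ (λ u v → u ℤ.* f y ℤ.+ v) (indicator-no (x ≟ y) x≉y) (∑ᴸ-δ-∉ xs ps f)

  -- The alternative `f x ≡ 0ℤ` admits points outside the list, as needed for lists that agree only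
  -- on the support of `f`.
  ∑ᴸ-δ : ∀ {f} → Respects f → ∀ {x xs} → Unique xs → f x ≡ 0ℤ ⊎ x ∈ xs →
         ∑ᴸ (λ y → indicator (x ≟ y) ℤ.* f y) xs ≡ f x
  ∑ᴸ-δ {f} resp {x} {xs} _ (inj₁ fx≡0) = ≡.trans (∑ᴸ-cong xs λ y → ≡.trans
    (indicator-*-cong (x ≟ y) (λ x≈y → ≡.trans (≡.sym (resp x≈y)) fx≡0)) (ℤ.*-zeroʳ (indicator (x ≟ y))))
    (≡.trans (∑ᴸ-zero xs) (≡.sym fx≡0))
  ∑ᴸ-δ {f} resp {x} {y ∷ xs} (y∉xs ∷ _) (inj₂ (here x≈y)) = ≡.trans
    (≡.cong₂ (λ u v → u ℤ.* f y ℤ.+ v) (indicator-yes (x ≟ y) x≈y)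
      (∑ᴸ-δ-∉ xs (All.map (λ y≉z x≈z → y≉z (trans (sym x≈y) x≈z)) y∉xs) f))
    (≡.trans (ℤ.+-identityʳ _) (≡.trans (ℤ.*-identityˡ (f y)) (≡.sym (resp x≈y))))
  ∑ᴸ-δ {f} resp {x} {y ∷ xs} (y∉xs ∷ xs!) (inj₂ (there x∈xs)) = ≡.trans
    (≡.cong₂ (λ u v → u ℤ.* f y ℤ.+ v) (indicator-no (x ≟ y) λ x≈y →
      All.lookupₛ S (λ {u} {v} u≈v y≉u y≈v → y≉u (trans y≈v (sym u≈v))) y∉xs x∈xs (sym x≈y))
      (∑ᴸ-δ resp xs! (inj₂ x∈xs)))
    (ℤ.+-identityˡ (f x))

  -- Each `f x` is written as a delta sum over the other list and the two sums are exchanged. This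
  -- frees all later counts from the particular enumeration of a finite set.
  ∑ᴸ-support : ∀ {f} → Respects f → ∀ {xs ys} → Unique xs → Unique ys →
               (∀ x → x ∈ xs → f x ≡ 0ℤ ⊎ x ∈ ys) → (∀ y → y ∈ ys → f y ≡ 0ℤ ⊎ y ∈ xs) → ∑ᴸ f xs ≡ ∑ᴸ f ys
  ∑ᴸ-support {f} resp {xs} {ys} xs! ys! xs⊆ys ys⊆xs = begin
    ∑ᴸ f xs
      ≡⟨ ∑ᴸ-cong-∈ xs (λ x x∈xs → ≡.sym (∑ᴸ-δ resp ys! (xs⊆ys x x∈xs))) ⟩
    ∑ᴸ (λ x → ∑ᴸ (λ y → indicator (x ≟ y) ℤ.* f y) ys) xs
      ≡⟨ ∑ᴸ-swap _ xs ys ⟩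
    ∑ᴸ (λ y → ∑ᴸ (λ x → indicator (x ≟ y) ℤ.* f y) xs) ys
      ≡⟨ ∑ᴸ-cong ys (λ y → ∑ᴸ-cong xs λ x → ≡.trans
           (≡.cong (ℤ._* f y) (indicator-⇔ (mk⇔ sym sym) (x ≟ y) (y ≟ x)))
           (indicator-*-cong (y ≟ x) resp)) ⟩
    ∑ᴸ (λ y → ∑ᴸ (λ x → indicator (y ≟ x) ℤ.* f x) xs) ys
      ≡⟨ ∑ᴸ-cong-∈ ys (λ y y∈ys → ∑ᴸ-δ resp xs! (ys⊆xs y y∈ys)) ⟩
    ∑ᴸ f ys ∎
    where open ≡.≡-Reasoning

  module _ {p} {φ : Carrier → Set p} (φ? : ∀ x → Dec (φ x)) (φ-resp : ∀ {x y} → x ≈ y → φ x → φ y) where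

    indicator-resp : Respects (λ x → indicator (φ? x))
    indicator-resp {x} {y} x≈y = indicator-⇔ (mk⇔ (φ-resp x≈y) (φ-resp (sym x≈y))) (φ? x) (φ? y)

    ∑ᴸ-count : (F : Finite S φ) → ∀ {xs} → Unique xs → (∀ x → φ x → x ∈ xs) →
               ∑ᴸ (λ x → indicator (φ? x)) xs ≡ + Finite.size F
    ∑ᴸ-count F {xs} xs! φ⊆xs = ≡.trans
      (∑ᴸ-support indicator-resp xs! F.unique
        (λ x _ → ⊎.map₂ (Equivalence.from (F.∈⇔ x)) (zero-or x))
        (λ x _ → ⊎.map₂ (φ⊆xs x) (zero-or x)))
      (∑ᴸ-1 _ F.elements (All.tabulateₛ S λ {x} x∈ → indicator-yes (φ? x) (Equivalence.to (F.∈⇔ x) x∈)))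
      where
      module F = Finite F
      zero-or : ∀ x → indicator (φ? x) ≡ 0ℤ ⊎ φ x
      zero-or x with φ? x
      ... | yes p = inj₂ p
      ... | no _  = inj₁ ≡.refl

    restrict : ∀ {xs} → Unique xs → (∀ x → φ x → x ∈ xs) → Finite S φ
    restrict {xs} xs! φ⊆xs = record
      { elements = filter φ? xs
      ; unique = Uniqueₚ.filter⁺ S φ? xs!
      ; ∈⇔ = λ x → mk⇔ (λ x∈ → proj₂ (Membershipₚ.∈-filter⁻ S φ? φ-resp {xs = xs} x∈))
                       (λ φx → Membershipₚ.∈-filter⁺ S φ? φ-resp (φ⊆xs x φx) φx)
      }

-- Sums over covers

module Covers {a ℓ₁ ℓ₂} {P : Poset a ℓ₁ ℓ₂} (G : D1 P) where
  open Poset P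
  open D1 G
  open PosetProperties P using (_<_; <-resp-≈)
  open FiniteSums Eq.setoid (≈-dec G) public
  open Membership Eq.setoid using (_∈_)
  open Unique Eq.setoid using (Unique)

  private
    infix 4 _⋖′_
    _⋖′_ = _⋖_ P

  ⋖-respʳ : ∀ {x y z} → y ≈ z → x ⋖′ y → x ⋖′ z
  ⋖-respʳ y≈z (x<y , none) = proj₁ <-resp-≈ y≈z x<y ,
    λ w (x<w , w<z) → none w (x<w , proj₁ <-resp-≈ (Eq.sym y≈z) w<z)

  ⋖-respˡ : ∀ {x y z} → y ≈ z → y ⋖′ x → z ⋖′ x
  ⋖-respˡ y≈z (y<x , none) = proj₂ <-resp-≈ y≈z y<x ,
    λ w (z<w , w<x) → none w (proj₂ <-resp-≈ (Eq.sym y≈z) z<w , w<x)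

  level : ℕ → List Carrier
  level n = Finite.elements (ranks-finite n)

  level-unique : ∀ n → Unique (level n)
  level-unique n = Finite.unique (ranks-finite n)

  ∈level : ∀ {n x} → rank x ≡ n → x ∈ level n
  ∈level {n} {x} = Equivalence.from (Finite.∈⇔ (ranks-finite n) x)

  rank-∈level : ∀ {n x} → x ∈ level n → rank x ≡ n
  rank-∈level {n} {x} = Equivalence.to (Finite.∈⇔ (ranks-finite n) x)

  levelBelow : ℕ → List Carrier
  levelBelow zero    = []
  levelBelow (suc n) = level n

  levelBelow-unique : ∀ n → Unique (levelBelow n)
  levelBelow-unique zero    = []
  levelBelow-unique (suc n) = level-unique n

  ∈levelBelow : ∀ {n x} → n ≡ suc (rank x) → x ∈ levelBelow n
  ∈levelBelow ≡.refl = ∈level ≡.refl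

  rank-∈levelBelow : ∀ {n x} → x ∈ levelBelow n → n ≡ suc (rank x)
  rank-∈levelBelow {suc n} x∈ = ≡.cong suc (≡.sym (rank-∈level x∈))

  [_⋖_] : Carrier → Carrier → ℤ
  [ x ⋖ y ] = indicator (⋖-dec G x y)

  [_≈_] : Carrier → Carrier → ℤ
  [ x ≈ y ] = indicator (≈-dec G x y)

  [⋖]-cong : ∀ {x x′ y y′} → x ≈ x′ → y ≈ y′ → [ x ⋖ y ] ≡ [ x′ ⋖ y′ ]
  [⋖]-cong {x} {x′} {y} {y′} x≈x′ y≈y′ = indicator-⇔ (mk⇔ (⋖-respˡ x≈x′ ∘ ⋖-respʳ y≈y′)
    (⋖-respˡ (Eq.sym x≈x′) ∘ ⋖-respʳ (Eq.sym y≈y′))) (⋖-dec G x y) (⋖-dec G x′ y′)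

  [≈]-resp : ∀ x → Respects [ x ≈_]
  [≈]-resp x {y} {z} y≈z = indicator-⇔ (mk⇔ (λ x≈y → Eq.trans x≈y y≈z) (λ x≈z → Eq.trans x≈z (Eq.sym y≈z)))
    (≈-dec G x y) (≈-dec G x z)

  -- Functions on the whole poset, as opposed to vectors on one rank: this spares the
  -- product poset all bookkeeping with pairs of ranks.
  ∑⋗ ∑⋖ : (Carrier → ℤ) → Carrier → ℤ
  ∑⋗ g x = ∑ᴸ (λ z → [ x ⋖ z ] ℤ.* g z) (level (suc (rank x)))
  ∑⋖ g x = ∑ᴸ (λ z → [ z ⋖ x ] ℤ.* g z) (levelBelow (rank x))

  ∑⋗-cong : ∀ {g h} → (∀ z → g z ≡ h z) → ∀ x → ∑⋗ g x ≡ ∑⋗ h x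
  ∑⋗-cong e x = ∑ᴸ-cong (level (suc (rank x))) λ z → ≡.cong (λ u → [ x ⋖ z ] ℤ.* u) (e z)

  ∑⋖-cong : ∀ {g h} → (∀ z → g z ≡ h z) → ∀ x → ∑⋖ g x ≡ ∑⋖ h x
  ∑⋖-cong e x = ∑ᴸ-cong (levelBelow (rank x)) λ z → ≡.cong (λ u → [ z ⋖ x ] ℤ.* u) (e z)

  ∑⋗-+ : ∀ g h x → ∑⋗ (λ z → g z ℤ.+ h z) x ≡ ∑⋗ g x ℤ.+ ∑⋗ h x
  ∑⋗-+ g h x = ≡.trans (∑ᴸ-cong (level (suc (rank x))) λ z → ℤ.*-distribˡ-+ [ x ⋖ z ] (g z) (h z))
    (∑ᴸ-+ (λ z → [ x ⋖ z ] ℤ.* g z) (λ z → [ x ⋖ z ] ℤ.* h z) (level (suc (rank x))))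

  ∑⋖-+ : ∀ g h x → ∑⋖ (λ z → g z ℤ.+ h z) x ≡ ∑⋖ g x ℤ.+ ∑⋖ h x
  ∑⋖-+ g h x = ≡.trans (∑ᴸ-cong (levelBelow (rank x)) λ z → ℤ.*-distribˡ-+ [ z ⋖ x ] (g z) (h z))
    (∑ᴸ-+ (λ z → [ z ⋖ x ] ℤ.* g z) (λ z → [ z ⋖ x ] ℤ.* h z) (levelBelow (rank x)))

  ∑⋗-resp : ∀ g → Respects (∑⋗ g)
  ∑⋗-resp g {x} {y} x≈y = ≡.trans (∑ᴸ-cong (level (suc (rank x))) λ z → ≡.cong (ℤ._* g z) ([⋖]-cong x≈y (Eq.refl {z})))
    (≡.cong (λ n → ∑ᴸ (λ z → [ y ⋖ z ] ℤ.* g z) (level (suc n))) (rank-cong x≈y))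

  ∑⋖-resp : ∀ g → Respects (∑⋖ g)
  ∑⋖-resp g {x} {y} x≈y = ≡.trans (∑ᴸ-cong (levelBelow (rank x)) λ z → ≡.cong (ℤ._* g z) ([⋖]-cong (Eq.refl {z}) x≈y))
    (≡.cong (λ n → ∑ᴸ (λ z → [ z ⋖ y ] ℤ.* g z) (levelBelow n)) (rank-cong x≈y))

  ⋖⇒∈level : ∀ {x} z → x ⋖′ z → z ∈ level (suc (rank x))
  ⋖⇒∈level z x⋖z = ∈level (rank-cover x⋖z)

  ⋖⇒∈levelBelow : ∀ {x} z → z ⋖′ x → z ∈ levelBelow (rank x)
  ⋖⇒∈levelBelow z z⋖x = ∈levelBelow (rank-cover z⋖x)

  -- For `x` and `w` of equal rank these are the matrix entries of `DU` and `UD`.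
  ↑count ↓count : Carrier → Carrier → ℤ
  ↑count x w = ∑ᴸ (λ z → [ x ⋖ z ] ℤ.* [ w ⋖ z ]) (level (suc (rank x)))
  ↓count x w = ∑ᴸ (λ z → [ z ⋖ x ] ℤ.* [ z ⋖ w ]) (levelBelow (rank x))

  ∑⋗∑⋖ : ∀ g x → ∑⋗ (∑⋖ g) x ≡ ∑ᴸ (λ w → ↑count x w ℤ.* g w) (level (rank x))
  ∑⋗∑⋖ g x = begin
    ∑ᴸ (λ z → [ x ⋖ z ] ℤ.* ∑⋖ g z) L
      -- The range of the inner sum depends on the rank of `z`, but wherever the indicator is
      -- nonzero that rank is determined by `x`. With a fixed range the sums can be exchanged.
      ≡⟨ ∑ᴸ-cong L (λ z → indicator-*-cong (⋖-dec G x z) λ x⋖z →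
           ≡.cong (λ n → ∑ᴸ (λ w → [ w ⋖ z ] ℤ.* g w) (levelBelow n)) (rank-cover x⋖z)) ⟩
    ∑ᴸ (λ z → [ x ⋖ z ] ℤ.* ∑ᴸ (λ w → [ w ⋖ z ] ℤ.* g w) (level (rank x))) L
      ≡⟨ ∑ᴸ-cong L (λ z → ≡.trans (*-∑ᴸ [ x ⋖ z ] (λ w → [ w ⋖ z ] ℤ.* g w) (level (rank x))) (∑ᴸ-cong (level (rank x)) λ w → ≡.sym (ℤ.*-assoc [ x ⋖ z ] [ w ⋖ z ] (g w)))) ⟩
    ∑ᴸ (λ z → ∑ᴸ (λ w → [ x ⋖ z ] ℤ.* [ w ⋖ z ] ℤ.* g w) (level (rank x))) L
      ≡⟨ ∑ᴸ-swap _ L (level (rank x)) ⟩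
    ∑ᴸ (λ w → ∑ᴸ (λ z → [ x ⋖ z ] ℤ.* [ w ⋖ z ] ℤ.* g w) L) (level (rank x))
      ≡⟨ ∑ᴸ-cong (level (rank x)) (λ w → ≡.sym (∑ᴸ-* (g w) _ L)) ⟩
    ∑ᴸ (λ w → ↑count x w ℤ.* g w) (level (rank x)) ∎
    where
    open ≡.≡-Reasoning
    L = level (suc (rank x))

  ∑⋖∑⋗ : ∀ g x → ∑⋖ (∑⋗ g) x ≡ ∑ᴸ (λ w → ↓count x w ℤ.* g w) (level (rank x))
  ∑⋖∑⋗ g x = begin
    ∑ᴸ (λ z → [ z ⋖ x ] ℤ.* ∑⋗ g z) L
      ≡⟨ ∑ᴸ-cong L (λ z → indicator-*-cong (⋖-dec G z x) λ z⋖x →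
           ≡.cong (λ n → ∑ᴸ (λ w → [ z ⋖ w ] ℤ.* g w) (level n)) (≡.sym (rank-cover z⋖x))) ⟩
    ∑ᴸ (λ z → [ z ⋖ x ] ℤ.* ∑ᴸ (λ w → [ z ⋖ w ] ℤ.* g w) (level (rank x))) L
      ≡⟨ ∑ᴸ-cong L (λ z → ≡.trans (*-∑ᴸ [ z ⋖ x ] (λ w → [ z ⋖ w ] ℤ.* g w) (level (rank x))) (∑ᴸ-cong (level (rank x)) λ w → ≡.sym (ℤ.*-assoc [ z ⋖ x ] [ z ⋖ w ] (g w)))) ⟩
    ∑ᴸ (λ z → ∑ᴸ (λ w → [ z ⋖ x ] ℤ.* [ z ⋖ w ] ℤ.* g w) (level (rank x))) L
      ≡⟨ ∑ᴸ-swap _ L (level (rank x)) ⟩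
    ∑ᴸ (λ w → ∑ᴸ (λ z → [ z ⋖ x ] ℤ.* [ z ⋖ w ] ℤ.* g w) L) (level (rank x))
      ≡⟨ ∑ᴸ-cong (level (rank x)) (λ w → ≡.sym (∑ᴸ-* (g w) _ L)) ⟩
    ∑ᴸ (λ w → ↓count x w ℤ.* g w) (level (rank x)) ∎
    where
    open ≡.≡-Reasoning
    L = levelBelow (rank x)

  -- On coefficient functions `∑⋗` acts as `D` and `∑⋖` as `U`, so this is the relation
  -- `DU - UD = r`, for all ranks at once.
  Commutes : ℤ → Set _
  Commutes r = ∀ g → Respects g → ∀ x → ∑⋗ (∑⋖ g) x ≡ ∑⋖ (∑⋗ g) x ℤ.+ r ℤ.* g x

module _ {a ℓ₁ ℓ₂} {P : Poset a ℓ₁ ℓ₂} {r} (d : IsDifferential P r) where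
  open IsDifferential d
  open Poset P
  open Covers d1

  -- Distinct elements fall under (D2), equal ones under (D3). Both axioms speak of finite sets with
  -- a given size, so the common lower covers are first enumerated by filtering the rank below.
  ↑count≡↓count : ∀ x w → ↑count x w ≡ ↓count x w ℤ.+ + r ℤ.* [ x ≈ w ]
  ↑count≡↓count x w with ≈-dec d1 x w
  ... | no x≉w = ≡.trans ↑count≡ (≡.sym (≡.trans (≡.cong₂ ℤ._+_ ↓count≡ (ℤ.*-zeroʳ (+ r))) (ℤ.+-identityʳ _)))
    where
    ↓? : ∀ z → Dec (_⋖_ P z x × _⋖_ P z w)
    ↓? z = ⋖-dec d1 z x ×-dec ⋖-dec d1 z w
    ↑? : ∀ z → Dec (_⋖_ P x z × _⋖_ P w z)
    ↑? z = ⋖-dec d1 x z ×-dec ⋖-dec d1 w z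
    ↓-resp : ∀ {y z} → y ≈ z → _⋖_ P y x × _⋖_ P y w → _⋖_ P z x × _⋖_ P z w
    ↓-resp y≈z (p , q) = ⋖-respˡ y≈z p , ⋖-respˡ y≈z q
    ↑-resp : ∀ {y z} → y ≈ z → _⋖_ P x y × _⋖_ P w y → _⋖_ P x z × _⋖_ P w z
    ↑-resp y≈z (p , q) = ⋖-respʳ y≈z p , ⋖-respʳ y≈z q
    lower = restrict ↓? ↓-resp (levelBelow-unique (rank x)) (λ z p → ⋖⇒∈levelBelow z (proj₁ p))
    upper = d2 x w (Finite.size lower) x≉w (lower , ≡.refl)
    ↓count≡ : ↓count x w ≡ + Finite.size lower
    ↓count≡ = ≡.trans (∑ᴸ-cong (levelBelow (rank x)) λ z → ≡.sym (indicator-× (⋖-dec d1 z x) (⋖-dec d1 z w)))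
      (∑ᴸ-count ↓? ↓-resp lower (levelBelow-unique (rank x)) (λ z p → ⋖⇒∈levelBelow z (proj₁ p)))
    ↑count≡ : ↑count x w ≡ + Finite.size lower
    ↑count≡ = ≡.trans (∑ᴸ-cong (level (suc (rank x))) λ z → ≡.sym (indicator-× (⋖-dec d1 x z) (⋖-dec d1 w z)))
      (≡.trans (∑ᴸ-count ↑? ↑-resp (proj₁ upper) (level-unique (suc (rank x))) (λ z p → ⋖⇒∈level z (proj₁ p)))
        (≡.cong +_ (proj₂ upper)))
  ... | yes x≈w = ≡.trans ↑count≡ (≡.sym (≡.cong₂ ℤ._+_ ↓count≡ (ℤ.*-identityʳ (+ r))))
    where
    lower = restrict (λ z → ⋖-dec d1 z x) ⋖-respˡ (levelBelow-unique (rank x)) ⋖⇒∈levelBelow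
    upper = d3 x (Finite.size lower) (lower , ≡.refl)
    idem : ∀ {b} {B : Set b} (b? : Dec B) → indicator b? ℤ.* indicator b? ≡ indicator b?
    idem (yes _) = ≡.refl
    idem (no _)  = ≡.refl
    ↓count≡ : ↓count x w ≡ + Finite.size lower
    ↓count≡ = ≡.trans (∑ᴸ-cong (levelBelow (rank x)) λ z → ≡.trans (≡.cong (λ u → [ z ⋖ x ] ℤ.* u) ([⋖]-cong Eq.refl (Eq.sym x≈w))) (idem (⋖-dec d1 z x)))
      (∑ᴸ-count (λ z → ⋖-dec d1 z x) ⋖-respˡ lower (levelBelow-unique (rank x)) ⋖⇒∈levelBelow)
    ↑count≡ : ↑count x w ≡ + Finite.size lower ℤ.+ + r
    ↑count≡ = ≡.trans (∑ᴸ-cong (level (suc (rank x))) λ z → ≡.trans (≡.cong (λ u → [ x ⋖ z ] ℤ.* u) ([⋖]-cong (Eq.sym x≈w) Eq.refl)) (idem (⋖-dec d1 x z)))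
      (≡.trans (∑ᴸ-count (λ z → ⋖-dec d1 x z) ⋖-respʳ (proj₁ upper) (level-unique (suc (rank x))) ⋖⇒∈level)
        (≡.cong +_ (proj₂ upper)))

  commutes : Commutes (+ r)
  commutes g g-resp x = begin
    ∑⋗ (∑⋖ g) x
      ≡⟨ ∑⋗∑⋖ g x ⟩
    ∑ᴸ (λ w → ↑count x w ℤ.* g w) L
      ≡⟨ ∑ᴸ-cong L (λ w → ≡.trans (≡.cong (ℤ._* g w) (↑count≡↓count x w)) (lemma (↓count x w) (+ r) [ x ≈ w ] (g w))) ⟩
    ∑ᴸ (λ w → ↓count x w ℤ.* g w ℤ.+ + r ℤ.* ([ x ≈ w ] ℤ.* g w)) L
      ≡⟨ ∑ᴸ-+ _ _ L ⟩
    ∑ᴸ (λ w → ↓count x w ℤ.* g w) L ℤ.+ ∑ᴸ (λ w → + r ℤ.* ([ x ≈ w ] ℤ.* g w)) L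
      ≡⟨ ≡.cong₂ ℤ._+_ (≡.sym (∑⋖∑⋗ g x)) (≡.trans (≡.sym (*-∑ᴸ (+ r) _ L))
           (≡.cong (λ u → + r ℤ.* u) (∑ᴸ-δ g-resp (level-unique (rank x)) (inj₂ (∈level ≡.refl))))) ⟩
    ∑⋖ (∑⋗ g) x ℤ.+ + r ℤ.* g x ∎
    where
    open ≡.≡-Reasoning
    L = level (rank x)
    lemma : ∀ c r e g → (c ℤ.+ r ℤ.* e) ℤ.* g ≡ c ℤ.* g ℤ.+ r ℤ.* (e ℤ.* g)
    lemma = solve-∀

-- Covers and the commutation relation in a product

module ProductCovers {a ℓ₁ ℓ₂ b ℓ₃ ℓ₄} {P : Poset a ℓ₁ ℓ₂} {Q : Poset b ℓ₃ ℓ₄} (G : D1 P) (H : D1 Q) where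
  private
    module P = Poset P
    module Q = Poset Q
    module G = D1 G
    module H = D1 H
    T = ×-D1 G H
    module T = Poset (×-poset P Q)
    module CP = Covers G
    module CQ = Covers H
    module CT = Covers T
    open Membership P.Eq.setoid using () renaming (_∈_ to _∈P_)
    open Membership Q.Eq.setoid using () renaming (_∈_ to _∈Q_)
    open Membership T.Eq.setoid using () renaming (_∈_ to _∈T_)
    infix 4 _⋖P_ _⋖Q_ _⋖T_
    _⋖P_ = _⋖_ P
    _⋖Q_ = _⋖_ Q
    _⋖T_ = _⋖_ (×-poset P Q)

  ⋖-fst : ∀ {x x′ y} → (x , y) ⋖T (x′ , y) ⇔ x ⋖P x′
  ⋖-fst {x} {x′} {y} = mk⇔
    (λ (((x≤x′ , _) , ≉) , none) → (x≤x′ , λ x≈x′ → ≉ (x≈x′ , Q.Eq.refl)) ,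
      λ z ((x≤z , x≉z) , (z≤x′ , z≉x′)) → none (z , y) (((x≤z , Q.refl) , x≉z ∘ proj₁) , ((z≤x′ , Q.refl) , z≉x′ ∘ proj₁)))
    (λ ((x≤x′ , x≉x′) , none) → ((x≤x′ , Q.refl) , x≉x′ ∘ proj₁) ,
      λ (z , w) (((x≤z , y≤w) , ≉₁) , ((z≤x′ , w≤y) , ≉₂)) →
        let y≈w = Q.antisym y≤w w≤y in
        none z ((x≤z , λ x≈z → ≉₁ (x≈z , y≈w)) , (z≤x′ , λ z≈x′ → ≉₂ (z≈x′ , Q.Eq.sym y≈w))))

  ⋖-snd : ∀ {x y y′} → (x , y) ⋖T (x , y′) ⇔ y ⋖Q y′
  ⋖-snd {x} {y} {y′} = mk⇔
    (λ (((_ , y≤y′) , ≉) , none) → (y≤y′ , λ y≈y′ → ≉ (P.Eq.refl , y≈y′)) ,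
      λ w ((y≤w , y≉w) , (w≤y′ , w≉y′)) → none (x , w) (((P.refl , y≤w) , y≉w ∘ proj₂) , ((P.refl , w≤y′) , w≉y′ ∘ proj₂)))
    (λ ((y≤y′ , y≉y′) , none) → ((P.refl , y≤y′) , y≉y′ ∘ proj₂) ,
      λ (z , w) (((x≤z , y≤w) , ≉₁) , ((z≤x , w≤y′) , ≉₂)) →
        let x≈z = P.antisym x≤z z≤x in
        none w ((y≤w , λ y≈w → ≉₁ (x≈z , y≈w)) , (w≤y′ , λ w≈y′ → ≉₂ (P.Eq.sym x≈z , w≈y′))))

  -- If both coordinates moved, `(x′ , y)` would lie strictly between.
  ⋖-shared : ∀ {x y x′ y′} → (x , y) ⋖T (x′ , y′) → x P.≈ x′ ⊎ y Q.≈ y′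
  ⋖-shared {x} {y} {x′} {y′} (((x≤x′ , y≤y′) , _) , none) with ≈-dec G x x′ | ≈-dec H y y′
  ... | yes x≈x′ | _        = inj₁ x≈x′
  ... | no _     | yes y≈y′ = inj₂ y≈y′
  ... | no x≉x′  | no y≉y′  = contradiction
    (((x≤x′ , Q.refl) , x≉x′ ∘ proj₁) , ((P.refl , y≤y′) , y≉y′ ∘ proj₂)) (none (x′ , y))

  module _ {p q t} {EP : P.Carrier → Set p} {EQ : Q.Carrier → Set q} {ET : T.Carrier → Set t}
    (EP? : ∀ x → Dec (EP x)) (EQ? : ∀ y → Dec (EQ y)) (ET? : ∀ z → Dec (ET z))
    {LP : List P.Carrier} {LQ : List Q.Carrier} {LT : List T.Carrier} where

    -- Phrased for arbitrary predicates so as to serve upper and lower covers alike. The support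
    -- splits into the elements that share `y` and those that share `x`; a common element would have
    -- first coordinate `x`, which `¬ (x ∈P LP)` excludes.
    ∑ᴸ-× : Unique.Unique P.Eq.setoid LP → Unique.Unique Q.Eq.setoid LQ → Unique.Unique T.Eq.setoid LT →
           (∀ x → EP x → x ∈P LP) → (∀ y → EQ y → y ∈Q LQ) → (∀ z → ET z → z ∈T LT) →
           (∀ {z z′} → z T.≈ z′ → ET z → ET z′) → ∀ x y → ¬ (x ∈P LP) →
           (∀ x′ → ET (x′ , y) ⇔ EP x′) → (∀ y′ → ET (x , y′) ⇔ EQ y′) →
           (∀ {x′ y′} → ET (x′ , y′) → x P.≈ x′ ⊎ y Q.≈ y′) →
           ∀ g → CT.Respects g →
           ∑ᴸ (λ z → indicator (ET? z) ℤ.* g z) LT ≡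
           ∑ᴸ (λ x′ → indicator (EP? x′) ℤ.* g (x′ , y)) LP ℤ.+ ∑ᴸ (λ y′ → indicator (EQ? y′) ℤ.* g (x , y′)) LQ
    ∑ᴸ-× LP! LQ! LT! ⊆LP ⊆LQ ⊆LT resp x y x∉LP fst⇔ snd⇔ shared g g-resp = begin
      ∑ᴸ h LT
        ≡⟨ CT.∑ᴸ-support h-resp LT!
             (Uniqueₚ.++⁺ T.Eq.setoid (Uniqueₚ.map⁺ P.Eq.setoid T.Eq.setoid proj₁ LP!) (Uniqueₚ.map⁺ Q.Eq.setoid T.Eq.setoid proj₂ LQ!) disjoint)
             (λ z _ → ⊎.map₂ (covered z) (zero-or z)) (λ z _ → ⊎.map₂ (⊆LT z) (zero-or z)) ⟩
      ∑ᴸ h (map (_, y) LP ++ map (x ,_) LQ)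
        ≡⟨ ∑ᴸ-++ h (map (_, y) LP) (map (x ,_) LQ) ⟩
      ∑ᴸ h (map (_, y) LP) ℤ.+ ∑ᴸ h (map (x ,_) LQ)
        ≡⟨ ≡.cong₂ ℤ._+_
             (≡.trans (∑ᴸ-map h (_, y) LP) (∑ᴸ-cong LP λ x′ → ≡.cong (ℤ._* g (x′ , y)) (indicator-⇔ (fst⇔ x′) (ET? (x′ , y)) (EP? x′))))
             (≡.trans (∑ᴸ-map h (x ,_) LQ) (∑ᴸ-cong LQ λ y′ → ≡.cong (ℤ._* g (x , y′)) (indicator-⇔ (snd⇔ y′) (ET? (x , y′)) (EQ? y′)))) ⟩
      ∑ᴸ (λ x′ → indicator (EP? x′) ℤ.* g (x′ , y)) LP ℤ.+ ∑ᴸ (λ y′ → indicator (EQ? y′) ℤ.* g (x , y′)) LQ ∎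
      where
      open ≡.≡-Reasoning
      h : T.Carrier → ℤ
      h z = indicator (ET? z) ℤ.* g z
      h-resp : CT.Respects h
      h-resp {z} {z′} z≈z′ = ≡.cong₂ ℤ._*_ (CT.indicator-resp ET? resp z≈z′) (g-resp z≈z′)
      zero-or : ∀ z → h z ≡ 0ℤ ⊎ ET z
      zero-or z with ET? z
      ... | yes e = inj₂ e
      ... | no _  = inj₁ ≡.refl
      disjoint : ∀ {v} → ¬ (v ∈T map (_, y) LP × v ∈T map (x ,_) LQ)
      disjoint (v∈₁ , v∈₂) =
        let x′ , x′∈ , (v≈x′ , _) = Membershipₚ.∈-map⁻ P.Eq.setoid T.Eq.setoid v∈₁
            y′ , y′∈ , (v≈x , _) = Membershipₚ.∈-map⁻ Q.Eq.setoid T.Eq.setoid v∈₂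
        in x∉LP (Membershipₚ.∈-resp-≈ P.Eq.setoid (P.Eq.trans (P.Eq.sym v≈x′) v≈x) x′∈)
      covered : ∀ z → ET z → z ∈T map (_, y) LP ++ map (x ,_) LQ
      covered (x′ , y′) e with shared e
      ... | inj₁ x≈x′ = Membershipₚ.∈-++⁺ʳ T.Eq.setoid (map (_, y) LP) (Membershipₚ.∈-resp-≈ T.Eq.setoid (x≈x′ , Q.Eq.refl)
        (Membershipₚ.∈-map⁺ Q.Eq.setoid T.Eq.setoid (P.Eq.refl ,_)
          (⊆LQ y′ (Equivalence.to (snd⇔ y′) (resp (P.Eq.sym x≈x′ , Q.Eq.refl) e)))))
      ... | inj₂ y≈y′ = Membershipₚ.∈-++⁺ˡ T.Eq.setoid (Membershipₚ.∈-resp-≈ T.Eq.setoid (P.Eq.refl , y≈y′)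
        (Membershipₚ.∈-map⁺ P.Eq.setoid T.Eq.setoid (_, Q.Eq.refl)
          (⊆LP x′ (Equivalence.to (fst⇔ x′) (resp (P.Eq.refl , Q.Eq.sym y≈y′) e)))))

  ∑⋗-× : ∀ g → CT.Respects g → ∀ x y → CT.∑⋗ g (x , y) ≡ CP.∑⋗ (λ x′ → g (x′ , y)) x ℤ.+ CQ.∑⋗ (λ y′ → g (x , y′)) y
  ∑⋗-× g g-resp x y = ∑ᴸ-× (⋖-dec G x) (⋖-dec H y) (⋖-dec T (x , y))
    (CP.level-unique (suc (G.rank x))) (CQ.level-unique (suc (H.rank y))) (CT.level-unique (suc (D1.rank T (x , y))))
    CP.⋖⇒∈level CQ.⋖⇒∈level CT.⋖⇒∈level CT.⋖-respʳ x y
    (λ x∈ → ℕ.1+n≢n (≡.sym (CP.rank-∈level x∈)))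
    (λ _ → ⋖-fst) (λ _ → ⋖-snd) ⋖-shared g g-resp

  ∑⋖-× : ∀ g → CT.Respects g → ∀ x y → CT.∑⋖ g (x , y) ≡ CP.∑⋖ (λ x′ → g (x′ , y)) x ℤ.+ CQ.∑⋖ (λ y′ → g (x , y′)) y
  ∑⋖-× g g-resp x y = ∑ᴸ-× (λ x′ → ⋖-dec G x′ x) (λ y′ → ⋖-dec H y′ y) (λ z → ⋖-dec T z (x , y))
    (CP.levelBelow-unique (G.rank x)) (CQ.levelBelow-unique (H.rank y)) (CT.levelBelow-unique (D1.rank T (x , y)))
    CP.⋖⇒∈levelBelow CQ.⋖⇒∈levelBelow CT.⋖⇒∈levelBelow CT.⋖-respˡ x y
    (λ x∈ → ℕ.1+n≢n (≡.sym (CP.rank-∈levelBelow x∈)))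
    (λ _ → ⋖-fst) (λ _ → ⋖-snd) (⊎.map P.Eq.sym Q.Eq.sym ∘ ⋖-shared) g g-resp

  swap-⋗P-⋖Q : ∀ (g : T.Carrier → ℤ) x y →
    CP.∑⋗ (λ x′ → CQ.∑⋖ (λ y′ → g (x′ , y′)) y) x ≡ CQ.∑⋖ (λ y′ → CP.∑⋗ (λ x′ → g (x′ , y′)) x) y
  swap-⋗P-⋖Q g x y = ∑ᴸ-interchange CP.[ x ⋖_] CQ.[_⋖ y ] (λ x′ y′ → g (x′ , y′)) (CP.level (suc (G.rank x))) (CQ.levelBelow (H.rank y))

  swap-⋗Q-⋖P : ∀ (g : T.Carrier → ℤ) x y →
    CQ.∑⋗ (λ y′ → CP.∑⋖ (λ x′ → g (x′ , y′)) x) y ≡ CP.∑⋖ (λ x′ → CQ.∑⋗ (λ y′ → g (x′ , y′)) y) x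
  swap-⋗Q-⋖P g x y = ∑ᴸ-interchange CQ.[ y ⋖_] CP.[_⋖ x ] (λ y′ x′ → g (x′ , y′)) (CQ.level (suc (H.rank y))) (CP.levelBelow (G.rank x))

  -- Both `D` and `U` of the product are sums of operators on the two coordinates. Operators on
  -- different coordinates commute, so the commutator is the sum of the two commutators.
  ×-commutes : ∀ {r s} → CP.Commutes r → CQ.Commutes s → CT.Commutes (r ℤ.+ s)
  ×-commutes {r} {s} P-commutes Q-commutes g g-resp (x , y) = begin
    CT.∑⋗ (CT.∑⋖ g) (x , y)
      ≡⟨ ∑⋗-× (CT.∑⋖ g) (λ {z} {z′} → CT.∑⋖-resp g {z} {z′}) x y ⟩
    CP.∑⋗ (λ x′ → CT.∑⋖ g (x′ , y)) x ℤ.+ CQ.∑⋗ (λ y′ → CT.∑⋖ g (x , y′)) y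
      ≡⟨ ≡.cong₂ ℤ._+_
           (≡.trans (CP.∑⋗-cong (λ x′ → ∑⋖-× g g-resp x′ y) x) (CP.∑⋗-+ _ _ x))
           (≡.trans (CQ.∑⋗-cong (λ y′ → ∑⋖-× g g-resp x y′) y) (CQ.∑⋗-+ _ _ y)) ⟩
    (CP.∑⋗ (CP.∑⋖ gP) x ℤ.+ A₁) ℤ.+ (A₂ ℤ.+ CQ.∑⋗ (CQ.∑⋖ gQ) y)
      ≡⟨ ≡.cong₂ ℤ._+_
           (≡.cong₂ ℤ._+_ (P-commutes gP (λ e → g-resp (e , Q.Eq.refl)) x) (swap-⋗P-⋖Q g x y))
           (≡.cong₂ ℤ._+_ (swap-⋗Q-⋖P g x y) (Q-commutes gQ (λ e → g-resp (P.Eq.refl , e)) y)) ⟩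
    (CP.∑⋖ (CP.∑⋗ gP) x ℤ.+ r ℤ.* g (x , y) ℤ.+ B₁) ℤ.+ (B₂ ℤ.+ (CQ.∑⋖ (CQ.∑⋗ gQ) y ℤ.+ s ℤ.* g (x , y)))
      ≡⟨ lemma (CP.∑⋖ (CP.∑⋗ gP) x) r (g (x , y)) B₁ B₂ (CQ.∑⋖ (CQ.∑⋗ gQ) y) s ⟩
    (CP.∑⋖ (CP.∑⋗ gP) x ℤ.+ B₂) ℤ.+ (B₁ ℤ.+ CQ.∑⋖ (CQ.∑⋗ gQ) y) ℤ.+ (r ℤ.+ s) ℤ.* g (x , y)
      ≡⟨ ≡.cong (ℤ._+ (r ℤ.+ s) ℤ.* g (x , y)) (≡.sym (≡.cong₂ ℤ._+_
           (≡.trans (CP.∑⋖-cong (λ x′ → ∑⋗-× g g-resp x′ y) x) (CP.∑⋖-+ _ _ x))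
           (≡.trans (CQ.∑⋖-cong (λ y′ → ∑⋗-× g g-resp x y′) y) (CQ.∑⋖-+ _ _ y)))) ⟩
    CP.∑⋖ (λ x′ → CT.∑⋗ g (x′ , y)) x ℤ.+ CQ.∑⋖ (λ y′ → CT.∑⋗ g (x , y′)) y ℤ.+ (r ℤ.+ s) ℤ.* g (x , y)
      ≡⟨ ≡.cong (ℤ._+ (r ℤ.+ s) ℤ.* g (x , y)) (≡.sym (∑⋖-× (CT.∑⋗ g) (λ {z} {z′} → CT.∑⋗-resp g {z} {z′}) x y)) ⟩
    CT.∑⋖ (CT.∑⋗ g) (x , y) ℤ.+ (r ℤ.+ s) ℤ.* g (x , y) ∎
    where
    open ≡.≡-Reasoning
    gP = λ x′ → g (x′ , y)
    gQ = λ y′ → g (x , y′)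
    A₁ = CP.∑⋗ (λ x′ → CQ.∑⋖ (λ y′ → g (x′ , y′)) y) x
    A₂ = CQ.∑⋗ (λ y′ → CP.∑⋖ (λ x′ → g (x′ , y′)) x) y
    B₁ = CQ.∑⋖ (λ y′ → CP.∑⋗ (λ x′ → g (x′ , y′)) x) y
    B₂ = CP.∑⋖ (λ x′ → CQ.∑⋗ (λ y′ → g (x′ , y′)) y) x
    lemma : ∀ p r g b₁ b₂ q s → (p ℤ.+ r ℤ.* g ℤ.+ b₁) ℤ.+ (b₂ ℤ.+ (q ℤ.+ s ℤ.* g)) ≡ (p ℤ.+ b₂) ℤ.+ (b₁ ℤ.+ q) ℤ.+ (r ℤ.+ s) ℤ.* g
    lemma = solve-∀

-- The matrices of the down maps

module _ {a ℓ} (S : Setoid a ℓ) where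
  open Setoid S
  open Unique S using (Unique)

  lookup-injective : ∀ {xs} → Unique xs → ∀ i j → lookup xs i ≈ lookup xs j → i ≡ j
  lookup-injective {x ∷ xs} (_ ∷ _)    zero    zero    e = ≡.refl
  lookup-injective {x ∷ xs} (x∉ ∷ _)   zero    (suc j) e =
    contradiction e (All.lookupₛ S (λ u≈v x≉u x≈v → x≉u (trans x≈v (sym u≈v))) x∉ (Membershipₚ.∈-lookup S xs j))
  lookup-injective {x ∷ xs} (x∉ ∷ _)   (suc i) zero    e =
    contradiction (sym e) (All.lookupₛ S (λ u≈v x≉u x≈v → x≉u (trans x≈v (sym u≈v))) x∉ (Membershipₚ.∈-lookup S xs i))
  lookup-injective {x ∷ xs} (_ ∷ xs!)  (suc i) (suc j) e = ≡.cong suc (lookup-injective xs! i j e)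

module LevelMatrices {a ℓ₁ ℓ₂} {P : Poset a ℓ₁ ℓ₂} (G : D1 P) where
  open Poset P
  open D1 G
  open Covers G
  open ℤM using (Mat; entry; _≋_; pointwise; _∙_; _⊞_; _ᵀ; 𝟙; scalar; ∑; ∑-cong; δ; δ-∑; δ-sym; *-∑; ∑-swap)

  rank-basis : ∀ n i → rank (basis n i) ≡ n
  rank-basis n i = rank-∈level (Membershipₚ.∈-lookup Eq.setoid (level n) i)

  [basis≈basis] : ∀ n i j → [ basis n i ≈ basis n j ] ≡ δ {fin (rankSize n)} i j
  [basis≈basis] n i j = indicator-⇔ (mk⇔ (lookup-injective Eq.setoid (level-unique n) i j) (λ { ≡.refl → Eq.refl }))
    (≈-dec G (basis n i) (basis n j)) (i Fin.≟ j)

  downMatrix : ∀ n → Mat (fin (rankSize n)) (fin (rankSize (suc n)))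
  entry (downMatrix n) i k = [ basis n i ⋖ basis (suc n) k ]

  downMatrix-∙ : ∀ n (h : Carrier → ℤ) i →
                 ∑ (fin (rankSize (suc n))) (λ k → [ basis n i ⋖ basis (suc n) k ] ℤ.* h (basis (suc n) k)) ≡ ∑⋗ h (basis n i)
  downMatrix-∙ n h i = ≡.trans (∑ᴸ-lookup (λ z → [ basis n i ⋖ z ] ℤ.* h z) (level (suc n)))
    (≡.cong (λ m → ∑ᴸ (λ z → [ basis n i ⋖ z ] ℤ.* h z) (level (suc m))) (≡.sym (rank-basis n i)))

  matrixOf-DU : ∀ n i j → matrixOf (DU G n) i j ≡ entry (downMatrix n ∙ downMatrix n ᵀ) i j
  matrixOf-DU n i j = ∑-cong (fin (rankSize (suc n))) λ k → ≡.trans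
    (≡.cong (ℤ._* [ basis n i ⋖ basis (suc n) k ]) (≡.trans
      (∑-cong (fin (rankSize n)) λ l → ≡.cong (ℤ._* [ basis n l ⋖ basis (suc n) k ]) (δ-sym {fin (rankSize n)} l j))
      (δ-∑ (fin (rankSize n)) j λ l → [ basis n l ⋖ basis (suc n) k ])))
    (ℤ.*-comm [ basis n j ⋖ basis (suc n) k ] [ basis n i ⋖ basis (suc n) k ])

  module _ {r} (commutes : Commutes r) where

    -- The operator identity is turned back into one of matrix entries by testing it on the
    -- indicator function of `w`.
    count-commutes : ∀ x w → rank w ≡ rank x → ↑count x w ≡ ↓count x w ℤ.+ r ℤ.* [ w ≈ x ]
    count-commutes x w w~x = begin
      ↑count x w                                           ≡⟨ δ-count ↑-resp ⟨
      ∑ᴸ (λ u → ↑count x u ℤ.* [ w ≈ u ]) L                ≡⟨ ∑⋗∑⋖ [ w ≈_] x ⟨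
      ∑⋗ (∑⋖ [ w ≈_]) x                                    ≡⟨ commutes [ w ≈_] ([≈]-resp w) x ⟩
      ∑⋖ (∑⋗ [ w ≈_]) x ℤ.+ r ℤ.* [ w ≈ x ]                ≡⟨ ≡.cong (ℤ._+ r ℤ.* [ w ≈ x ]) (∑⋖∑⋗ [ w ≈_] x) ⟩
      ∑ᴸ (λ u → ↓count x u ℤ.* [ w ≈ u ]) L ℤ.+ r ℤ.* [ w ≈ x ] ≡⟨ ≡.cong (ℤ._+ r ℤ.* [ w ≈ x ]) (δ-count ↓-resp) ⟩
      ↓count x w ℤ.+ r ℤ.* [ w ≈ x ]                       ∎
      where
      open ≡.≡-Reasoning
      L = level (rank x)
      ↑-resp : Respects (↑count x)
      ↑-resp u≈v = ∑ᴸ-cong (level (suc (rank x))) λ z → ≡.cong (λ t → [ x ⋖ z ] ℤ.* t) ([⋖]-cong u≈v (Eq.refl {z}))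
      ↓-resp : Respects (↓count x)
      ↓-resp u≈v = ∑ᴸ-cong (levelBelow (rank x)) λ z → ≡.cong (λ t → [ z ⋖ x ] ℤ.* t) ([⋖]-cong (Eq.refl {z}) u≈v)
      δ-count : ∀ {f} → Respects f → ∑ᴸ (λ u → f u ℤ.* [ w ≈ u ]) L ≡ f w
      δ-count {f} f-resp = ≡.trans (∑ᴸ-cong L λ u → ℤ.*-comm (f u) [ w ≈ u ])
        (∑ᴸ-δ f-resp (level-unique (rank x)) (inj₂ (∈level w~x)))

    ↑count-basis : ∀ n i j → entry (downMatrix n ∙ downMatrix n ᵀ) i j ≡
                   ↓count (basis n i) (basis n j) ℤ.+ r ℤ.* δ {fin (rankSize n)} i j
    ↑count-basis n i j = ≡.trans (downMatrix-∙ n [ basis n j ⋖_] i) (≡.trans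
      (count-commutes (basis n i) (basis n j) (≡.trans (rank-basis n j) (≡.sym (rank-basis n i))))
      (≡.cong (λ t → ↓count (basis n i) (basis n j) ℤ.+ r ℤ.* t)
        (≡.trans ([basis≈basis] n j i) (δ-sym {fin (rankSize n)} j i))))

    downMatrix-base : downMatrix 0 ∙ downMatrix 0 ᵀ ≋ scalar r
    downMatrix-base = pointwise λ i j → ≡.trans (↑count-basis 0 i j) (≡.trans
      (≡.cong (λ n → ∑ᴸ (λ z → [ z ⋖ basis 0 i ] ℤ.* [ z ⋖ basis 0 j ]) (levelBelow n) ℤ.+ r ℤ.* δ {fin (rankSize 0)} i j) (rank-basis 0 i))
      (ℤ.+-identityˡ _))

    downMatrix-commute : ∀ n → downMatrix (suc n) ∙ downMatrix (suc n) ᵀ ≋ downMatrix n ᵀ ∙ downMatrix n ⊞ scalar r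
    downMatrix-commute n = pointwise λ i j → ≡.trans (↑count-basis (suc n) i j)
      (≡.cong (ℤ._+ r ℤ.* δ {fin (rankSize (suc n))} i j) (≡.trans
        (≡.cong (λ m → ∑ᴸ (λ z → [ z ⋖ basis (suc n) i ] ℤ.* [ z ⋖ basis (suc n) j ]) (levelBelow m)) (rank-basis (suc n) i))
        (≡.sym (∑ᴸ-lookup (λ z → [ z ⋖ basis (suc n) i ] ℤ.* [ z ⋖ basis (suc n) j ]) (level n)))))

  -- Surjectivity of `D` on functions on the whole poset, which contains the surjectivity of every
  -- single down map and needs no splitting of product ranks.
  Solvable : Set _
  Solvable = ∀ g → Respects g → ∃ λ h → ∀ x → ∑⋗ h x ≡ g x

  downMatrix-section : Solvable → ∀ n → ∃ λ σ → downMatrix n ∙ σ ≋ 𝟙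
  downMatrix-section solve n = σ , pointwise λ i j → ≡.trans (downMatrix-∙ n (h j) i)
    (≡.trans (proj₂ (solve [ basis n j ≈_] ([≈]-resp (basis n j))) (basis n i))
      (≡.trans ([basis≈basis] n j i) (δ-sym {fin (rankSize n)} j i)))
    where
    h : Fin (rankSize n) → Carrier → ℤ
    h j = proj₁ (solve [ basis n j ≈_] ([≈]-resp (basis n j)))
    σ : Mat (fin (rankSize (suc n))) (fin (rankSize n))
    entry σ k j = h j (basis (suc n) k)

  module Lift (surjective : DownMapsSurjective G) where
    private
      v : ∀ n → Fin (rankSize n) → Fin (rankSize (suc n)) → ℤ
      v n j = proj₁ (surjective n (unit j))

      D-v : ∀ n j i → ∑ (fin (rankSize (suc n))) (λ k → v n j k ℤ.* [ basis n i ⋖ basis (suc n) k ]) ≡ δ {fin (rankSize n)} i j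
      D-v n j = proj₂ (surjective n (unit j)) (λ _ → ≡.refl)

      preimage : ∀ n → Fin (rankSize n) → Carrier → ℤ
      preimage n j z = ∑ (fin (rankSize (suc n))) λ k → [ z ≈ basis (suc n) k ] ℤ.* v n j k

      preimage-basis : ∀ n j k → preimage n j (basis (suc n) k) ≡ v n j k
      preimage-basis n j k = ≡.trans (∑-cong (fin (rankSize (suc n))) λ l → ≡.cong (ℤ._* v n j l) ([basis≈basis] (suc n) k l))
        (δ-∑ (fin (rankSize (suc n))) k (v n j))

    -- A linear section of one down map, with values extended by zero off rank `n + 1`. Being one
    -- fixed formula in `f`, it keeps any dependence of `f` on a parameter well defined.
    lift : ∀ n → (Carrier → ℤ) → Carrier → ℤ
    lift n f z = ∑ (fin (rankSize n)) λ j → f (basis n j) ℤ.* preimage n j z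

    lift-cong : ∀ n {f f′} → (∀ x → f x ≡ f′ x) → ∀ z → lift n f z ≡ lift n f′ z
    lift-cong n e z = ∑-cong (fin (rankSize n)) λ j → ≡.cong (ℤ._* preimage n j z) (e (basis n j))

    lift-resp : ∀ n f → Respects (lift n f)
    lift-resp n f {y} {z} y≈z = ∑-cong (fin (rankSize n)) λ j → ≡.cong (λ t → f (basis n j) ℤ.* t)
      (∑-cong (fin (rankSize (suc n))) λ k → ≡.cong (ℤ._* v n j k) (indicator-⇔
        (mk⇔ (Eq.trans (Eq.sym y≈z)) (Eq.trans y≈z)) (≈-dec G y (basis (suc n) k)) (≈-dec G z (basis (suc n) k))))

    ∑⋗-lift : ∀ n f → Respects f → ∀ x → rank x ≡ n → ∑⋗ (lift n f) x ≡ f x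
    ∑⋗-lift n f f-resp x x∈n = ≡.trans (∑⋗-resp (lift n f) x≈) (≡.trans on-basis (f-resp (Eq.sym x≈)))
      where
      i = Any.index (∈level x∈n)
      x≈ : x ≈ basis n i
      x≈ = Anyₚ.lookup-index (∈level x∈n)
      p′ = fin (rankSize (suc n))
      p = fin (rankSize n)
      open ≡.≡-Reasoning
      shuffle : ∀ c f v → c ℤ.* (f ℤ.* v) ≡ f ℤ.* (v ℤ.* c)
      shuffle = solve-∀
      on-basis : ∑⋗ (lift n f) (basis n i) ≡ f (basis n i)
      on-basis = begin
        ∑⋗ (lift n f) (basis n i)
          ≡⟨ downMatrix-∙ n (lift n f) i ⟨
        ∑ p′ (λ k → [ basis n i ⋖ basis (suc n) k ] ℤ.* lift n f (basis (suc n) k))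
          ≡⟨ ∑-cong p′ (λ k → ≡.trans (≡.cong (λ t → [ basis n i ⋖ basis (suc n) k ] ℤ.* t)
               (∑-cong p λ j → ≡.cong (λ t → f (basis n j) ℤ.* t) (preimage-basis n j k)))
               (*-∑ p [ basis n i ⋖ basis (suc n) k ] (λ j → f (basis n j) ℤ.* v n j k))) ⟩
        ∑ p′ (λ k → ∑ p λ j → [ basis n i ⋖ basis (suc n) k ] ℤ.* (f (basis n j) ℤ.* v n j k))
          ≡⟨ ∑-swap p′ p (λ k j → [ basis n i ⋖ basis (suc n) k ] ℤ.* (f (basis n j) ℤ.* v n j k)) ⟩
        ∑ p (λ j → ∑ p′ λ k → [ basis n i ⋖ basis (suc n) k ] ℤ.* (f (basis n j) ℤ.* v n j k))
          ≡⟨ ∑-cong p (λ j → ≡.trans (∑-cong p′ λ k → shuffle [ basis n i ⋖ basis (suc n) k ] (f (basis n j)) (v n j k))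
               (≡.trans (≡.sym (*-∑ p′ (f (basis n j)) (λ k → v n j k ℤ.* [ basis n i ⋖ basis (suc n) k ])))
               (≡.trans (≡.cong (λ t → f (basis n j) ℤ.* t) (D-v n j i)) (ℤ.*-comm (f (basis n j)) (δ {p} i j))))) ⟩
        ∑ p (λ j → δ {p} i j ℤ.* f (basis n j))
          ≡⟨ δ-∑ p i (λ j → f (basis n j)) ⟩
        f (basis n i) ∎

-- Surjectivity of the down maps of the product

module _ {a ℓ₁ ℓ₂ b ℓ₃ ℓ₄} {P : Poset a ℓ₁ ℓ₂} {Q : Poset b ℓ₃ ℓ₄} (G : D1 P) (H : D1 Q) (surjective : DownMapsSurjective G) where
  private
    module P = Poset P
    module Q = Poset Q
    module G = D1 G
    module CP = Covers G
    module CQ = Covers H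
  open LevelMatrices.Lift G surjective

  module _ (g : P.Carrier → Q.Carrier → ℤ) (g-resp : ∀ {x x′ y y′} → x P.≈ x′ → y Q.≈ y′ → g x y ≡ g x′ y′) where
    private
      -- Solved by increasing rank of the first coordinate.
      h : ℕ → P.Carrier → Q.Carrier → ℤ
      residual : ℕ → Q.Carrier → P.Carrier → ℤ
      -- The equation at `(x , y)` involves values over the rank `n` of `x` and over rank `n + 1`.
      -- The values over rank 0 are therefore free, and once those over rank `n` are fixed, what
      -- remains is an equation for the down map of the first factor with right-hand side
      -- `residual`.
      h zero    x y = 0ℤ
      h (suc n) x y = lift n (residual n y) x
      residual n y x = g x y ℤ.- CQ.∑⋗ (h n x) y

      h-respˡ : ∀ n {x x′} y → x P.≈ x′ → h n x y ≡ h n x′ y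
      h-respˡ zero    y x≈ = ≡.refl
      h-respˡ (suc n) y x≈ = lift-resp n (residual n y) x≈

      residual-resp : ∀ n y → CP.Respects (residual n y)
      residual-resp n y x≈ = ≡.cong₂ ℤ._-_ (g-resp x≈ Q.Eq.refl) (CQ.∑⋗-cong (λ y′ → h-respˡ n y′ x≈) y)

    solve-× : ∃ λ (f : P.Carrier → Q.Carrier → ℤ) →
              (∀ {x x′ y y′} → x P.≈ x′ → y Q.≈ y′ → f x y ≡ f x′ y′) ×
              (∀ x y → CP.∑⋗ (λ x′ → f x′ y) x ℤ.+ CQ.∑⋗ (f x) y ≡ g x y)
    solve-× = (λ x → h (G.rank x) x) ,
      (λ {x} {x′} {y} {y′} x≈ y≈ → ≡.trans (h-respˡ (G.rank x) y x≈)
        (≡.trans (≡.cong (λ n → h n x′ y) (G.rank-cong x≈)) (h-respʳ (G.rank x′) x′ y≈))) ,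
      λ x y → ≡.trans (≡.cong (ℤ._+ CQ.∑⋗ (h (G.rank x) x) y) (begin
        CP.∑⋗ (λ x′ → h (G.rank x′) x′ y) x
          ≡⟨ ∑ᴸ-cong (CP.level (suc (G.rank x))) (λ x′ → indicator-*-cong (⋖-dec G x x′) λ x⋖x′ →
               ≡.cong (λ n → h n x′ y) (G.rank-cover x⋖x′)) ⟩
        CP.∑⋗ (lift (G.rank x) (residual (G.rank x) y)) x
          ≡⟨ ∑⋗-lift (G.rank x) (residual (G.rank x) y) (residual-resp (G.rank x) y) x ≡.refl ⟩
        g x y ℤ.- CQ.∑⋗ (h (G.rank x) x) y ∎)) (cancel (g x y) (CQ.∑⋗ (h (G.rank x) x) y))
      where
      open ≡.≡-Reasoning
      cancel : ∀ u w → u ℤ.- w ℤ.+ w ≡ u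
      cancel = solve-∀
      h-respʳ : ∀ n x {y y′} → y Q.≈ y′ → h n x y ≡ h n x y′
      h-respʳ zero    x y≈ = ≡.refl
      h-respʳ (suc n) x y≈ = lift-cong n (λ x′ → ≡.cong₂ ℤ._-_ (g-resp (P.Eq.refl {x′}) y≈) (CQ.∑⋗-resp (h n x′) y≈)) x

module _ {a ℓ₁ ℓ₂ b ℓ₃ ℓ₄} {P : Poset a ℓ₁ ℓ₂} {Q : Poset b ℓ₃ ℓ₄} (G : D1 P) (H : D1 Q) where
  private
    module CP = Covers G
    module CQ = Covers H

  ×-solvable : DownMapsSurjective G ⊎ DownMapsSurjective H → LevelMatrices.Solvable (×-D1 G H)
  ×-solvable (inj₁ surjective) g g-resp =
    let f , f-resp , solves = solve-× G H surjective (λ x y → g (x , y)) (λ x≈ y≈ → g-resp (x≈ , y≈))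
        f̂ = λ z → f (proj₁ z) (proj₂ z)
    in f̂ , λ (x , y) → ≡.trans (ProductCovers.∑⋗-× G H f̂ (λ (x≈ , y≈) → f-resp x≈ y≈) x y) (solves x y)
  ×-solvable (inj₂ surjective) g g-resp =
    let f , f-resp , solves = solve-× H G surjective (λ y x → g (x , y)) (λ y≈ x≈ → g-resp (x≈ , y≈))
        f̂ = λ z → f (proj₂ z) (proj₁ z)
    in f̂ , λ (x , y) → ≡.trans (ProductCovers.∑⋗-× G H f̂ (λ (x≈ , y≈) → f-resp y≈ x≈) x y)
         (≡.trans (ℤ.+-comm (CP.∑⋗ (λ x′ → f y x′) x) (CQ.∑⋗ (λ y′ → f y′ x) y)) (solves y x))

-- Rank sizes

-- The recursion shifts `p`, matching the order of the blocks in a product rank; positivity and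
-- monotonicity of `p` are stable under this shift.
convolution : (ℕ → ℕ) → (ℕ → ℕ) → ℕ → ℕ
convolution p q zero    = p 0 ℕ.* q 0
convolution p q (suc n) = p 0 ℕ.* q (suc n) ℕ.+ convolution (p ∘ suc) q n

length-cartesianProduct : ∀ {a b} {A : Set a} {B : Set b} (xs : List A) (ys : List B) →
  length (cartesianProduct xs ys) ≡ length xs ℕ.* length ys
length-cartesianProduct []       ys = ≡.refl
length-cartesianProduct (x ∷ xs) ys = ≡.trans (List.length-++ (map (x ,_) ys))
  (≡.cong₂ ℕ._+_ (List.length-map (x ,_) ys) (length-cartesianProduct xs ys))

length-concat-products : ∀ {a b} {A : Set a} {B : Set b} (xs : ℕ → List A) (ys : ℕ → List B) n →
  length (concat (applyUpTo (λ i → cartesianProduct (xs i) (ys (n ∸ i))) (suc n))) ≡ convolution (length ∘ xs) (length ∘ ys) n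
length-concat-products xs ys zero = ≡.trans (List.length-++ (cartesianProduct (xs 0) (ys 0)))
  (≡.trans (ℕ.+-identityʳ _) (length-cartesianProduct (xs 0) (ys 0)))
length-concat-products xs ys (suc n) = ≡.trans (List.length-++ (cartesianProduct (xs 0) (ys (suc n))))
  (≡.cong₂ ℕ._+_ (length-cartesianProduct (xs 0) (ys (suc n))) (length-concat-products (xs ∘ suc) ys n))

module _ (q : ℕ → ℕ) (q₀ : q 0 ≡ 1) (q₁ : 1 ℕ.≤ q 1) (q₂ : suc (q 1) ℕ.≤ q 2)
  (q-convex : ∀ n → q (suc n) ℕ.+ q (suc n) ℕ.≤ q n ℕ.+ q (suc (suc n))) where

  -- Splitting off the term of `p 0` leaves a weak inequality, the convexity of `q` scaled by `p 0`,
  -- next to the same claim for the shifted `p`. All strictness thus comes from the case 0.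
  convolution-convex : ∀ (p : ℕ → ℕ) → (∀ n → 1 ℕ.≤ p n) → (∀ n → p n ℕ.≤ p (suc n)) → ∀ n →
    convolution p q (suc n) ℕ.+ convolution p q (suc n) ℕ.< convolution p q n ℕ.+ convolution p q (suc (suc n))
  convolution-convex p p-pos p-mono zero rewrite q₀ = base (q 1) q₁ q₂ (q-convex 0)
    where
    a = p 0
    b = p 1
    c = p 2
    open ℕ.≤-Reasoning
    base : ∀ s → 1 ℕ.≤ s → suc s ℕ.≤ q 2 → s ℕ.+ s ℕ.≤ q 0 ℕ.+ q 2 →
           (a ℕ.* s ℕ.+ b ℕ.* 1) ℕ.+ (a ℕ.* s ℕ.+ b ℕ.* 1) ℕ.< a ℕ.* 1 ℕ.+ (a ℕ.* q 2 ℕ.+ (b ℕ.* s ℕ.+ c ℕ.* 1))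
    -- For `q 1 = 1` convexity gives no more than `1 ≤ q 2`; the bound `2 ≤ q 2` and the
    -- monotonicity of `p` are used instead.
    base (suc zero) _ 2≤q₂ _ = begin-strict
      (a ℕ.* 1 ℕ.+ b ℕ.* 1) ℕ.+ (a ℕ.* 1 ℕ.+ b ℕ.* 1)  ≡⟨ lhs a b ⟩
      (a ℕ.+ a) ℕ.+ (b ℕ.+ b)                          <⟨ ℕ.+-mono-<-≤ (ℕ.m<n+m (a ℕ.+ a) (p-pos 0)) (ℕ.+-monoʳ-≤ b (p-mono 1)) ⟩
      (a ℕ.+ (a ℕ.+ a)) ℕ.+ (b ℕ.+ c)                  ≡⟨ rhs a b c ⟩
      a ℕ.* 1 ℕ.+ (a ℕ.* 2 ℕ.+ (b ℕ.* 1 ℕ.+ c ℕ.* 1))  ≤⟨ ℕ.+-monoʳ-≤ (a ℕ.* 1) (ℕ.+-monoˡ-≤ _ (ℕ.*-monoʳ-≤ a 2≤q₂)) ⟩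
      a ℕ.* 1 ℕ.+ (a ℕ.* q 2 ℕ.+ (b ℕ.* 1 ℕ.+ c ℕ.* 1)) ∎
      where
      lhs : ∀ a b → (a ℕ.* 1 ℕ.+ b ℕ.* 1) ℕ.+ (a ℕ.* 1 ℕ.+ b ℕ.* 1) ≡ (a ℕ.+ a) ℕ.+ (b ℕ.+ b)
      lhs = solveℕ-∀
      rhs : ∀ a b c → (a ℕ.+ (a ℕ.+ a)) ℕ.+ (b ℕ.+ c) ≡ a ℕ.* 1 ℕ.+ (a ℕ.* 2 ℕ.+ (b ℕ.* 1 ℕ.+ c ℕ.* 1))
      rhs = solveℕ-∀
    -- Here `b * s` already pays for `b * 2`, and the positive term `c` gives strictness.
    base s@(suc (suc _)) _ _ 2s≤ = begin-strict
      (a ℕ.* s ℕ.+ b ℕ.* 1) ℕ.+ (a ℕ.* s ℕ.+ b ℕ.* 1)    ≡⟨ lhs a b s ⟩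
      a ℕ.* (s ℕ.+ s) ℕ.+ b ℕ.* 2                        <⟨ ℕ.m<m+n _ (p-pos 2) ⟩
      a ℕ.* (s ℕ.+ s) ℕ.+ b ℕ.* 2 ℕ.+ c                  ≤⟨ ℕ.+-monoˡ-≤ c (ℕ.+-mono-≤ (ℕ.*-monoʳ-≤ a (ℕ.≤-trans 2s≤ (ℕ.≤-reflexive (≡.cong (ℕ._+ q 2) q₀)))) (ℕ.*-monoʳ-≤ b (s≤s (s≤s z≤n)))) ⟩
      a ℕ.* (1 ℕ.+ q 2) ℕ.+ b ℕ.* s ℕ.+ c                ≡⟨ rhs a b c s (q 2) ⟩
      a ℕ.* 1 ℕ.+ (a ℕ.* q 2 ℕ.+ (b ℕ.* s ℕ.+ c ℕ.* 1))  ∎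
      where
      lhs : ∀ a b s → (a ℕ.* s ℕ.+ b ℕ.* 1) ℕ.+ (a ℕ.* s ℕ.+ b ℕ.* 1) ≡ a ℕ.* (s ℕ.+ s) ℕ.+ b ℕ.* 2
      lhs = solveℕ-∀
      rhs : ∀ a b c s t → a ℕ.* (1 ℕ.+ t) ℕ.+ b ℕ.* s ℕ.+ c ≡ a ℕ.* 1 ℕ.+ (a ℕ.* t ℕ.+ (b ℕ.* s ℕ.+ c ℕ.* 1))
      rhs = solveℕ-∀
  convolution-convex p p-pos p-mono (suc n) = begin-strict
    (a ℕ.* q (2 ℕ.+ n) ℕ.+ C 1) ℕ.+ (a ℕ.* q (2 ℕ.+ n) ℕ.+ C 1)
      ≡⟨ lhs a (q (2 ℕ.+ n)) (C 1) ⟩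
    a ℕ.* (q (2 ℕ.+ n) ℕ.+ q (2 ℕ.+ n)) ℕ.+ (C 1 ℕ.+ C 1)
      <⟨ ℕ.+-mono-≤-< (ℕ.*-monoʳ-≤ a (q-convex (suc n))) (convolution-convex (p ∘ suc) (p-pos ∘ suc) (p-mono ∘ suc) n) ⟩
    a ℕ.* (q (1 ℕ.+ n) ℕ.+ q (3 ℕ.+ n)) ℕ.+ (C 0 ℕ.+ C 2)
      ≡⟨ rhs a (q (1 ℕ.+ n)) (q (3 ℕ.+ n)) (C 0) (C 2) ⟩
    (a ℕ.* q (1 ℕ.+ n) ℕ.+ C 0) ℕ.+ (a ℕ.* q (3 ℕ.+ n) ℕ.+ C 2) ∎
    where
    open ℕ.≤-Reasoning
    a = p 0
    C : ℕ → ℕ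
    C i = convolution (p ∘ suc) q (i ℕ.+ n)
    lhs : ∀ a u c → (a ℕ.* u ℕ.+ c) ℕ.+ (a ℕ.* u ℕ.+ c) ≡ a ℕ.* (u ℕ.+ u) ℕ.+ (c ℕ.+ c)
    lhs = solveℕ-∀
    rhs : ∀ a u v c d → a ℕ.* (u ℕ.+ v) ℕ.+ (c ℕ.+ d) ≡ (a ℕ.* u ℕ.+ c) ℕ.+ (a ℕ.* v ℕ.+ d)
    rhs = solveℕ-∀

Δ-monotone⇒convex : ∀ (q : ℕ → ℕ) → (∀ n → 2 ℕ.≤ n → Δ q (pred n) ℤ.≤ Δ q n) →
                    ∀ n → q (suc n) ℕ.+ q (suc n) ℕ.≤ q n ℕ.+ q (suc (suc n))
Δ-monotone⇒convex q Δ-mono n = ℤ.drop‿+≤+ (begin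
  + (b ℕ.+ b)                            ≡⟨ lhs (+ b) (+ a) ⟩
  + b ℤ.- + a ℤ.+ (+ a ℤ.+ + b)          ≤⟨ ℤ.+-monoˡ-≤ (+ a ℤ.+ + b) (≡.subst₂ ℤ._≤_ (≡.sym (ℤ.m-n≡m⊖n b a)) (≡.sym (ℤ.m-n≡m⊖n c b)) (Δ-mono (suc (suc n)) (s≤s (s≤s z≤n)))) ⟩
  + c ℤ.- + b ℤ.+ (+ a ℤ.+ + b)          ≡⟨ rhs (+ a) (+ b) (+ c) ⟩
  + (a ℕ.+ c)                            ∎)
  where
  open ℤ.≤-Reasoning
  a = q n
  b = q (suc n)
  c = q (suc (suc n))
  lhs : ∀ b a → b ℤ.+ b ≡ b ℤ.- a ℤ.+ (a ℤ.+ b)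
  lhs = solve-∀
  rhs : ∀ a b c → c ℤ.- b ℤ.+ (a ℤ.+ b) ≡ a ℤ.+ c
  rhs = solve-∀

-- Monotonicity and first values of the rank sizes of a differential poset

module RankSizes {a ℓ₁ ℓ₂} {P : Poset a ℓ₁ ℓ₂} {r} (d : IsDifferential P r) where
  open IsDifferential d
  open Poset P
  open Covers d1
  open LevelMatrices d1

  -- The commutation relation makes `D ∙ Dᵀ` positive definite. At rank 0 the missing map from below
  -- is represented by a matrix without rows.
  rankSize-mono : ∀ n → rankSize n ℕ.≤ rankSize (suc n)
  rankSize-mono zero = rows≤columns {l = 0} r-positive (downMatrix 0) ℤM.𝟘
    (ℤM.≋-trans (downMatrix-base {+ r} (commutes d)) (ℤM.pointwise λ i j → ≡.sym (ℤ.+-identityˡ (ℤM.entry (ℤM.scalar (+ r)) i j))))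
  rankSize-mono (suc n) = rows≤columns r-positive (downMatrix (suc n)) (downMatrix n) (downMatrix-commute {+ r} (commutes d) n)

  0̂≈ : ∀ {x} → rank x ≡ 0 → 0̂ ≈ x
  0̂≈ {x} x₀ with ≈-dec d1 0̂ x
  ... | yes e = e
  ... | no ≉ = contradiction (≡.subst (rank 0̂ ℕ.<_) x₀ (rank-mono (0̂-minimum x , ≉))) ℕ.n≮0

  ⋖-rank₁ : ∀ {x y} → rank x ≡ 0 → rank y ≡ 1 → _⋖_ P x y
  ⋖-rank₁ {x} {y} x₀ y₁ =
    (trans (reflexive (Eq.sym (0̂≈ x₀))) (0̂-minimum y) , λ x≈y → contradiction (≡.trans (≡.sym x₀) (≡.trans (rank-cong x≈y) y₁)) λ ()) ,
    λ z (x<z , z<y) → ℕ.<⇒≱ (≡.subst₂ ℕ._<_ x₀ ≡.refl (rank-mono x<z)) (ℕ.≤-pred (≡.subst (rank z ℕ.<_) y₁ (rank-mono z<y)))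

  rankSize₀ : rankSize 0 ≡ 1
  rankSize₀ = ℤ.+-injective (≡.trans (≡.sym (∑ᴸ-1 (λ _ → 1ℤ) (level 0) (All.universal (λ _ → ≡.refl) (level 0))))
    (∑ᴸ-support {λ _ → 1ℤ} (λ _ → ≡.refl) {level 0} {0̂ ∷ []} (level-unique 0) ([] ∷ [])
      (λ x x∈ → inj₂ (here (Eq.sym (0̂≈ (rank-∈level x∈)))))
      λ { y (here y≈) → inj₂ (∈level (≡.trans (rank-cong y≈) rank-0̂)) }))

  private
    all-one : ∀ x xs → All (λ z → [ x ⋖ z ] ≡ 1ℤ) xs → ∑ᴸ (λ z → [ x ⋖ z ] ℤ.* [ x ⋖ z ]) xs ≡ + length xs
    all-one x xs ones = ∑ᴸ-1 _ xs (All.map (λ e → ≡.cong₂ ℤ._*_ e e) ones)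

  -- The minimum covers nothing, so it has `r` upper covers, and every element of rank 1 is one of
  -- them.
  rankSize₁ : rankSize 1 ≡ r
  rankSize₁ = ℤ.+-injective (begin
    + rankSize 1                      ≡⟨ all-one 0̂ (level 1) (All.tabulateₛ Eq.setoid λ {z} z∈ → indicator-yes (⋖-dec d1 0̂ z) (⋖-rank₁ rank-0̂ (rank-∈level z∈))) ⟨
    ∑ᴸ f (level 1)                    ≡⟨ ≡.cong (λ n → ∑ᴸ f (level (suc n))) rank-0̂ ⟨
    ↑count 0̂ 0̂                        ≡⟨ ↑count≡↓count d 0̂ 0̂ ⟩
    ↓count 0̂ 0̂ ℤ.+ + r ℤ.* [ 0̂ ≈ 0̂ ]  ≡⟨ ≡.cong₂ (λ n u → ∑ᴸ (λ z → [ z ⋖ 0̂ ] ℤ.* [ z ⋖ 0̂ ]) (levelBelow n) ℤ.+ + r ℤ.* u) rank-0̂ (indicator-yes (≈-dec d1 0̂ 0̂) Eq.refl) ⟩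
    0ℤ ℤ.+ + r ℤ.* 1ℤ                 ≡⟨ ≡.trans (ℤ.+-identityˡ _) (ℤ.*-identityʳ (+ r)) ⟩
    + r                               ∎)
    where
    open ≡.≡-Reasoning
    f = λ z → [ 0̂ ⋖ z ] ℤ.* [ 0̂ ⋖ z ]

  -- An element of rank 1 exists because `r` is positive. It covers exactly the minimum, so it is
  -- covered by `1 + r` elements of rank 2.
  rankSize₂ : suc r ℕ.≤ rankSize 2
  rankSize₂ = ℤ.drop‿+≤+ (begin
    + (1 ℕ.+ r)                         ≡⟨ ≡.cong₂ ℤ._+_ ↓≡1 (≡.trans (≡.cong (λ u → + r ℤ.* u) (indicator-yes (≈-dec d1 x x) Eq.refl)) (ℤ.*-identityʳ (+ r))) ⟨
    ↓count x x ℤ.+ + r ℤ.* [ x ≈ x ]    ≡⟨ ↑count≡↓count d x x ⟨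
    ↑count x x                          ≡⟨ ≡.cong (λ n → ∑ᴸ (λ z → [ x ⋖ z ] ℤ.* [ x ⋖ z ]) (level (suc n))) x₁ ⟩
    ∑ᴸ (λ z → [ x ⋖ z ] ℤ.* [ x ⋖ z ]) (level 2) ≤⟨ squares≤length (λ z → ⋖-dec d1 x z) (level 2) ⟩
    + rankSize 2                        ∎)
    where
    open ℤ.≤-Reasoning
    x = basis 1 (≡.subst Fin (≡.sym rankSize₁) (Fin.fromℕ< r-positive))
    x₁ : rank x ≡ 1
    x₁ = rank-basis 1 _
    ↓≡1 : ↓count x x ≡ 1ℤ
    ↓≡1 = ≡.trans (≡.cong (λ n → ∑ᴸ (λ z → [ z ⋖ x ] ℤ.* [ z ⋖ x ]) (levelBelow n)) x₁)
      (≡.trans (∑ᴸ-1 _ (level 0) (All.tabulateₛ Eq.setoid λ {z} z∈ →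
        let e = indicator-yes (⋖-dec d1 z x) (⋖-rank₁ (rank-∈level z∈) x₁) in ≡.cong₂ ℤ._*_ e e)) (≡.cong +_ rankSize₀))
    squares≤length : ∀ {b} {B : Carrier → Set b} (B? : ∀ z → Dec (B z)) zs → ∑ᴸ (λ z → indicator (B? z) ℤ.* indicator (B? z)) zs ℤ.≤ + length zs
    squares≤length B? [] = ℤ.≤-refl
    squares≤length B? (z ∷ zs) = ℤ.+-mono-≤ (bit (B? z)) (squares≤length B? zs)
      where
      bit : ∀ {b} {B : Set b} (b? : Dec B) → indicator b? ℤ.* indicator b? ℤ.≤ 1ℤ
      bit (yes _) = ℤ.≤-refl
      bit (no _)  = +≤+ z≤n

  rankSize-positive : ∀ n → 1 ℕ.≤ rankSize n
  rankSize-positive zero    = ℕ.≤-reflexive (≡.sym rankSize₀)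
  rankSize-positive (suc n) = ℕ.≤-trans (rankSize-positive n) (rankSize-mono n)

-- The product poset as a ladder, and the conclusion

module _ {a ℓ₁ ℓ₂ b ℓ₃ ℓ₄} {P : Poset a ℓ₁ ℓ₂} {Q : Poset b ℓ₃ ℓ₄} {r s}
  (dP : IsDifferential P r) (dQ : IsDifferential Q s) where
  private
    module dP = IsDifferential dP
    module dQ = IsDifferential dQ
    module RP = RankSizes dP
    module RQ = RankSizes dQ
    T = ×-D1 dP.d1 dQ.d1
    open LevelMatrices T

  ladder : (∀ n → 2 ℕ.≤ n → Δ dQ.rankSize (pred n) ℤ.≤ Δ dQ.rankSize n) →
           DownMapsSurjective dP.d1 ⊎ DownMapsSurjective dQ.d1 → Ladder (D1.rankSize T) (r ℕ.+ s)
  ladder Δ-mono surjective = record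
    { down = downMatrix
    ; section = λ n → proj₁ (downMatrix-section solvable n)
    ; down∙section = λ n → proj₂ (downMatrix-section solvable n)
    ; base = downMatrix-base {+ (r ℕ.+ s)} T-commutes
    ; commute = downMatrix-commute {+ (r ℕ.+ s)} T-commutes
    ; t₀ = ≡.trans (t≡ 0) (≡.cong₂ ℕ._*_ RP.rankSize₀ RQ.rankSize₀)
    ; t₁ = first-step
    ; convex = λ n → ≡.subst₂ ℕ._<_ (≡.sym (≡.cong₂ ℕ._+_ (t≡ (suc n)) (t≡ (suc n)))) (≡.sym (≡.cong₂ ℕ._+_ (t≡ n) (t≡ (suc (suc n)))))
        (convolution-convex dQ.rankSize RQ.rankSize₀ (RQ.rankSize-positive 1)
          (ℕ.≤-trans (ℕ.≤-reflexive (≡.cong suc RQ.rankSize₁)) RQ.rankSize₂) (Δ-monotone⇒convex dQ.rankSize Δ-mono)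
          dP.rankSize RP.rankSize-positive RP.rankSize-mono n)
    }
    where
    solvable = ×-solvable dP.d1 dQ.d1 surjective
    T-commutes = ProductCovers.×-commutes dP.d1 dQ.d1 {+ r} {+ s} (commutes dP) (commutes dQ)
    t≡ : ∀ n → D1.rankSize T n ≡ convolution dP.rankSize dQ.rankSize n
    t≡ = length-concat-products (Covers.level dP.d1) (Covers.level dQ.d1)
    t₁≡ : D1.rankSize T 1 ≡ r ℕ.+ s
    t₁≡ = ≡.trans (t≡ 1) (≡.trans
      (≡.cong₂ ℕ._+_ (≡.cong₂ ℕ._*_ RP.rankSize₀ RQ.rankSize₁) (≡.cong₂ ℕ._*_ RP.rankSize₁ RQ.rankSize₀)) (lemma r s))
      where
      lemma : ∀ r s → 1 ℕ.* s ℕ.+ r ℕ.* 1 ≡ r ℕ.+ s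
      lemma = solveℕ-∀
    first-step : 2 ℕ.< D1.rankSize T 1 ⊎ r ℕ.+ s ≡ 2
    first-step = ⊎.map (λ 2<R → ≡.subst (2 ℕ.<_) (≡.sym t₁≡) 2<R) ≡.sym
      (ℕ.m≤n⇒m<n∨m≡n (ℕ.+-mono-≤ dP.r-positive dQ.r-positive))

mainTheorem7 : ∀ {a ℓ₁ ℓ₂ b ℓ₃ ℓ₄} (P : Poset a ℓ₁ ℓ₂) (Q : Poset b ℓ₃ ℓ₄) (r s : ℕ)
    (dP : IsDifferential P r) (dQ : IsDifferential Q s) →
    let open IsDifferential in
    (∀ n → 2 ℕ.≤ n → Δ (rankSize dQ) (pred n) ℤ.≤ Δ (rankSize dQ) n) →
    DownMapsSurjective (d1 dP) ⊎ DownMapsSurjective (d1 dQ) →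
    ∀ n → HasSmithNormalForm ℤ[x] ([DU_]+xI (×-D1 (d1 dP) (d1 dQ)) n)
mainTheorem7 P Q r s dP dQ Δ-mono surjective n = hasSmithNormalForm ℤ[x] constant-hom {M = M}
  (DiagonalForm-resp ℤ[x] constant-hom M≋ (form ℤ[x] constant-hom X evaluation (ladder dP dQ Δ-mono surjective) n 0))
  where
  open IsDifferential
  open Matrices ℤ[x]
  open CommutativeRing ℤ[x] using (+-cong; *-congʳ; refl; sym; trans; reflexive)
  T = ×-D1 (d1 dP) (d1 dQ)
  open LevelMatrices T using (matrixOf-DU; downMatrix)
  N = D1.rankSize T n
  M : Mat (fin N) (fin N)
  entry M = [DU_]+xI T n
  -- The induction is used at `c = 0`, where its scalar `x + 0` computes to `x`.
  M≋ : M ≋ BaseChange.mapᴹ constant-hom (downMatrix n ℤM.∙ downMatrix n ℤM.ᵀ) ⊞ scalar (X ℤPolynomial.+ₚ constant 0ℤ)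
  M≋ = pointwise λ i j → +-cong (reflexive (≡.cong constant (matrixOf-DU n i j)))
    (*-congʳ {δ {fin N} i j} {X} {X ℤPolynomial.+ₚ constant 0ℤ} refl)
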